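{- Let $a$ be a positive integer, $R = \mathbb{Z}[x,y,z]/(x^{2a},y^{2a},z^{2a})$ with its standard grading, and $m := 3a-2$. Let the cyclic group $C_3=\{1,\rho,\rho^2\}$ act on $R$ by the ring automorphism $\rho$ with $x\mapsto y$, $y\mapsto z$, $z\mapsto x$, and let $R^{C_3}$ be the invariant subring, with homogeneous components $R^{C_3}_r = R^{C_3}\cap R_r$ (free $\mathbb{Z}$-modules). Multiplication by $x+y+z$ restricts to a $\mathbb{Z}$-linear map $U_m|_{R^{C_3}}: R^{C_3}_m \to R^{C_3}_{m+1}$ between free $\mathbb{Z}$-modules of equal rank. Then its determinant (well defined up to sign) equals, up to sign, the number of cyclically symmetric plane partitions fitting in an $a \times a \times a$ box.
   Context: A plane partition fitting in an $a\times a\times a$ box may be identified with a set $S$ of unit cubes (points of $\{1,\dots,a\}^3$) that is an order ideal: if $(i,j,k)\in S$ and $(i',j',k')\in\{1,\dots,a\}^3$ with $i'\le i$, $j'\le j$, $k'\le k$, then $(i',j',k')\in S$ (equivalently, an array $(\pi_{i,j})_{1\le i,j\le a}$ with entries in $\{0,\dots,a\}$ weakly decreasing in rows and columns, with $S=\{(i,j,k): k\le \pi_{i,j}\}$). It is cyclically symmetric if $S$ is invariant under the coordinate permutation $(i,j,k)\mapsto(j,k,i)$. -}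

module Defs where

open import Data.Bool using (Bool; true; false; _∧_; _∨_; not; if_then_else_)
open import Data.Nat using (ℕ; zero; suc; _+_; _*_; _∸_; _≡ᵇ_; _<ᵇ_; _≤ᵇ_)
open import Data.Fin using (Fin; zero; suc; toℕ; punchIn)
open import Data.Integer using (ℤ; 0ℤ; 1ℤ; -1ℤ) renaming (_+_ to _+ℤ_; _*_ to _*ℤ_)
open import Data.List using (List; []; _∷_; [_]; map; concatMap; allFin; upTo; foldr; length; filterᵇ; lookup)
open import Data.Bool.ListAction using (and)
open import Data.Maybe using (Maybe; just; nothing)
open import Data.Product using (_×_; _,_)

sumℤ : List ℤ → ℤ
sumℤ = foldr _+ℤ_ 0ℤ

sgn : ℕ → ℤ
sgn zero          = 1ℤ
sgn (suc zero)    = -1ℤ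
sgn (suc (suc j)) = sgn j

det : (n : ℕ) → (Fin n → Fin n → ℤ) → ℤ
det zero    M = 1ℤ
det (suc n) M =
  sumℤ (map (λ j → sgn (toℕ j) *ℤ (M zero j *ℤ det n (λ r c → M (suc r) (punchIn j c))))
            (allFin (suc n)))

-- The ring R = ℤ[x,y,z]/(x^{2a},y^{2a},z^{2a}).
-- A monomial x^i y^j z^k is its exponent triple (i , j , k);
-- an element of R is its coefficient function on exponent triples,
-- supported on the box 0 ≤ i,j,k < 2a.

Mon : Set
Mon = ℕ × ℕ × ℕ

Elem : Set
Elem = Mon → ℤ

inBox : ℕ → Mon → Bool
inBox a (i , j , k) = (i <ᵇ 2 * a) ∧ (j <ᵇ 2 * a) ∧ (k <ᵇ 2 * a)

deg : Mon → ℕ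
deg (i , j , k) = i + j + k

mulX mulY mulZ : ℕ → Elem → Elem
mulX a f (i , j , k) = if inBox a (i , j , k) ∧ (1 ≤ᵇ i) then f (i ∸ 1 , j , k) else 0ℤ
mulY a f (i , j , k) = if inBox a (i , j , k) ∧ (1 ≤ᵇ j) then f (i , j ∸ 1 , k) else 0ℤ
mulZ a f (i , j , k) = if inBox a (i , j , k) ∧ (1 ≤ᵇ k) then f (i , j , k ∸ 1) else 0ℤ

mulXYZ : ℕ → Elem → Elem
mulXYZ a f t = mulX a f t +ℤ mulY a f t +ℤ mulZ a f t

-- ρ : x ↦ y, y ↦ z, z ↦ x sends x^i y^j z^k to x^k y^i z^j
ρ : Mon → Mon
ρ (i , j , k) = (k , i , j)

_==ᵐ_ : Mon → Mon → Bool
(i , j , k) ==ᵐ (i' , j' , k') = (i ≡ᵇ i') ∧ (j ≡ᵇ j') ∧ (k ≡ᵇ k')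

_<ˡ_ : Mon → Mon → Bool
(i , j , k) <ˡ (i' , j' , k') =
  (i <ᵇ i') ∨ ((i ≡ᵇ i') ∧ ((j <ᵇ j') ∨ ((j ≡ᵇ j') ∧ (k <ᵇ k'))))

_≤ˡ_ : Mon → Mon → Bool
s ≤ˡ t = (s <ˡ t) ∨ (s ==ᵐ t)

orbitSum : Mon → Elem
orbitSum t u = if (u ==ᵐ t) ∨ (u ==ᵐ ρ t) ∨ (u ==ᵐ ρ (ρ t)) then 1ℤ else 0ℤ

canonical : Mon → Bool
canonical t = (t ≤ˡ ρ t) ∧ (t ≤ˡ ρ (ρ t))

-- ℤ-basis of R^{C₃}_r : orbit sums of the canonical monomials of degree r
-- in the box (listed by their canonical representatives)
invBasis : ℕ → ℕ → List Mon
invBasis a r =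
  filterᵇ (λ t → (deg t ≡ᵇ r) ∧ canonical t)
    (concatMap (λ i → concatMap (λ j → map (λ k → (i , j , k)) (upTo (2 * a)))
                                 (upTo (2 * a)))
               (upTo (2 * a)))

-- coordinate of an invariant element g on the basis vector orbitSum t
-- (t canonical): the orbit sums have disjoint supports with coefficient 1,
-- so this is the coefficient of the monomial t in g.
nth : {A : Set} → List A → ℕ → Maybe A
nth []       _       = nothing
nth (x ∷ xs) zero    = just x
nth (x ∷ xs) (suc n) = nth xs n

coordAt : List Mon → ℕ → Elem → ℤ
coordAt B p g with nth B p
... | just t  = g t
... | nothing = 0ℤ

-- The matrix of U_m restricted to R^{C₃}_m → R^{C₃}_{m+1} w.r.t. the
-- orbit-sum bases; columns indexed by the domain basis, rows by the
-- codomain basis (of the same size, see the theorem).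
Umat : (a m : ℕ) → Fin (length (invBasis a m)) → Fin (length (invBasis a m)) → ℤ
Umat a m p q = coordAt (invBasis a (suc m)) (toℕ p) (mulXYZ a (orbitSum (lookup (invBasis a m) q)))

-- Cyclically symmetric plane partitions in an a×a×a box, as subsets S
-- of {1..a}³ (here Fin a, 0-based), given by their indicator functions.

funs : {A : Set} → List A → (n : ℕ) → List (Fin n → A)
funs xs zero    = [ (λ ()) ]
funs xs (suc n) =
  concatMap (λ x → map (λ f → λ { zero → x ; (suc i) → f i }) (funs xs n)) xs

Cube : ℕ → Set
Cube a = Fin a → Fin a → Fin a → Bool

allCubes : (a : ℕ) → List (Cube a)
allCubes a = funs (funs (funs (true ∷ false ∷ []) a) a) a

allFinᵇ : {n : ℕ} → (Fin n → Bool) → Bool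
allFinᵇ {n} p = and (map p (allFin n))

_≤ᶠ_ : {n : ℕ} → Fin n → Fin n → Bool
i ≤ᶠ j = toℕ i ≤ᵇ toℕ j

_⇒ᵇ_ : Bool → Bool → Bool
b ⇒ᵇ c = not b ∨ c

_⇔ᵇ_ : Bool → Bool → Bool
b ⇔ᵇ c = (b ⇒ᵇ c) ∧ (c ⇒ᵇ b)

isOrderIdeal : {a : ℕ} → Cube a → Bool
isOrderIdeal S =
  allFinᵇ λ i → allFinᵇ λ j → allFinᵇ λ k →
  allFinᵇ λ i' → allFinᵇ λ j' → allFinᵇ λ k' →
    (S i j k ∧ (i' ≤ᶠ i) ∧ (j' ≤ᶠ j) ∧ (k' ≤ᶠ k)) ⇒ᵇ S i' j' k'

isCyclic : {a : ℕ} → Cube a → Bool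
isCyclic S = allFinᵇ λ i → allFinᵇ λ j → allFinᵇ λ k → S i j k ⇔ᵇ S j k i

cspp : ℕ → ℕ
cspp a = length (filterᵇ (λ S → isOrderIdeal S ∧ isCyclic S) (allCubes a))

{-# OPTIONS --safe #-}

-- Every C₃-orbit of monomials of degree 3a - 2 or 3a - 1 in the box has exactly one member with first
-- exponent below a and last exponent at least a, and these form an a × a rhombus. In these coordinates
-- the matrix is a unitriangular matrix plus a matrix that glues two sides of the rhombus. Inverting the
-- unitriangular part, whose inverse has signed binomial entries, leaves the a × a determinant
-- det (δ p x + C(p + x, x)), which is the sum of the principal minors of the Pascal matrix. By Pascal's
-- rule and multilinearity a minor with rows E and columns G is the number of chains of interlacing sets
-- starting at E in which the exits are prescribed by G. For E = G these chains are the level sets of the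
-- height function of a cyclically symmetric plane partition, h(c, t) = #{x : (x, x + c, x + t) ∈ S}: the
-- c-th set consists of the t with h(c, t) ≠ h(c, t + 1), and cyclic symmetry is h(c, 0) = h(0, c).
module Submission where

open import Defs
open import Data.Nat using (ℕ; zero; suc; _≤_; _*_; _∸_)
import Data.Nat as ℕ
import Data.Nat.Properties as ℕ
open import Data.Nat.Tactic.RingSolver using () renaming (solve-∀ to ℕ-solve-∀)
open import Data.Integer using (ℤ; 0ℤ; 1ℤ; -1ℤ; _+_; ∣_∣) renaming (_*_ to infixl 7 _·_)
import Data.Integer.Properties as ℤ
import Data.Integer as ℤ using (+_)
open import Data.Integer.Tactic.RingSolver using (solve-∀)
open import Data.Fin using (Fin; zero; suc; toℕ; fromℕ<; punchIn)
open import Data.Fin.Properties using (toℕ<n; toℕ-fromℕ<; toℕ-injective)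
open import Data.Bool.ListAction using (and)
open import Data.List using (List; []; _∷_; map; concatMap; _++_; _∷ʳ_; length; tabulate; allFin; lookup; upTo; filterᵇ)
import Data.List.Properties as List
open import Data.List.Membership.Propositional using (_∈_; find; lose)
open import Data.List.Membership.Propositional.Properties using (∈-++⁻; ∈-++⁺ˡ; ∈-++⁺ʳ; ∈-map⁺; ∈-map⁻; ∈-∃++; ∈-concatMap⁺; ∈-concatMap⁻; ∈-upTo⁺; ∈-upTo⁻; ∈-allFin; ∈-filter⁺; ∈-filter⁻)
open import Data.List.Relation.Unary.All as All using (All; []; _∷_)
open import Data.List.Relation.Unary.Any as Any using (Any; here; there)
import Data.List.Relation.Unary.Any.Properties as Any
open import Data.List.Relation.Unary.Unique.Propositional using (Unique)
import Data.List.Relation.Unary.Unique.Propositional.Properties as Unique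
open import Data.List.Relation.Binary.Pointwise as Pointwise using (Pointwise; []; _∷_)
open import Data.List.Relation.Binary.Permutation.Propositional using (_↭_; refl; prep; swap; trans; ↭-sym)
import Data.List.Relation.Binary.Permutation.Propositional.Properties as ↭
import Data.List.Relation.Unary.All.Properties as All
open import Data.List.Relation.Unary.AllPairs as AllPairs using (AllPairs; []; _∷_)
import Data.List.Relation.Unary.AllPairs.Properties as AllPairs
open import Data.Product using (Σ; ∃; _×_; _,_; proj₁; proj₂)
open import Data.Product.Properties using (≡-dec)
open import Data.Bool as Bool using (Bool; true; false; _∧_; _∨_; if_then_else_)
open import Data.Bool.Properties using (T-∧; T-∨; T-≡)
open import Data.Empty using (⊥)
open import Function.Bundles using (module Equivalence)
open Equivalence using (to; from)
open import Relation.Binary.Definitions using (Symmetric)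
open import Relation.Nullary using (Dec; yes; no; ¬_; contradiction)
open import Relation.Nullary.Decidable using (_⊎-dec_; ⌊_⌋; toWitness; fromWitness)
open import Data.Maybe using (just; nothing)
open import Data.Sum using (_⊎_; inj₁; inj₂)
open import Function using (_∘_; id)
open import Relation.Binary.PropositionalEquality using (_≡_; _≢_; refl; sym; cong; cong₂; subst; subst₂; module ≡-Reasoning)
import Relation.Binary.PropositionalEquality as ≡

-- The given determinant recurses over `Fin`, while the argument keeps changing what indexes rows
-- and columns: basis monomials, cells of the rhombus, numbers. Hence `D`, which takes lists of
-- covectors and of labels of any type; reordering these lists costs only a sign, which the absolute
-- value absorbs. The unitriangular part is the identity plus two unit moves on the rhombus, so its
-- inverse counts lattice paths with signs. The glue alters only the rows on the side q = 0, and
-- there it adds a unit vector on the side p = 0. After division by the unitriangular part the other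
-- rows are unit vectors, and paths from (0, p) to (x, 0) remain: C(p + x, x) of them, with sign
-- (-1)^(p + x), a sign that row and column scalings remove. The final count compares cubes, which
-- are functions and can be recognised as equal only pointwise, with chains, which are lists. The
-- correspondence is therefore a relation, having the same height function, and not a pair of
-- inverse maps.

private variable
  A B : Set

-- Finite sums

∑ : List A → (A → ℤ) → ℤ
∑ xs f = sumℤ (map f xs)

∑-cong : ∀ (xs : List A) {f g : A → ℤ} → (∀ {x} → x ∈ xs → f x ≡ g x) → ∑ xs f ≡ ∑ xs g
∑-cong []       eq = refl
∑-cong (x ∷ xs) eq = cong₂ _+_ (eq (here refl)) (∑-cong xs (eq ∘ there))

∑-zero : ∀ (xs : List A) {f : A → ℤ} → (∀ {x} → x ∈ xs → f x ≡ 0ℤ) → ∑ xs f ≡ 0ℤ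
∑-zero []       eq = refl
∑-zero (x ∷ xs) eq = cong₂ _+_ (eq (here refl)) (∑-zero xs (eq ∘ there))

∑-map : ∀ (h : A → B) xs (f : B → ℤ) → ∑ (map h xs) f ≡ ∑ xs (f ∘ h)
∑-map h xs f = cong sumℤ (sym (List.map-∘ xs))

∑-++ : ∀ (xs : List A) {ys} (f : A → ℤ) → ∑ (xs ++ ys) f ≡ ∑ xs f + ∑ ys f
∑-++ []       f = sym (ℤ.+-identityˡ _)
∑-++ (x ∷ xs) f = ≡.trans (cong (f x +_) (∑-++ xs f)) (sym (ℤ.+-assoc (f x) _ _))

∑-+ : ∀ (xs : List A) (f g : A → ℤ) → ∑ xs (λ x → f x + g x) ≡ ∑ xs f + ∑ xs g
∑-+ []       f g = refl
∑-+ (x ∷ xs) f g = ≡.trans (cong (λ z → f x + g x + z) (∑-+ xs f g)) (shuffle (f x) (g x) _ _)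
  where
  shuffle : ∀ p q r s → p + q + (r + s) ≡ p + r + (q + s)
  shuffle = solve-∀

∑-* : ∀ (xs : List A) y (f : A → ℤ) → ∑ xs (λ x → y · f x) ≡ y · ∑ xs f
∑-* []       y f = sym (ℤ.*-zeroʳ y)
∑-* (x ∷ xs) y f = ≡.trans (cong (y · f x +_) (∑-* xs y f)) (sym (ℤ.*-distribˡ-+ y _ _))

-- Exterior products

-- An alternating form is represented by its values on lists of coordinates, so that D R is the exterior
-- product of the covectors in R, and D R C is a determinant when R and C have the same length.
wedge : (B → ℤ) → (List B → ℤ) → List B → ℤ
wedge v ω []      = 0ℤ
wedge v ω (c ∷ C) = v c · ω C + -1ℤ · wedge v (λ C′ → ω (c ∷ C′)) C

D : List (B → ℤ) → List B → ℤ
D []      []      = 1ℤ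
D []      (_ ∷ _) = 0ℤ
D (v ∷ R) C       = wedge v (D R) C

-- These are the only lists at which `wedge v ω C` evaluates `ω`. Recording them allows entries to
-- be compared on the columns in `C` alone, and makes lengths drop by one in inductions.
data Delete {B : Set} : List B → List B → Set where
  here  : ∀ {c C} → Delete (c ∷ C) C
  there : ∀ {c C C′} → Delete C C′ → Delete (c ∷ C) (c ∷ C′)

Delete-length : ∀ {C C′ : List B} → Delete C C′ → length C ≡ suc (length C′)
Delete-length here      = refl
Delete-length (there d) = cong suc (Delete-length d)

Delete-⊆ : ∀ {C C′ : List B} → Delete C C′ → ∀ {c} → c ∈ C′ → c ∈ C
Delete-⊆ here      p         = there p
Delete-⊆ (there d) (here p)  = here p
Delete-⊆ (there d) (there p) = there (Delete-⊆ d p)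

wedge-cong : ∀ {v w : B → ℤ} {ω ψ : List B → ℤ} C → (∀ {c} → c ∈ C → v c ≡ w c) →
             (∀ {C′} → Delete C C′ → ω C′ ≡ ψ C′) → wedge v ω C ≡ wedge w ψ C
wedge-cong []      vw ωψ = refl
wedge-cong (c ∷ C) vw ωψ = cong₂ _+_ (cong₂ _·_ (vw (here refl)) (ωψ here))
  (cong (-1ℤ ·_) (wedge-cong C (vw ∘ there) (ωψ ∘ there)))

wedge-congʳ : ∀ (v : B → ℤ) {ω ψ : List B → ℤ} C → (∀ C′ → ω C′ ≡ ψ C′) → wedge v ω C ≡ wedge v ψ C
wedge-congʳ v C ωψ = wedge-cong C (λ _ → refl) (λ _ → ωψ _)

D-cong : ∀ {R S : List (B → ℤ)} C → Pointwise (λ v w → ∀ {c} → c ∈ C → v c ≡ w c) R S → D R C ≡ D S C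
D-cong C []         = refl
D-cong C (vw ∷ R≈S) = wedge-cong C vw (λ d → D-cong _ (restrict d R≈S))
  where
  restrict : ∀ {C C′} → Delete C C′ → ∀ {R S : List (B → ℤ)} →
    Pointwise (λ v w → ∀ {c} → c ∈ C → v c ≡ w c) R S → Pointwise (λ v w → ∀ {c} → c ∈ C′ → v c ≡ w c) R S
  restrict d []         = []
  restrict d (vw ∷ R≈S) = (vw ∘ Delete-⊆ d) ∷ restrict d R≈S

wedge-zeroˡ : ∀ {v : B → ℤ} (ω : List B → ℤ) C → (∀ {c} → c ∈ C → v c ≡ 0ℤ) → wedge v ω C ≡ 0ℤ
wedge-zeroˡ ω []      v0 = refl
wedge-zeroˡ ω (c ∷ C) v0 rewrite v0 (here refl) | wedge-zeroˡ (ω ∘ (c ∷_)) C (v0 ∘ there) = refl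

wedge-zeroʳ : ∀ (v : B → ℤ) {ω : List B → ℤ} C → (∀ {C′} → Delete C C′ → ω C′ ≡ 0ℤ) → wedge v ω C ≡ 0ℤ
wedge-zeroʳ v         []      ω0 = refl
wedge-zeroʳ v {ω = ω} (c ∷ C) ω0
  rewrite ω0 here | wedge-zeroʳ v {ω = ω ∘ (c ∷_)} C (ω0 ∘ there) | ℤ.*-zeroʳ (v c) = refl

wedge-linearʳ : ∀ v x y (ω ψ : List B → ℤ) C →
  wedge v (λ C′ → x · ω C′ + y · ψ C′) C ≡ x · wedge v ω C + y · wedge v ψ C
wedge-linearʳ v x y ω ψ []      = zeros x y
  where
  zeros : ∀ x y → 0ℤ ≡ x · 0ℤ + y · 0ℤ
  zeros = solve-∀
wedge-linearʳ v x y ω ψ (c ∷ C)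
  rewrite wedge-linearʳ v x y (ω ∘ (c ∷_)) (ψ ∘ (c ∷_)) C = shuffle (v c) x y (ω C) (ψ C) _ _
  where
  shuffle : ∀ u x y p q r s → u · (x · p + y · q) + -1ℤ · (x · r + y · s) ≡ x · (u · p + -1ℤ · r) + y · (u · q + -1ℤ · s)
  shuffle = solve-∀

wedge-+ʳ : ∀ v (ω ψ : List B → ℤ) C → wedge v (λ C′ → ω C′ + ψ C′) C ≡ wedge v ω C + wedge v ψ C
wedge-+ʳ v ω ψ []      = refl
wedge-+ʳ v ω ψ (c ∷ C) rewrite wedge-+ʳ v (ω ∘ (c ∷_)) (ψ ∘ (c ∷_)) C = shuffle (v c) (ω C) (ψ C) _ _
  where
  shuffle : ∀ u p q r s → u · (p + q) + -1ℤ · (r + s) ≡ u · p + -1ℤ · r + (u · q + -1ℤ · s)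
  shuffle = solve-∀

wedge-*ʳ : ∀ v x (ω : List B → ℤ) C → wedge v (λ C′ → x · ω C′) C ≡ x · wedge v ω C
wedge-*ʳ v x ω []      = sym (ℤ.*-zeroʳ x)
wedge-*ʳ v x ω (c ∷ C) rewrite wedge-*ʳ v x (ω ∘ (c ∷_)) C = shuffle (v c) x (ω C) _
  where
  shuffle : ∀ u x p r → u · (x · p) + -1ℤ · (x · r) ≡ x · (u · p + -1ℤ · r)
  shuffle = solve-∀

wedge-linearˡ : ∀ x v w (ω : List B → ℤ) C →
  wedge (λ c → x · v c + w c) ω C ≡ x · wedge v ω C + wedge w ω C
wedge-linearˡ x v w ω []      = cong (_+ 0ℤ) (sym (ℤ.*-zeroʳ x))
wedge-linearˡ x v w ω (c ∷ C) rewrite wedge-linearˡ x v w (ω ∘ (c ∷_)) C = shuffle x (v c) (w c) (ω C) _ _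
  where
  shuffle : ∀ x p q u r s → (x · p + q) · u + -1ℤ · (x · r + s) ≡ x · (p · u + -1ℤ · r) + (q · u + -1ℤ · s)
  shuffle = solve-∀

wedge-+ˡ : ∀ v w (ω : List B → ℤ) C → wedge (λ c → v c + w c) ω C ≡ wedge v ω C + wedge w ω C
wedge-+ˡ v w ω []      = refl
wedge-+ˡ v w ω (c ∷ C) rewrite wedge-+ˡ v w (ω ∘ (c ∷_)) C = shuffle (v c) (w c) (ω C) _ _
  where
  shuffle : ∀ p q u r s → (p + q) · u + -1ℤ · (r + s) ≡ p · u + -1ℤ · r + (q · u + -1ℤ · s)
  shuffle = solve-∀

wedge-∑ʳ : ∀ v (xs : List A) (ω : A → List B → ℤ) C →
  wedge v (λ C′ → ∑ xs (λ x → ω x C′)) C ≡ ∑ xs (λ x → wedge v (ω x) C)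
wedge-∑ʳ v []       ω C = wedge-zeroʳ v C (λ _ → refl)
wedge-∑ʳ v (x ∷ xs) ω C = ≡.trans (wedge-+ʳ v (ω x) _ C) (cong (wedge v (ω x) C +_) (wedge-∑ʳ v xs ω C))

-- Both sides delete two entries of `C`, in opposite orders. `ω` ranges over all functions on lists,
-- so that the induction can pass to `ω ∘ (c ∷_)`.
wedge-anticomm : ∀ v w (ω : List B → ℤ) C → wedge v (wedge w ω) C ≡ -1ℤ · wedge w (wedge v ω) C
wedge-anticomm v w ω []      = refl
wedge-anticomm v w ω (c ∷ C)
  rewrite wedge-linearʳ v (w c) -1ℤ ω (wedge w (ω ∘ (c ∷_))) C
        | wedge-linearʳ w (v c) -1ℤ ω (wedge v (ω ∘ (c ∷_))) C
        | wedge-anticomm v w (ω ∘ (c ∷_)) C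
        = shuffle (v c) (w c) _ _ _
  where
  shuffle : ∀ x y p q r → x · p + -1ℤ · (y · q + -1ℤ · (-1ℤ · r)) ≡ -1ℤ · (y · q + -1ℤ · (x · p + -1ℤ · r))
  shuffle = solve-∀

wedge-self : ∀ v (ω : List B → ℤ) C → wedge v (wedge v ω) C ≡ 0ℤ
wedge-self v ω []      = refl
wedge-self v ω (c ∷ C)
  rewrite wedge-linearʳ v (v c) -1ℤ ω (wedge v (ω ∘ (c ∷_))) C
        | wedge-self v (ω ∘ (c ∷_)) C = cancel (v c) _
  where
  cancel : ∀ x p → x · p + -1ℤ · (x · p + -1ℤ · 0ℤ) ≡ 0ℤ
  cancel = solve-∀

-- Deletions from `X` and from `Y` are independent, and each sign depends on one list only. This
-- exchanges expansion along a row with expansion along a column.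
wedge-wedge-comm : ∀ (v : A → ℤ) (w : B → ℤ) (Φ : List A → List B → ℤ) X Y →
  wedge v (λ X′ → wedge w (Φ X′) Y) X ≡ wedge w (λ Y′ → wedge v (λ X′ → Φ X′ Y′) X) Y
wedge-wedge-comm v w Φ []      Y = sym (wedge-zeroʳ w Y (λ _ → refl))
wedge-wedge-comm v w Φ (x ∷ X) Y
  rewrite wedge-wedge-comm v w (Φ ∘ (x ∷_)) X Y =
  sym (wedge-linearʳ w (v x) -1ℤ (Φ X) (λ Y′ → wedge v (λ X′ → Φ (x ∷ X′) Y′) X) Y)

-- The list of rows takes the place of the list of coordinates, and evaluation at `c` that of the
-- covector, so the same `wedge` expresses expansion along a column.
D-column : ∀ (R : List (B → ℤ)) c C → D R (c ∷ C) ≡ wedge (λ v → v c) (λ R′ → D R′ C) R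
D-column []      c C = refl
D-column (v ∷ R) c C = cong (λ z → v c · D R C + -1ℤ · z) (≡.trans
  (wedge-congʳ v C (λ C′ → D-column R c C′))
  (sym (wedge-wedge-comm (λ u → u c) v D R C)))

D-transpose : ∀ (R : List (B → ℤ)) C → D R C ≡ D (map (λ c v → v c) C) R
D-transpose []      []      = refl
D-transpose (v ∷ R) []      = refl
D-transpose R       (c ∷ C) = ≡.trans (D-column R c C) (wedge-congʳ _ R (λ R′ → D-transpose R′ C))

D-relabel : ∀ (f : A → B) R C → D (map (_∘ f) R) C ≡ D R (map f C)
D-relabel f []      []      = refl
D-relabel f []      (c ∷ C) = refl
D-relabel f (v ∷ R) C       = ≡.trans (wedge-congʳ (v ∘ f) C (λ C′ → D-relabel f R C′)) (go (D R) C)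
  where
  go : ∀ ω C → wedge (v ∘ f) (ω ∘ map f) C ≡ wedge v ω (map f C)
  go ω []      = refl
  go ω (c ∷ C) = cong (λ z → v (f c) · ω (map f C) + -1ℤ · z) (go (ω ∘ (f c ∷_)) C)

D-drop : ∀ {v : B → ℤ} R {c} C → v c ≡ 1ℤ → (∀ {c′} → c′ ∈ C → v c′ ≡ 0ℤ) → D (v ∷ R) (c ∷ C) ≡ D R C
D-drop {v = v} R {c} C vc v0 rewrite vc | wedge-zeroˡ (D R ∘ (c ∷_)) C v0 = unit (D R C)
  where
  unit : ∀ x → 1ℤ · x + -1ℤ · 0ℤ ≡ x
  unit = solve-∀

-- The sign is chosen before `C`, because `prep` has to pull one common sign out of all minors in
-- the expansion along its row.
D-swap-rows : ∀ {R S : List (B → ℤ)} → R ↭ S → (∀ C → D R C ≡ D S C) ⊎ (∀ C → D R C ≡ -1ℤ · D S C)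
D-swap-rows refl        = inj₁ (λ C → refl)
D-swap-rows (prep v p) with D-swap-rows p
... | inj₁ eq = inj₁ (λ C → wedge-congʳ v C eq)
... | inj₂ eq = inj₂ (λ C → ≡.trans (wedge-congʳ v C eq) (wedge-*ʳ v -1ℤ _ C))
D-swap-rows {S = S} (swap v w p) with D-swap-rows p
... | inj₁ eq = inj₂ (λ C → ≡.trans (wedge-congʳ v C (λ C′ → wedge-congʳ w C′ eq)) (wedge-anticomm v w _ C))
... | inj₂ eq = inj₁ λ C → begin
    wedge v (wedge w _) C                     ≡⟨ wedge-congʳ v C (λ C′ → ≡.trans (wedge-congʳ w C′ eq) (wedge-*ʳ w -1ℤ _ C′)) ⟩
    wedge v (λ C′ → -1ℤ · wedge w _ C′) C     ≡⟨ wedge-*ʳ v -1ℤ _ C ⟩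
    -1ℤ · wedge v (wedge w _) C               ≡⟨ cong (-1ℤ ·_) (wedge-anticomm v w _ C) ⟩
    -1ℤ · (-1ℤ · wedge w (wedge v _) C)       ≡⟨ involutive _ ⟩
    wedge w (wedge v _) C                     ∎
  where
  open ≡-Reasoning
  involutive : ∀ x → -1ℤ · (-1ℤ · x) ≡ x
  involutive = solve-∀
D-swap-rows (trans p q) with D-swap-rows p | D-swap-rows q
... | inj₁ e | inj₁ f = inj₁ (λ C → ≡.trans (e C) (f C))
... | inj₁ e | inj₂ f = inj₂ (λ C → ≡.trans (e C) (f C))
... | inj₂ e | inj₁ f = inj₂ (λ C → ≡.trans (e C) (cong (-1ℤ ·_) (f C)))
... | inj₂ e | inj₂ f = inj₁ (λ C → ≡.trans (e C) (≡.trans (cong (-1ℤ ·_) (f C)) (involutive _)))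
  where
  involutive : ∀ x → -1ℤ · (-1ℤ · x) ≡ x
  involutive = solve-∀

∣-1*∣ : ∀ x → ∣ -1ℤ · x ∣ ≡ ∣ x ∣
∣-1*∣ x = ≡.trans (ℤ.abs-* -1ℤ x) (ℕ.*-identityˡ ∣ x ∣)

∣D∣-↭-rows : ∀ {R S : List (B → ℤ)} → R ↭ S → ∀ C → ∣ D R C ∣ ≡ ∣ D S C ∣
∣D∣-↭-rows {S = S} p C with D-swap-rows p
... | inj₁ eq = cong ∣_∣ (eq C)
... | inj₂ eq = ≡.trans (cong ∣_∣ (eq C)) (∣-1*∣ (D S C))

∣D∣-↭-columns : ∀ (R : List (B → ℤ)) {C E} → C ↭ E → ∣ D R C ∣ ≡ ∣ D R E ∣
∣D∣-↭-columns R {C} {E} p = begin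
  ∣ D R C ∣                          ≡⟨ cong ∣_∣ (D-transpose R C) ⟩
  ∣ D (map (λ c v → v c) C) R ∣      ≡⟨ ∣D∣-↭-rows (↭.map⁺ _ p) R ⟩
  ∣ D (map (λ c v → v c) E) R ∣      ≡⟨ cong ∣_∣ (D-transpose R E) ⟨
  ∣ D R E ∣                          ∎
  where open ≡-Reasoning

-- Determinants of matrix products

linComb : (A → B → ℤ) → List A → (A → ℤ) → B → ℤ
linComb w K v c = ∑ K (λ k → v k · w k c)

-- Collecting the terms in which one of the covectors in R contributes its w k component.
D-linComb-∷ : ∀ (w : A → B → ℤ) k K R C →
  D (map (linComb w (k ∷ K)) R) C ≡
  D (map (linComb w K) R) C + wedge (w k) (λ C′ → wedge (λ v → v k) (λ R′ → D (map (linComb w K) R′) C′) R) C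
D-linComb-∷ w k K [] C =
  ≡.trans (sym (ℤ.+-identityʳ _)) (cong (D [] C +_) (sym (wedge-zeroʳ (w k) C (λ _ → refl))))
D-linComb-∷ w k K (v ∷ R) C = begin
  wedge (λ c → v k · w k c + u c) (D (map (linComb w (k ∷ K)) R)) C
    ≡⟨ wedge-linearˡ (v k) (w k) u _ C ⟩
  v k · wedge (w k) (D (map (linComb w (k ∷ K)) R)) C + wedge u (D (map (linComb w (k ∷ K)) R)) C
    ≡⟨ cong₂ (λ x y → v k · x + y) (split (w k)) (split u) ⟩
  v k · (wedge (w k) F C + wedge (w k) (wedge (w k) Q) C) + (wedge u F C + wedge u (wedge (w k) Q) C)
    -- Terms in which both `v` and another row contribute `w k` vanish.
    ≡⟨ cong₂ (λ x y → v k · (wedge (w k) F C + x) + (wedge u F C + y)) (wedge-self (w k) Q C) (wedge-anticomm u (w k) Q C) ⟩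
  v k · (wedge (w k) F C + 0ℤ) + (wedge u F C + -1ℤ · wedge (w k) (wedge u Q) C)
    ≡⟨ shuffle (v k) (wedge (w k) F C) (wedge u F C) (wedge (w k) (wedge u Q) C) ⟩
  wedge u F C + (v k · wedge (w k) F C + -1ℤ · wedge (w k) (wedge u Q) C)
    ≡⟨ cong (wedge u F C +_) (wedge-linearʳ (w k) (v k) -1ℤ F (wedge u Q) C) ⟨
  wedge u F C + wedge (w k) (λ C′ → v k · F C′ + -1ℤ · wedge u Q C′) C
    ≡⟨ cong (wedge u F C +_) (wedge-congʳ (w k) C (λ C′ → cong (λ z → v k · F C′ + -1ℤ · z)
         (wedge-wedge-comm (λ v′ → v′ k) u (λ R′ → D (map (linComb w K) R′)) R C′))) ⟨
  wedge u F C + wedge (w k) (λ C′ → wedge (λ v′ → v′ k) (λ R′ → D (map (linComb w K) R′) C′) (v ∷ R)) C ∎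
  where
  open ≡-Reasoning
  u = linComb w K v
  F = D (map (linComb w K) R)
  Q = λ C′ → wedge (λ v′ → v′ k) (λ R′ → D (map (linComb w K) R′) C′) R
  split : ∀ v′ → wedge v′ (D (map (linComb w (k ∷ K)) R)) C ≡ wedge v′ F C + wedge v′ (wedge (w k) Q) C
  split v′ = ≡.trans (wedge-congʳ v′ C (D-linComb-∷ w k K R)) (wedge-+ʳ v′ F (wedge (w k) Q) C)
  shuffle : ∀ x p q r → x · (p + 0ℤ) + (q + -1ℤ · r) ≡ q + (x · p + -1ℤ · r)
  shuffle = solve-∀

-- The rows lie in the span of fewer covectors than there are rows. In the induction, terms without
-- `w k` use the shorter `K`, and terms with it lose a row as well.
D-linComb-dependent : ∀ (w : A → B → ℤ) K R C → length K ℕ.< length R → D (map (linComb w K) R) C ≡ 0ℤ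
D-linComb-dependent w []      (v ∷ R) C _ = wedge-zeroˡ _ C (λ _ → refl)
D-linComb-dependent w (k ∷ K) R       C K<R = begin
  D (map (linComb w (k ∷ K)) R) C      ≡⟨ D-linComb-∷ w k K R C ⟩
  _                                    ≡⟨ cong₂ _+_ (D-linComb-dependent w K R C (ℕ.<-trans (ℕ.n<1+n _) K<R))
                                            (wedge-zeroʳ (w k) C (λ {C′} _ → wedge-zeroʳ _ R (λ {R′} d →
                                              D-linComb-dependent w K R′ C′ (ℕ.≤-pred (subst (suc (length K) ℕ.<_) (Delete-length d) K<R))))) ⟩
  0ℤ                                   ∎
  where open ≡-Reasoning

-- Multiplicativity of the determinant: the rows on the left form the product of the matrix of `R`
-- on `K` with the matrix of `w`. Terms that never use `w k` vanish by dependence; the others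
-- assemble to the expansion of `D R (k ∷ K)` along its first column.
D-linComb : ∀ (w : A → B → ℤ) K R C → length R ≡ length K → D (map (linComb w K) R) C ≡ D R K · D (map w K) C
D-linComb w []      []      C _   = sym (ℤ.*-identityˡ _)
D-linComb w (k ∷ K) R       C len = begin
  D (map (linComb w (k ∷ K)) R) C
    ≡⟨ D-linComb-∷ w k K R C ⟩
  D (map (linComb w K) R) C + wedge (w k) (λ C′ → wedge (λ v → v k) (λ R′ → D (map (linComb w K) R′) C′) R) C
    ≡⟨ cong₂ _+_ (D-linComb-dependent w K R C (ℕ.≤-reflexive (sym len)))
         (wedge-congʳ (w k) C (λ C′ → wedge-cong R (λ _ → refl) (λ {R′} d → ≡.trans
           (D-linComb w K R′ C′ (ℕ.suc-injective (≡.trans (sym (Delete-length d)) len))) (ℤ.*-comm (D R′ K) (D (map w K) C′))))) ⟩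
  0ℤ + wedge (w k) (λ C′ → wedge (λ v → v k) (λ R′ → D (map w K) C′ · D R′ K) R) C
    ≡⟨ ℤ.+-identityˡ _ ⟩
  wedge (w k) (λ C′ → wedge (λ v → v k) (λ R′ → D (map w K) C′ · D R′ K) R) C
    ≡⟨ wedge-congʳ (w k) C (λ C′ → ≡.trans (wedge-*ʳ _ (D (map w K) C′) _ R) (≡.trans
         (cong (D (map w K) C′ ·_) (sym (D-column R k K))) (ℤ.*-comm (D (map w K) C′) (D R (k ∷ K))))) ⟩
  wedge (w k) (λ C′ → D R (k ∷ K) · D (map w K) C′) C
    ≡⟨ wedge-*ʳ (w k) (D R (k ∷ K)) _ C ⟩
  D R (k ∷ K) · wedge (w k) (D (map w K)) C ∎
  where open ≡-Reasoning

sgn-suc : ∀ n → sgn (suc n) ≡ -1ℤ · sgn n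
sgn-suc zero          = refl
sgn-suc (suc zero)    = refl
sgn-suc (suc (suc n)) = sgn-suc n

sgn-square : ∀ n → sgn n · sgn n ≡ 1ℤ
sgn-square zero          = refl
sgn-square (suc zero)    = refl
sgn-square (suc (suc n)) = sgn-square n

D-front-row : ∀ R (v : B → ℤ) S C → D (R ++ v ∷ S) C ≡ sgn (length R) · D (v ∷ R ++ S) C
D-front-row []      v S C = sym (ℤ.*-identityˡ _)
D-front-row (u ∷ R) v S C = begin
  wedge u (D (R ++ v ∷ S)) C                                  ≡⟨ wedge-congʳ u C (D-front-row R v S) ⟩
  wedge u (λ C′ → sgn (length R) · D (v ∷ R ++ S) C′) C       ≡⟨ wedge-*ʳ u (sgn (length R)) _ C ⟩
  sgn (length R) · wedge u (wedge v (D (R ++ S))) C           ≡⟨ cong (sgn (length R) ·_) (wedge-anticomm u v _ C) ⟩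
  sgn (length R) · (-1ℤ · wedge v (wedge u (D (R ++ S))) C)   ≡⟨ shuffle (sgn (length R)) _ ⟩
  -1ℤ · sgn (length R) · wedge v (wedge u (D (R ++ S))) C     ≡⟨ cong (_· wedge v (wedge u (D (R ++ S))) C) (sgn-suc (length R)) ⟨
  sgn (suc (length R)) · wedge v (wedge u (D (R ++ S))) C     ∎
  where
  open ≡-Reasoning
  shuffle : ∀ x y → x · (-1ℤ · y) ≡ -1ℤ · x · y
  shuffle = solve-∀

D-front-column : ∀ (R : List (B → ℤ)) G c C → D R (G ++ c ∷ C) ≡ sgn (length G) · D R (c ∷ G ++ C)
D-front-column R G c C = begin
  D R (G ++ c ∷ C)                                        ≡⟨ D-transpose R (G ++ c ∷ C) ⟩
  D (map ev (G ++ c ∷ C)) R                               ≡⟨ cong (λ L → D L R) (List.map-++ ev G (c ∷ C)) ⟩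
  D (map ev G ++ ev c ∷ map ev C) R                       ≡⟨ D-front-row (map ev G) (ev c) (map ev C) R ⟩
  sgn (length (map ev G)) · D (ev c ∷ map ev G ++ map ev C) R ≡⟨ cong₂ (λ n L → sgn n · D (ev c ∷ L) R) (List.length-map ev G) (sym (List.map-++ ev G C)) ⟩
  sgn (length G) · D (map ev (c ∷ G ++ C)) R              ≡⟨ cong (sgn (length G) ·_) (D-transpose R (c ∷ G ++ C)) ⟨
  sgn (length G) · D R (c ∷ G ++ C)                       ∎
  where
  open ≡-Reasoning
  ev : B → (B → ℤ) → ℤ
  ev c v = v c

-- The row and the column have equally many predecessors, so moving both to the front costs the same
-- sign twice.
D-drop-middle : ∀ R {v : B → ℤ} S G {c} C → length R ≡ length G → v c ≡ 1ℤ → (∀ {c′} → c′ ∈ G ++ C → v c′ ≡ 0ℤ) →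
  D (R ++ v ∷ S) (G ++ c ∷ C) ≡ D (R ++ S) (G ++ C)
D-drop-middle R {v} S G {c} C len vc v0 = begin
  D (R ++ v ∷ S) (G ++ c ∷ C)                                 ≡⟨ D-front-row R v S (G ++ c ∷ C) ⟩
  sgn (length R) · D (v ∷ R ++ S) (G ++ c ∷ C)                ≡⟨ cong (sgn (length R) ·_) (D-front-column (v ∷ R ++ S) G c C) ⟩
  sgn (length R) · (sgn (length G) · D (v ∷ R ++ S) (c ∷ G ++ C)) ≡⟨ cong₂ (λ n x → sgn n · (sgn (length G) · x)) len (D-drop (R ++ S) (G ++ C) vc v0) ⟩
  sgn (length G) · (sgn (length G) · D (R ++ S) (G ++ C))     ≡⟨ ℤ.*-assoc (sgn (length G)) _ _ ⟨
  sgn (length G) · sgn (length G) · D (R ++ S) (G ++ C)       ≡⟨ cong (_· D (R ++ S) (G ++ C)) (sgn-square (length G)) ⟩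
  1ℤ · D (R ++ S) (G ++ C)                                    ≡⟨ ℤ.*-identityˡ _ ⟩
  D (R ++ S) (G ++ C)                                         ∎
  where open ≡-Reasoning

D-triangular : ∀ (T : B → B → ℤ) K → (∀ {k} → k ∈ K → T k k ≡ 1ℤ) → AllPairs (λ c k → T k c ≡ 0ℤ) K → D (map T K) K ≡ 1ℤ
D-triangular T []      diag tri         = refl
D-triangular T (c ∷ K) diag (Tc ∷ tri) = begin
  D (T c ∷ map T K) (c ∷ K)      ≡⟨ D-transpose (T c ∷ map T K) (c ∷ K) ⟩
  D (ev c ∷ map ev K) (T c ∷ map T K) ≡⟨ D-drop (map ev K) {T c} (map T K) (diag (here refl)) (below Tc) ⟩
  D (map ev K) (map T K)         ≡⟨ D-transpose (map T K) K ⟨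
  D (map T K) K                  ≡⟨ D-triangular T K (diag ∘ there) tri ⟩
  1ℤ                             ∎
  where
  open ≡-Reasoning
  ev : B → (B → ℤ) → ℤ
  ev c v = v c
  below : ∀ {L} → All (λ k → T k c ≡ 0ℤ) L → ∀ {v} → v ∈ map T L → v c ≡ 0ℤ
  below (p ∷ ps) (here refl) = p
  below (p ∷ ps) (there v∈)  = below ps v∈

D-scale-rows : ∀ (σ : A → ℤ) (M : A → B → ℤ) L C → (∀ x → ∣ σ x ∣ ≡ 1) →
  ∣ D (map (λ x c → σ x · M x c) L) C ∣ ≡ ∣ D (map M L) C ∣
D-scale-rows σ M L C unit with scaled L
  where
  scaled : ∀ L → Σ ℤ λ ε → ∣ ε ∣ ≡ 1 × (∀ C → D (map (λ x c → σ x · M x c) L) C ≡ ε · D (map M L) C)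
  scaled []      = 1ℤ , refl , λ C → sym (ℤ.*-identityˡ _)
  scaled (x ∷ L) with scaled L
  ... | ε , ∣ε∣ , eq = σ x · ε , ≡.trans (ℤ.abs-* (σ x) ε) (cong₂ ℕ._*_ (unit x) ∣ε∣) , λ C → begin
      wedge (λ c → σ x · M x c) _ C             ≡⟨ wedge-cong C (λ {c} _ → sym (ℤ.+-identityʳ _)) (λ _ → eq _) ⟩
      wedge (λ c → σ x · M x c + 0ℤ) _ C        ≡⟨ wedge-linearˡ (σ x) (M x) (λ _ → 0ℤ) _ C ⟩
      σ x · wedge (M x) (λ C′ → ε · D (map M L) C′) C + wedge (λ _ → 0ℤ) (λ C′ → ε · D (map M L) C′) C
        ≡⟨ cong₂ (λ p q → σ x · p + q) (wedge-*ʳ (M x) ε _ C) (wedge-zeroˡ _ C (λ _ → refl)) ⟩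
      σ x · (ε · wedge (M x) (D (map M L)) C) + 0ℤ   ≡⟨ shuffle (σ x) ε _ ⟩
      σ x · ε · wedge (M x) (D (map M L)) C     ∎
    where
    open ≡-Reasoning
    shuffle : ∀ x y z → x · (y · z) + 0ℤ ≡ x · y · z
    shuffle = solve-∀
... | ε , ∣ε∣ , eq = ≡.trans (cong ∣_∣ (eq C)) (≡.trans (ℤ.abs-* ε _) (≡.trans (cong (ℕ._* _) ∣ε∣) (ℕ.*-identityˡ _)))

D-transpose-map : ∀ (M : A → B → ℤ) L C → D (map M L) C ≡ D (map (λ c x → M x c) C) L
D-transpose-map M L C = begin
  D (map M L) C                              ≡⟨ D-transpose (map M L) C ⟩
  D (map (λ c v → v c) C) (map M L)          ≡⟨ D-relabel M (map (λ c v → v c) C) L ⟨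
  D (map (_∘ M) (map (λ c v → v c) C)) L     ≡⟨ cong (λ R → D R L) (List.map-∘ C) ⟨
  D (map (λ c x → M x c) C) L                ∎
  where open ≡-Reasoning

D-scale-columns : ∀ (σ : B → ℤ) (M : A → B → ℤ) L C → (∀ x → ∣ σ x ∣ ≡ 1) →
  ∣ D (map (λ x c → σ c · M x c) L) C ∣ ≡ ∣ D (map M L) C ∣
D-scale-columns σ M L C unit = begin
  ∣ D (map (λ x c → σ c · M x c) L) C ∣  ≡⟨ cong ∣_∣ (D-transpose-map _ L C) ⟩
  ∣ D (map (λ c x → σ c · M x c) C) L ∣  ≡⟨ D-scale-rows σ (λ c x → M x c) C L unit ⟩
  ∣ D (map (λ c x → M x c) C) L ∣        ≡⟨ cong ∣_∣ (D-transpose-map M L C) ⟨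
  ∣ D (map M L) C ∣                      ∎
  where open ≡-Reasoning

-- Bridges the two forms of the expansion: `wedge` alternates the sign step by step along the list,
-- `det` attaches `sgn (toℕ j)` to the minor without column `j`.
wedge-tabulate : ∀ n (v : B → ℤ) (ω : List B → ℤ) (g : Fin (suc n) → B) →
  wedge v ω (tabulate g) ≡ ∑ (allFin (suc n)) (λ j → sgn (toℕ j) · (v (g j) · ω (tabulate (g ∘ punchIn j))))
wedge-tabulate zero    v ω g = base (v (g zero)) _
  where
  base : ∀ x y → x · y + -1ℤ · 0ℤ ≡ 1ℤ · (x · y) + 0ℤ
  base = solve-∀
wedge-tabulate (suc n) v ω g = begin
  v (g zero) · ω (tabulate (g ∘ suc)) + -1ℤ · wedge v (ω ∘ (g zero ∷_)) (tabulate (g ∘ suc))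
    ≡⟨ cong₂ (λ x y → x + -1ℤ · y) (sym (ℤ.*-identityˡ (v (g zero) · ω (tabulate (g ∘ suc))))) (wedge-tabulate n v (ω ∘ (g zero ∷_)) (g ∘ suc)) ⟩
  1ℤ · (v (g zero) · ω (tabulate (g ∘ suc))) + -1ℤ · ∑ (allFin (suc n)) (λ j → sgn (toℕ j) · x j)
    ≡⟨ cong (1ℤ · (v (g zero) · ω (tabulate (g ∘ suc))) +_) (∑-* (allFin (suc n)) -1ℤ (λ j → sgn (toℕ j) · x j)) ⟨
  1ℤ · (v (g zero) · ω (tabulate (g ∘ suc))) + ∑ (allFin (suc n)) (λ j → -1ℤ · (sgn (toℕ j) · x j))
    ≡⟨ cong (1ℤ · (v (g zero) · ω (tabulate (g ∘ suc))) +_) (∑-cong (allFin (suc n)) (λ {j} _ →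
         ≡.trans (sym (ℤ.*-assoc -1ℤ (sgn (toℕ j)) (x j))) (cong (_· x j) (sym (sgn-suc (toℕ j)))))) ⟩
  1ℤ · (v (g zero) · ω (tabulate (g ∘ suc))) + ∑ (allFin (suc n)) (λ j → sgn (suc (toℕ j)) · x j)
    ≡⟨ cong (1ℤ · (v (g zero) · ω (tabulate (g ∘ suc))) +_) (∑-map suc (allFin (suc n)) term) ⟨
  1ℤ · (v (g zero) · ω (tabulate (g ∘ suc))) + ∑ (map suc (allFin (suc n))) term
    ≡⟨ cong (λ L → 1ℤ · (v (g zero) · ω (tabulate (g ∘ suc))) + ∑ L term) (List.map-tabulate id suc) ⟩
  1ℤ · (v (g zero) · ω (tabulate (g ∘ suc))) + ∑ (tabulate suc) term ∎
  where
  open ≡-Reasoning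
  x : Fin (suc n) → ℤ
  x j = v (g (suc j)) · ω (tabulate (g ∘ punchIn (suc j)))
  term : Fin (suc (suc n)) → ℤ
  term j = sgn (toℕ j) · (v (g j) · ω (tabulate (g ∘ punchIn j)))

-- The column labels `g` are kept general because the recursion composes them with `punchIn j`.
det-D : ∀ n (M : Fin n → B → ℤ) (g : Fin n → B) → det n (λ r c → M r (g c)) ≡ D (tabulate M) (tabulate g)
det-D zero    M g = refl
det-D (suc n) M g = ≡.trans
  (∑-cong (allFin (suc n)) (λ {j} _ → cong (λ x → sgn (toℕ j) · (M zero (g j) · x)) (det-D n (M ∘ suc) (g ∘ punchIn j))))
  (sym (wedge-tabulate n (M zero) (D (tabulate (M ∘ suc))) g))

D-cong-map : ∀ {M N : A → B → ℤ} L C → (∀ {x c} → x ∈ L → c ∈ C → M x c ≡ N x c) → D (map M L) C ≡ D (map N L) C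
D-cong-map {M = M} {N} L C eq = D-cong C (rows L eq)
  where
  rows : ∀ L → (∀ {x c} → x ∈ L → c ∈ C → M x c ≡ N x c) → Pointwise (λ v w → ∀ {c} → c ∈ C → v c ≡ w c) (map M L) (map N L)
  rows []      eq = []
  rows (x ∷ L) eq = eq (here refl) ∷ rows L (eq ∘ there)

D-unit-rows : ∀ (M : B → B → ℤ) X Y → (∀ {x} → x ∈ X → M x x ≡ 1ℤ) → AllPairs (λ x c → M x c ≡ 0ℤ) X →
  (∀ {x c} → x ∈ X → c ∈ Y → M x c ≡ 0ℤ) → D (map M (X ++ Y)) (X ++ Y) ≡ D (map M Y) Y
D-unit-rows M []      Y diag tri zeros       = refl
D-unit-rows M (x ∷ X) Y diag (M0 ∷ tri) zeros = ≡.trans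
  (D-drop (map M (X ++ Y)) (X ++ Y) (diag (here refl)) (λ c∈ → All.lookup (All.++⁺ M0 (All.tabulate (zeros (here refl)))) c∈))
  (D-unit-rows M X Y (diag ∘ there) tri (zeros ∘ there))

D-+-middle : ∀ R (v w : B → ℤ) S C → D (R ++ (λ c → v c + w c) ∷ S) C ≡ D (R ++ v ∷ S) C + D (R ++ w ∷ S) C
D-+-middle []      v w S C = wedge-+ˡ v w (D S) C
D-+-middle (u ∷ R) v w S C = ≡.trans (wedge-congʳ u C (D-+-middle R v w S)) (wedge-+ʳ u _ _ C)

-- Principal minors

δ : ℕ → ℕ → ℤ
δ zero    zero    = 1ℤ
δ zero    (suc n) = 0ℤ
δ (suc m) zero    = 0ℤ
δ (suc m) (suc n) = δ m n

δ-refl : ∀ n → δ n n ≡ 1ℤ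
δ-refl zero    = refl
δ-refl (suc n) = δ-refl n

δ-≢ : ∀ {m n} → m ≢ n → δ m n ≡ 0ℤ
δ-≢ {zero}  {zero}  m≢n = contradiction refl m≢n
δ-≢ {zero}  {suc n} m≢n = refl
δ-≢ {suc m} {zero}  m≢n = refl
δ-≢ {suc m} {suc n} m≢n = δ-≢ (m≢n ∘ cong suc)

range : ℕ → ℕ → List ℕ
range o zero    = []
range o (suc n) = o ∷ range (suc o) n

∈-range⁻ : ∀ o n {x} → x ∈ range o n → o ℕ.≤ x × x ℕ.< o ℕ.+ n
∈-range⁻ o (suc n) (here refl) = ℕ.≤-refl , ℕ.m<m+n o ℕ.z<s
∈-range⁻ o (suc n) (there x∈)  with o<x , x< ← ∈-range⁻ (suc o) n x∈ =
  ℕ.<⇒≤ o<x , ℕ.<-≤-trans x< (ℕ.≤-reflexive (sym (ℕ.+-suc o n)))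

range-sorted : ∀ o n → AllPairs ℕ._<_ (range o n)
range-sorted o zero    = []
range-sorted o (suc n) = All.tabulate (proj₁ ∘ ∈-range⁻ (suc o) n) ∷ range-sorted (suc o) n

bools : ℕ → List (List Bool)
bools zero    = [] ∷ []
bools (suc n) = map (false ∷_) (bools n) ++ map (true ∷_) (bools n)

positions : ℕ → List Bool → List ℕ
positions o []           = []
positions o (false ∷ bs) = positions (suc o) bs
positions o (true ∷ bs)  = o ∷ positions (suc o) bs

positions-suc : ∀ o bs → positions (suc o) bs ≡ map suc (positions o bs)
positions-suc o []           = refl
positions-suc o (false ∷ bs) = positions-suc (suc o) bs
positions-suc o (true ∷ bs)  = cong (suc o ∷_) (positions-suc (suc o) bs)

-- Rows are split one at a time. If `δ o` is chosen, row and column `o` drop out; if `M o` is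
-- chosen, they join the prefix `R`, `G`. The bound on `G` makes `δ o` vanish on the columns kept so
-- far. With empty prefix this expands det (1 + M).
D-principal-minors : ∀ (M : ℕ → ℕ → ℤ) n o R G → length R ≡ length G → (∀ {g} → g ∈ G → g ℕ.< o) →
  D (R ++ map (λ l c → δ l c + M l c) (range o n)) (G ++ range o n) ≡
  ∑ (bools n) (λ bs → D (R ++ map M (positions o bs)) (G ++ positions o bs))
D-principal-minors M zero    o R G len G<o = sym (ℤ.+-identityʳ _)
D-principal-minors M (suc n) o R G len G<o = begin
  D (R ++ (λ c → δ o c + M o c) ∷ S) (G ++ o ∷ L)
    ≡⟨ D-+-middle R (δ o) (M o) S _ ⟩
  D (R ++ δ o ∷ S) (G ++ o ∷ L) + D (R ++ M o ∷ S) (G ++ o ∷ L)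
    ≡⟨ cong₂ _+_ (D-drop-middle R S G L len (δ-refl o) δ-zero) (sym (cong₂ D (List.∷ʳ-++ R (M o) S) (List.∷ʳ-++ G o L))) ⟩
  D (R ++ S) (G ++ L) + D (R ∷ʳ M o ++ S) (G ∷ʳ o ++ L)
    ≡⟨ cong₂ _+_ (D-principal-minors M n (suc o) R G len (ℕ.m<n⇒m<1+n ∘ G<o))
         (D-principal-minors M n (suc o) (R ∷ʳ M o) (G ∷ʳ o) len′ G∷ʳ<) ⟩
  ∑ (bools n) (minor ∘ (false ∷_)) + ∑ (bools n) (λ bs → D (R ∷ʳ M o ++ map M (positions (suc o) bs)) (G ∷ʳ o ++ positions (suc o) bs))
    ≡⟨ cong (∑ (bools n) (minor ∘ (false ∷_)) +_) (∑-cong (bools n) (λ {bs} _ →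
         cong₂ D (List.∷ʳ-++ R (M o) (map M (positions (suc o) bs))) (List.∷ʳ-++ G o (positions (suc o) bs)))) ⟩
  ∑ (bools n) (minor ∘ (false ∷_)) + ∑ (bools n) (minor ∘ (true ∷_))
    ≡⟨ cong₂ _+_ (∑-map (false ∷_) (bools n) minor) (∑-map (true ∷_) (bools n) minor) ⟨
  ∑ (map (false ∷_) (bools n)) minor + ∑ (map (true ∷_) (bools n)) minor
    ≡⟨ ∑-++ (map (false ∷_) (bools n)) minor ⟨
  ∑ (bools (suc n)) minor ∎
  where
  open ≡-Reasoning
  minor : List Bool → ℤ
  minor bs = D (R ++ map M (positions o bs)) (G ++ positions o bs)
  L = range (suc o) n
  S = map (λ l c → δ l c + M l c) L
  δ-zero : ∀ {c} → c ∈ G ++ L → δ o c ≡ 0ℤ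
  δ-zero c∈ with ∈-++⁻ G c∈
  ... | inj₁ c∈G = δ-≢ (ℕ.>⇒≢ (G<o c∈G))
  ... | inj₂ c∈L = δ-≢ (ℕ.<⇒≢ (proj₁ (∈-range⁻ (suc o) n c∈L)))
  len′ : length (R ∷ʳ M o) ≡ length (G ∷ʳ o)
  len′ = ≡.trans (List.length-++ R) (≡.trans (cong (ℕ._+ 1) len) (sym (List.length-++ G)))
  G∷ʳ< : ∀ {g} → g ∈ G ∷ʳ o → g ℕ.< suc o
  G∷ʳ< g∈ with ∈-++⁻ G g∈
  ... | inj₁ g∈G         = ℕ.m<n⇒m<1+n (G<o g∈G)
  ... | inj₂ (here refl) = ℕ.n<1+n o

-- Interlacing subsets

-- b (suc t) k is the binomial coefficient C(t + k, k).
b : ℕ → ℕ → ℤ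
b t       zero    = 1ℤ
b zero    (suc k) = 0ℤ
b (suc t) (suc k) = b (suc t) k + b t (suc k)

-- Subsets of an interval are lists of booleans. The members of succs false E interlace E: with e the
-- elements of E in increasing order, there is one element in each interval (eᵢ₋₁, eᵢ], where e₀ is minus
-- infinity; for succs true E the first of these intervals is left out.
succs : Bool → List Bool → List (List Bool)
succs false []          = [] ∷ []
succs true  []          = []
succs false (false ∷ E) = map (false ∷_) (succs false E) ++ map (true ∷_) (succs true E)
succs true  (false ∷ E) = map (false ∷_) (succs true E)
succs false (true ∷ E)  = map (true ∷_) (succs false E)
succs true  (true ∷ E)  = map (false ∷_) (succs false E)

-- One summand of Pascal's rule. On the columns `suc k` it is `b (suc t)` again, which lets a chain
-- advance by one set.
shifted : ℕ → ℕ → ℤ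
shifted t zero    = 0ℤ
shifted t (suc k) = b (suc t) k

b-suc : ∀ t k → b (suc t) k ≡ shifted t k + b t k
b-suc t zero    = refl
b-suc t (suc k) = refl

-- Pascal's rule b (suc t) = shifted t + b t is applied from the right end of E; the terms in which an element
-- of E meets a pending carry vanish, because b (suc t) ∧ b (suc t) = 0.
minor-scan : ∀ t E C → D (map (b ∘ suc) (positions t E)) C ≡
  ∑ (succs false E) (λ E′ → D (map shifted (positions t E′)) C) +
  wedge (b t) (λ C′ → ∑ (succs true E) (λ E′ → D (map shifted (positions t E′)) C′)) C
minor-scan t []          C = begin
  D [] C                                      ≡⟨ pad (D [] C) ⟩
  D [] C + 0ℤ + 0ℤ                            ≡⟨ cong (D [] C + 0ℤ +_) (wedge-zeroʳ (b t) C (λ _ → refl)) ⟨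
  D [] C + 0ℤ + wedge (b t) (λ _ → 0ℤ) C      ∎
  where
  open ≡-Reasoning
  pad : ∀ x → x ≡ x + 0ℤ + 0ℤ
  pad = solve-∀
minor-scan t (false ∷ E) C = begin
  D (map (b ∘ suc) (positions (suc t) E)) C
    ≡⟨ minor-scan (suc t) E C ⟩
  S false C + wedge (b (suc t)) (S true) C
    ≡⟨ cong (S false C +_) (≡.trans (wedge-cong C (λ {k} _ → b-suc t k) (λ _ → refl)) (wedge-+ˡ (shifted t) (b t) (S true) C)) ⟩
  S false C + (wedge (shifted t) (S true) C + wedge (b t) (S true) C)
    ≡⟨ ℤ.+-assoc (S false C) _ _ ⟨
  S false C + wedge (shifted t) (S true) C + wedge (b t) (S true) C
    ≡⟨ cong₂ _+_ (cong (S false C +_) (wedge-∑ʳ (shifted t) (succs true E) _ C)) (wedge-congʳ (b t) C (λ C′ → sym (∑-map (false ∷_) (succs true E) _))) ⟩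
  S false C + ∑ (succs true E) (λ E′ → minor (true ∷ E′) C) + wedge (b t) (λ C′ → ∑ (succs true (false ∷ E)) (λ E′ → minor E′ C′)) C
    ≡⟨ cong (_+ wedge (b t) (λ C′ → ∑ (succs true (false ∷ E)) (λ E′ → minor E′ C′)) C) (≡.trans
         (cong₂ _+_ (sym (∑-map (false ∷_) (succs false E) _)) (sym (∑-map (true ∷_) (succs true E) _)))
         (sym (∑-++ (map (false ∷_) (succs false E)) (λ E′ → minor E′ C)))) ⟩
  ∑ (succs false (false ∷ E)) (λ E′ → minor E′ C) + wedge (b t) (λ C′ → ∑ (succs true (false ∷ E)) (λ E′ → minor E′ C′)) C ∎
  where
  open ≡-Reasoning
  minor : List Bool → List ℕ → ℤ
  minor E′ C′ = D (map shifted (positions t E′)) C′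
  S : Bool → List ℕ → ℤ
  S d C′ = ∑ (succs d E) (λ E′ → minor (false ∷ E′) C′)
minor-scan t (true ∷ E)  C = begin
  wedge (b (suc t)) (D (map (b ∘ suc) (positions (suc t) E))) C
    ≡⟨ wedge-congʳ (b (suc t)) C (minor-scan (suc t) E) ⟩
  wedge (b (suc t)) (λ C′ → S false C′ + wedge (b (suc t)) (S true) C′) C
    ≡⟨ wedge-+ʳ (b (suc t)) (S false) (wedge (b (suc t)) (S true)) C ⟩
  wedge (b (suc t)) (S false) C + wedge (b (suc t)) (wedge (b (suc t)) (S true)) C
    ≡⟨ cong₂ _+_ (≡.trans (wedge-cong C (λ {k} _ → b-suc t k) (λ _ → refl)) (wedge-+ˡ (shifted t) (b t) (S false) C)) (wedge-self (b (suc t)) (S true) C) ⟩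
  wedge (shifted t) (S false) C + wedge (b t) (S false) C + 0ℤ
    ≡⟨ ℤ.+-identityʳ _ ⟩
  wedge (shifted t) (S false) C + wedge (b t) (S false) C
    ≡⟨ cong₂ _+_ (≡.trans (wedge-∑ʳ (shifted t) (succs false E) _ C) (sym (∑-map (true ∷_) (succs false E) _)))
                 (wedge-congʳ (b t) C (λ C′ → sym (∑-map (false ∷_) (succs false E) _))) ⟩
  ∑ (succs false (true ∷ E)) (λ E′ → minor E′ C) + wedge (b t) (λ C′ → ∑ (succs true (true ∷ E)) (λ E′ → minor E′ C′)) C ∎
  where
  open ≡-Reasoning
  minor : List Bool → List ℕ → ℤ
  minor E′ C′ = D (map shifted (positions t E′)) C′
  S : Bool → List ℕ → ℤ
  S d C′ = ∑ (succs d E) (λ E′ → minor (false ∷ E′) C′)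

D-shifted : ∀ L K → D (map shifted L) (map suc K) ≡ D (map (b ∘ suc) L) K
D-shifted L K = begin
  D (map shifted L) (map suc K)          ≡⟨ D-relabel suc (map shifted L) K ⟨
  D (map (_∘ suc) (map shifted L)) K     ≡⟨ cong (λ R → D R K) (List.map-∘ L) ⟨
  D (map (b ∘ suc) L) K                  ∎
  where open ≡-Reasoning

b-zero : ∀ K {c} → c ∈ map suc K → b zero c ≡ 0ℤ
b-zero (k ∷ K) (here refl) = refl
b-zero (k ∷ K) (there c∈)  = b-zero K c∈

shifted-zero : ∀ L {v} → v ∈ map shifted L → v zero ≡ 0ℤ
shifted-zero (t ∷ L) (here refl) = refl
shifted-zero (t ∷ L) (there v∈)  = shifted-zero L v∈

-- The carry that remains after the scan is `b 0`, the unit covector of column 0, and shifted rows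
-- vanish in that column. So without column 0 only the terms without a carry survive, and with it
-- only those whose carry takes it. The other columns move down by one.
minor-step : ∀ d bs E → D (map (b ∘ suc) (positions 0 E)) (positions 0 (d ∷ bs)) ≡
  ∑ (succs d E) (λ E′ → D (map (b ∘ suc) (positions 0 E′)) (positions 0 bs))
minor-step false bs E = begin
  D (map (b ∘ suc) (positions 0 E)) (positions 1 bs)
    ≡⟨ cong (D (map (b ∘ suc) (positions 0 E))) (positions-suc 0 bs) ⟩
  D (map (b ∘ suc) (positions 0 E)) (map suc K)
    ≡⟨ minor-scan 0 E (map suc K) ⟩
  ∑ (succs false E) (λ E′ → D (map shifted (positions 0 E′)) (map suc K)) + wedge (b 0) _ (map suc K)
    ≡⟨ cong₂ _+_ (∑-cong (succs false E) (λ {E′} _ → D-shifted (positions 0 E′) K)) (wedge-zeroˡ _ (map suc K) (b-zero K)) ⟩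
  ∑ (succs false E) (λ E′ → D (map (b ∘ suc) (positions 0 E′)) K) + 0ℤ
    ≡⟨ ℤ.+-identityʳ _ ⟩
  ∑ (succs false E) (λ E′ → D (map (b ∘ suc) (positions 0 E′)) K) ∎
  where
  open ≡-Reasoning
  K = positions 0 bs
minor-step true bs E = begin
  D (map (b ∘ suc) (positions 0 E)) (0 ∷ positions 1 bs)
    ≡⟨ cong (λ L → D (map (b ∘ suc) (positions 0 E)) (0 ∷ L)) (positions-suc 0 bs) ⟩
  D (map (b ∘ suc) (positions 0 E)) (0 ∷ map suc K)
    ≡⟨ minor-scan 0 E (0 ∷ map suc K) ⟩
  ∑ (succs false E) (λ E′ → D (map shifted (positions 0 E′)) (0 ∷ map suc K)) + (1ℤ · S (map suc K) + -1ℤ · wedge (b 0) (S ∘ (0 ∷_)) (map suc K))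
    ≡⟨ cong₂ (λ x y → x + (1ℤ · S (map suc K) + -1ℤ · y))
         (∑-zero (succs false E) (λ {E′} _ → ≡.trans (D-column (map shifted (positions 0 E′)) 0 (map suc K)) (wedge-zeroˡ _ _ (shifted-zero (positions 0 E′)))))
         (wedge-zeroˡ _ (map suc K) (b-zero K)) ⟩
  0ℤ + (1ℤ · S (map suc K) + -1ℤ · 0ℤ)
    ≡⟨ unit (S (map suc K)) ⟩
  S (map suc K)
    ≡⟨ ∑-cong (succs true E) (λ {E′} _ → D-shifted (positions 0 E′) K) ⟩
  ∑ (succs true E) (λ E′ → D (map (b ∘ suc) (positions 0 E′)) K) ∎
  where
  open ≡-Reasoning
  K = positions 0 bs
  S : List ℕ → ℤ
  S C = ∑ (succs true E) (λ E′ → D (map shifted (positions 0 E′)) C)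
  unit : ∀ x → 0ℤ + (1ℤ · x + -1ℤ · 0ℤ) ≡ x
  unit = solve-∀

∑-length : ∀ (f : A → List B) xs → ∑ xs (λ x → ℤ.+ (length (f x))) ≡ ℤ.+ (length (concatMap f xs))
∑-length f []       = refl
∑-length f (x ∷ xs) = ≡.trans (cong (ℤ.+ (length (f x)) +_) (∑-length f xs))
  (≡.trans (sym (ℤ.pos-+ (length (f x)) _)) (cong ℤ.+_ (sym (List.length-++ (f x)))))

-- With no columns left, a minor is 1 if there are no rows and 0 otherwise: a chain has to end in
-- the empty set.
blank : List Bool → List (List (List Bool))
blank []          = [] ∷ []
blank (false ∷ E) = blank E
blank (true ∷ E)  = []

chains : List Bool → List Bool → List (List (List Bool))
chains []       E = blank E
chains (d ∷ ds) E = concatMap (λ E′ → map (E′ ∷_) (chains ds E′)) (succs d E)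

minor-count : ∀ ds E → D (map (b ∘ suc) (positions 0 E)) (positions 0 ds) ≡ ℤ.+ (length (chains ds E))
minor-count []       E = base 0 E
  where
  base : ∀ t E → D (map (b ∘ suc) (positions t E)) [] ≡ ℤ.+ (length (blank E))
  base t []          = refl
  base t (false ∷ E) = base (suc t) E
  base t (true ∷ E)  = refl
minor-count (d ∷ ds) E = begin
  D (map (b ∘ suc) (positions 0 E)) (positions 0 (d ∷ ds))
    ≡⟨ minor-step d ds E ⟩
  ∑ (succs d E) (λ E′ → D (map (b ∘ suc) (positions 0 E′)) (positions 0 ds))
    ≡⟨ ∑-cong (succs d E) (λ {E′} _ → ≡.trans (minor-count ds E′) (cong ℤ.+_ (sym (List.length-map (E′ ∷_) (chains ds E′))))) ⟩
  ∑ (succs d E) (λ E′ → ℤ.+ (length (map (E′ ∷_) (chains ds E′))))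
    ≡⟨ ∑-length _ (succs d E) ⟩
  ℤ.+ (length (chains (d ∷ ds) E)) ∎
  where open ≡-Reasoning

cyclicChains : ℕ → List (List (List Bool))
cyclicChains a = concatMap (λ E → map (E ∷_) (chains E E)) (bools a)

D-δ+b : ∀ a → D (map (λ t k → δ t k + b (suc t) k) (range 0 a)) (range 0 a) ≡ ℤ.+ (length (cyclicChains a))
D-δ+b a = begin
  D (map (λ t k → δ t k + b (suc t) k) (range 0 a)) (range 0 a)
    ≡⟨ D-principal-minors (b ∘ suc) a 0 [] [] refl (λ ()) ⟩
  ∑ (bools a) (λ E → D (map (b ∘ suc) (positions 0 E)) (positions 0 E))
    ≡⟨ ∑-cong (bools a) (λ {E} _ → ≡.trans (minor-count E E) (cong ℤ.+_ (sym (List.length-map (E ∷_) (chains E E))))) ⟩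
  ∑ (bools a) (λ E → ℤ.+ (length (map (E ∷_) (chains E E))))
    ≡⟨ ∑-length _ (bools a) ⟩
  ℤ.+ (length (cyclicChains a)) ∎
  where open ≡-Reasoning

-- The rhombus matrix

δ₂ : ℕ × ℕ → ℕ × ℕ → ℤ
δ₂ (p , q) (x , y) = δ p x · δ q y

δ₂-refl : ∀ k → δ₂ k k ≡ 1ℤ
δ₂-refl (p , q) = cong₂ _·_ (δ-refl p) (δ-refl q)

δ₂-≢ : ∀ k c → k ≢ c → δ₂ k c ≡ 0ℤ
δ₂-≢ (p , q) (x , y) k≢c with p ℕ.≟ x
... | no p≢x   = cong (_· δ q y) (δ-≢ p≢x)
... | yes refl = ≡.trans (cong (δ p p ·_) (δ-≢ (k≢c ∘ cong (p ,_)))) (ℤ.*-zeroʳ (δ p p))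

-- The second coordinate descends, so that `tri` is triangular in this order and the row q = 0,
-- where the gluing happens, comes last.
grid : ℕ → ℕ → List (ℕ × ℕ)
grid a zero    = []
grid a (suc n) = map (_, n) (range 0 a) ++ grid a n

∈-grid⁻ : ∀ a n {p q} → (p , q) ∈ grid a n → p ℕ.< a × q ℕ.< n
∈-grid⁻ a (suc n) pq∈ with ∈-++⁻ (map (_, n) (range 0 a)) pq∈
... | inj₂ pq∈grid with p<a , q<n ← ∈-grid⁻ a n pq∈grid = p<a , ℕ.m<n⇒m<1+n q<n
... | inj₁ pq∈row with _ , p∈ , refl ← ∈-map⁻ (_, n) pq∈row = proj₂ (∈-range⁻ 0 a p∈) , ℕ.n<1+n n

-- tri k c + glue k c will be the entry of the matrix of the theorem at the orbits with coordinates k and c.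
tri : ℕ × ℕ → ℕ × ℕ → ℤ
tri (p , q) (x , y) = δ₂ (p , q) (x , y) + δ₂ (suc p , q) (x , y) + δ₂ (p , q) (x , suc y)

-- Lowering a last exponent equal to a makes the monomial leave the rhombus across the side q = 0;
-- its rotation lies on the side p = 0.
glue : ℕ × ℕ → ℕ × ℕ → ℤ
glue (p , zero)  c = δ₂ (0 , p) c
glue (p , suc q) c = 0ℤ

-- The coordinates of δ₂ (0 , p) in the basis tri.
path : ℕ → ℕ × ℕ → ℤ
path p       (x , zero)  = sgn x · (sgn p · b (suc p) x)
path zero    (x , suc y) = 0ℤ
path (suc p) (x , suc y) = path p (x , y)

pathGlue : ℕ × ℕ → ℕ × ℕ → ℤ
pathGlue (p , zero)  c = path p c
pathGlue (p , suc q) c = 0ℤ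

∑-range-δ : ∀ (f : ℕ → ℤ) x o n → o ℕ.≤ x → x ℕ.< o ℕ.+ n → ∑ (range o n) (λ p → f p · δ p x) ≡ f x
∑-range-δ f x o zero    o≤x x<o = contradiction (ℕ.<-≤-trans x<o (ℕ.≤-trans (ℕ.≤-reflexive (ℕ.+-identityʳ o)) o≤x)) (ℕ.<-irrefl refl)
∑-range-δ f x o (suc n) o≤x x<  with o ℕ.≟ x
... | yes refl = begin
  f o · δ o o + ∑ (range (suc o) n) (λ p → f p · δ p o)
    ≡⟨ cong₂ _+_ (cong (f o ·_) (δ-refl o)) (∑-zero (range (suc o) n) (λ {p} p∈ →
         ≡.trans (cong (f p ·_) (δ-≢ (ℕ.>⇒≢ (proj₁ (∈-range⁻ (suc o) n p∈))))) (ℤ.*-zeroʳ (f p)))) ⟩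
  f o · 1ℤ + 0ℤ
    ≡⟨ unit (f o) ⟩
  f o ∎
  where
  open ≡-Reasoning
  unit : ∀ x → x · 1ℤ + 0ℤ ≡ x
  unit = solve-∀
... | no o≢x = begin
  f o · δ o x + ∑ (range (suc o) n) (λ p → f p · δ p x)
    ≡⟨ cong₂ (λ y z → f o · y + z) (δ-≢ o≢x) (∑-range-δ f x (suc o) n (ℕ.≤∧≢⇒< o≤x o≢x) (ℕ.<-≤-trans x< (ℕ.≤-reflexive (ℕ.+-suc o n)))) ⟩
  f o · 0ℤ + f x
    ≡⟨ unit (f o) (f x) ⟩
  f x ∎
  where
  open ≡-Reasoning
  unit : ∀ x y → x · 0ℤ + y ≡ y
  unit = solve-∀

∑-grid-zero : ∀ a n (v : ℕ × ℕ → ℤ) {x y} → n ℕ.≤ y → ∑ (grid a n) (λ k → v k · δ₂ k (x , y)) ≡ 0ℤ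
∑-grid-zero a n v {x} {y} n≤y = ∑-zero (grid a n) λ {k} k∈ →
  ≡.trans (cong (v k ·_) (δ₂-≢ k (x , y) λ { refl → ℕ.<⇒≱ (proj₂ (∈-grid⁻ a n k∈)) n≤y })) (ℤ.*-zeroʳ (v k))

∑-grid : ∀ a n (v : ℕ × ℕ → ℤ) {x y} → x ℕ.< a → y ℕ.< n → ∑ (grid a n) (λ k → v k · δ₂ k (x , y)) ≡ v (x , y)
∑-grid a (suc n) v {x} {y} x<a y<1+n = ≡.trans (∑-++ (map (_, n) (range 0 a)) _) (go (n ℕ.≟ y))
  where
  open ≡-Reasoning
  shuffle : ∀ p q → p · (q · 1ℤ) ≡ p · q
  shuffle = solve-∀
  row : ℤ
  row = ∑ (map (_, n) (range 0 a)) (λ k → v k · δ₂ k (x , y))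
  go : Dec (n ≡ y) → row + ∑ (grid a n) (λ k → v k · δ₂ k (x , y)) ≡ v (x , y)
  go (yes refl) = begin
    row + ∑ (grid a n) (λ k → v k · δ₂ k (x , n))     ≡⟨ cong₂ _+_ (∑-map (_, n) (range 0 a) _) (∑-grid-zero a n v ℕ.≤-refl) ⟩
    ∑ (range 0 a) (λ p → v (p , n) · δ₂ (p , n) (x , n)) + 0ℤ  ≡⟨ ℤ.+-identityʳ _ ⟩
    ∑ (range 0 a) (λ p → v (p , n) · δ₂ (p , n) (x , n))
      ≡⟨ ∑-cong (range 0 a) (λ {p} _ → ≡.trans (cong (λ z → v (p , n) · (δ p x · z)) (δ-refl n)) (shuffle (v (p , n)) (δ p x))) ⟩
    ∑ (range 0 a) (λ p → v (p , n) · δ p x)           ≡⟨ ∑-range-δ (λ p → v (p , n)) x 0 a ℕ.z≤n x<a ⟩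
    v (x , n)                                         ∎
  go (no n≢y) = begin
    row + ∑ (grid a n) (λ k → v k · δ₂ k (x , y))
      ≡⟨ cong₂ _+_ (≡.trans (∑-map (_, n) (range 0 a) _) (∑-zero (range 0 a) (λ {p} _ →
           ≡.trans (cong (v (p , n) ·_) (δ₂-≢ (p , n) (x , y) (n≢y ∘ cong proj₂))) (ℤ.*-zeroʳ (v (p , n))))))
           (∑-grid a n v x<a (ℕ.≤∧≢⇒< (ℕ.≤-pred y<1+n) (n≢y ∘ sym))) ⟩
    0ℤ + v (x , y)                                    ≡⟨ ℤ.+-identityˡ _ ⟩
    v (x , y)                                         ∎

left : (ℕ × ℕ → ℤ) → ℕ → ℕ → ℤ
left v zero    y = 0ℤ
left v (suc x) y = v (x , y)

-- Column `(x , y)` of `tri` is nonzero only in the rows `(x , y)`, `(x - 1 , y)` and `(x , y + 1)`.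
-- The last may lie just outside the grid, whence the condition on `v (x , a)`; on the opposite
-- border `left` supplies the zero.
linComb-tri : ∀ a (v : ℕ × ℕ → ℤ) {x y} → x ℕ.< a → y ℕ.< a → v (x , a) ≡ 0ℤ →
  linComb tri (grid a a) v (x , y) ≡ v (x , y) + left v x y + v (x , suc y)
linComb-tri a v {x} {y} x<a y<a v0 = begin
  ∑ G (λ k → v k · tri k (x , y))
    ≡⟨ ∑-cong G (λ {k} _ → distrib (v k) (δ₂ k (x , y)) _ _) ⟩
  ∑ G (λ k → v k · δ₂ k (x , y) + v k · δ₂ (suc (proj₁ k) , proj₂ k) (x , y) + v k · δ₂ k (x , suc y))
    ≡⟨ ≡.trans (∑-+ G _ _) (cong (_+ ∑ G (λ k → v k · δ₂ k (x , suc y))) (∑-+ G _ _)) ⟩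
  ∑ G (λ k → v k · δ₂ k (x , y)) + ∑ G (λ k → v k · δ₂ (suc (proj₁ k) , proj₂ k) (x , y)) + ∑ G (λ k → v k · δ₂ k (x , suc y))
    ≡⟨ cong₂ _+_ (cong₂ _+_ (∑-grid a a v x<a y<a) (leftSum x x<a)) upSum ⟩
  v (x , y) + left v x y + v (x , suc y) ∎
  where
  open ≡-Reasoning
  G = grid a a
  distrib : ∀ w p q r → w · (p + q + r) ≡ w · p + w · q + w · r
  distrib = solve-∀
  leftSum : ∀ x → x ℕ.< a → ∑ G (λ k → v k · δ₂ (suc (proj₁ k) , proj₂ k) (x , y)) ≡ left v x y
  leftSum zero    x<a = ∑-zero G (λ {k} _ → ℤ.*-zeroʳ (v k))
  leftSum (suc x) x<a = ∑-grid a a v (ℕ.<-trans (ℕ.n<1+n x) x<a) y<a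
  upSum : ∑ G (λ k → v k · δ₂ k (x , suc y)) ≡ v (x , suc y)
  upSum with suc y ℕ.≟ a
  ... | yes refl = ≡.trans (∑-grid-zero a a v ℕ.≤-refl) (sym v0)
  ... | no sy≢a  = ∑-grid a a v x<a (ℕ.≤∧≢⇒< y<a sy≢a)

-- The moves of `tri` lead from (p, q) to (p + 1, q) and to (p, q - 1), and C(p - y + x, x) paths
-- made of them join (0, p) to (x, y); the sign is that of their length. As only p - y matters, the
-- claim reduces to p = 0 or y = 0, where Pascal's rule makes the terms cancel.
path-recurrence : ∀ p x y → path p (x , y) + left (path p) x y + path p (x , suc y) ≡ δ₂ (0 , p) (x , y)
path-recurrence (suc p) x       (suc y) = ≡.trans (cong (λ z → path p (x , y) + z + path p (x , suc y)) (shift x)) (path-recurrence p x y)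
  where
  shift : ∀ x → left (path (suc p)) x (suc y) ≡ left (path p) x y
  shift zero    = refl
  shift (suc x) = refl
path-recurrence zero    zero    (suc y) = refl
path-recurrence zero    (suc x) (suc y) = refl
path-recurrence zero    zero    zero    = refl
path-recurrence zero    (suc x) zero    rewrite sgn-suc x = cancel (sgn x) (b 1 x)
  where
  cancel : ∀ s z → -1ℤ · s · (1ℤ · (z + 0ℤ)) + s · (1ℤ · z) + 0ℤ ≡ 0ℤ
  cancel = solve-∀
path-recurrence (suc p) zero    zero    rewrite sgn-suc p = cancel (sgn p)
  where
  cancel : ∀ s → 1ℤ · (-1ℤ · s · 1ℤ) + 0ℤ + 1ℤ · (s · 1ℤ) ≡ 0ℤ
  cancel = solve-∀
path-recurrence (suc p) (suc x) zero    rewrite sgn-suc p | sgn-suc x = cancel (sgn x) (sgn p) (b (suc (suc p)) x) (b (suc p) x + b p (suc x))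
  where
  cancel : ∀ s t y z → -1ℤ · s · (-1ℤ · t · (y + z)) + s · (-1ℤ · t · y) + -1ℤ · s · (t · z) ≡ 0ℤ
  cancel = solve-∀

path-zero : ∀ p x y → p ℕ.< y → path p (x , y) ≡ 0ℤ
path-zero zero    x (suc y) p<y = refl
path-zero (suc p) x (suc y) p<y = path-zero p x y (ℕ.≤-pred p<y)

-- This factors the matrix as (identity + `pathGlue`) times `tri`, and the second factor has
-- determinant 1.
linComb-coordinates : ∀ a {k c} → k ∈ grid a a → c ∈ grid a a →
  tri k c + glue k c ≡ linComb tri (grid a a) (λ k′ → δ₂ k k′ + pathGlue k k′) c
linComb-coordinates a {p , q} {x , y} k∈ c∈ = sym (≡.trans
  (linComb-tri a v (proj₁ (∈-grid⁻ a a c∈)) (proj₂ (∈-grid⁻ a a c∈)) (cong₂ _+_ (δ₂-≢ (p , q) (x , a) λ { refl → ℕ.<-irrefl refl q<a }) (outside q q<a)))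
  (≡.trans (cong (λ z → v (x , y) + z + v (x , suc y)) (left-+ x)) (≡.trans
    (shuffle (δ₂ (p , q) (x , y)) (pathGlue (p , q) (x , y)) _ _ (δ₂ (p , q) (x , suc y)) (pathGlue (p , q) (x , suc y)))
    (cong (tri (p , q) (x , y) +_) (glued q)))))
  where
  v : ℕ × ℕ → ℤ
  v k′ = δ₂ (p , q) k′ + pathGlue (p , q) k′
  p<a = proj₁ (∈-grid⁻ a a k∈)
  q<a = proj₂ (∈-grid⁻ a a k∈)
  outside : ∀ q → q ℕ.< a → pathGlue (p , q) (x , a) ≡ 0ℤ
  outside zero    _ = path-zero p x a p<a
  outside (suc q) _ = refl
  left-+ : ∀ x → left v x y ≡ δ₂ (suc p , q) (x , y) + left (pathGlue (p , q)) x y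
  left-+ zero    = refl
  left-+ (suc x) = refl
  shuffle : ∀ d e f g h i → (d + e) + (f + g) + (h + i) ≡ d + f + h + (e + g + i)
  shuffle = solve-∀
  glued : ∀ q → pathGlue (p , q) (x , y) + left (pathGlue (p , q)) x y + pathGlue (p , q) (x , suc y) ≡ glue (p , q) (x , y)
  glued zero    = ≡.trans (cong (λ z → path p (x , y) + z + path p (x , suc y)) (same x)) (path-recurrence p x y)
    where
    same : ∀ x → left (pathGlue (p , zero)) x y ≡ left (path p) x y
    same zero    = refl
    same (suc x) = refl
  glued (suc q) = none x
    where
    none : ∀ x → 0ℤ + left (pathGlue (p , suc q)) x y + 0ℤ ≡ 0ℤ
    none zero    = refl
    none (suc x) = refl

_⋖_ : ℕ × ℕ → ℕ × ℕ → Set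
(x , y) ⋖ (p , q) = q ℕ.< y ⊎ (q ≡ y × x ℕ.< p)

grid-sorted : ∀ a n → AllPairs _⋖_ (grid a n)
grid-sorted a zero    = []
grid-sorted a (suc n) = AllPairs.++⁺ (AllPairs.map⁺ (AllPairs.map (λ x<p → inj₂ (refl , x<p)) (range-sorted 0 a))) (grid-sorted a n)
  (All.map⁺ (All.tabulate (λ _ → All.tabulate (λ k∈ → inj₁ (proj₂ (∈-grid⁻ a n k∈))))))

⋖⇒≢ : ∀ {c k} → c ⋖ k → c ≢ k
⋖⇒≢ (inj₁ q<y)       refl = ℕ.<-irrefl refl q<y
⋖⇒≢ (inj₂ (_ , x<p)) refl = ℕ.<-irrefl refl x<p

tri-triangular : ∀ {c k} → c ⋖ k → tri k c ≡ 0ℤ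
tri-triangular {x , y} {p , q} c⋖k = cong₂ _+_ (cong₂ _+_ (δ₂-≢ (p , q) (x , y) (⋖⇒≢ c⋖k ∘ sym)) (δ₂-≢ (suc p , q) (x , y) (≢₁ c⋖k))) (δ₂-≢ (p , q) (x , suc y) (≢₂ c⋖k))
  where
  ≢₁ : (x , y) ⋖ (p , q) → (suc p , q) ≢ (x , y)
  ≢₁ (inj₁ q<y)       refl = ℕ.<-irrefl refl q<y
  ≢₁ (inj₂ (_ , x<p)) refl = ℕ.<⇒≱ x<p (ℕ.n≤1+n p)
  ≢₂ : (x , y) ⋖ (p , q) → (p , q) ≢ (x , suc y)
  ≢₂ (inj₁ q<y)       refl = ℕ.<⇒≱ q<y (ℕ.n≤1+n y)
  ≢₂ (inj₂ (_ , x<p)) refl = ℕ.<-irrefl refl x<p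

tri-diagonal : ∀ k → tri k k ≡ 1ℤ
tri-diagonal (p , q) = cong₂ _+_ (cong₂ _+_ (δ₂-refl (p , q)) (δ₂-≢ (suc p , q) (p , q) (λ ()))) (δ₂-≢ (p , q) (p , suc q) (λ ()))

∣sgn∣ : ∀ n → ∣ sgn n ∣ ≡ 1
∣sgn∣ zero          = refl
∣sgn∣ (suc zero)    = refl
∣sgn∣ (suc (suc n)) = ∣sgn∣ n

-- Expanding along the unit rows, which precede the others in `grid`, reduces the size from a² to a.
D-rows-above-zero : ∀ a n (M : ℕ × ℕ → ℕ × ℕ → ℤ) → 1 ℕ.≤ n → (∀ p q c → M (p , suc q) c ≡ δ₂ (p , suc q) c) →
  D (map M (grid a n)) (grid a n) ≡ D (map M (grid a 1)) (grid a 1)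
D-rows-above-zero a (suc zero)    M _ unit = refl
D-rows-above-zero a (suc (suc n)) M _ unit = ≡.trans
  (D-unit-rows M (map (_, suc n) (range 0 a)) (grid a (suc n)) diagonal
    (AllPairs.map⁺ (AllPairs.map (λ {p} {x} p<x → ≡.trans (unit p n (x , suc n)) (δ₂-≢ (p , suc n) (x , suc n) λ { refl → ℕ.<-irrefl refl p<x })) (range-sorted 0 a)))
    zeros)
  (D-rows-above-zero a (suc n) M (ℕ.s≤s ℕ.z≤n) unit)
  where
  diagonal : ∀ {x} → x ∈ map (_, suc n) (range 0 a) → M x x ≡ 1ℤ
  diagonal x∈ with p , _ , refl ← ∈-map⁻ (_, suc n) x∈ = ≡.trans (unit p n (p , suc n)) (δ₂-refl (p , suc n))
  zeros : ∀ {x c} → x ∈ map (_, suc n) (range 0 a) → c ∈ grid a (suc n) → M x c ≡ 0ℤ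
  zeros {c = c} x∈ c∈ with p , _ , refl ← ∈-map⁻ (_, suc n) x∈ =
    ≡.trans (unit p n c) (δ₂-≢ (p , suc n) c λ { refl → ℕ.<-irrefl refl (proj₂ (∈-grid⁻ a (suc n) c∈)) })

∣D∣-rhombus : ∀ a → 1 ℕ.≤ a → ∣ D (map (λ k c → tri k c + glue k c) (grid a a)) (grid a a) ∣ ≡ length (cyclicChains a)
∣D∣-rhombus a 1≤a = begin
  ∣ D (map (λ k c → tri k c + glue k c) G) G ∣
    ≡⟨ cong ∣_∣ (D-cong-map G G (linComb-coordinates a)) ⟩
  ∣ D (map (λ k → linComb tri G (M k)) G) G ∣
    ≡⟨ cong (λ R → ∣ D R G ∣) (List.map-∘ G) ⟩
  ∣ D (map (linComb tri G) (map M G)) G ∣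
    ≡⟨ cong ∣_∣ (D-linComb tri G (map M G) G (List.length-map M G)) ⟩
  ∣ D (map M G) G · D (map tri G) G ∣
    ≡⟨ cong (λ z → ∣ D (map M G) G · z ∣) (D-triangular tri G (λ {k} _ → tri-diagonal k) (AllPairs.map tri-triangular (grid-sorted a a))) ⟩
  ∣ D (map M G) G · 1ℤ ∣
    ≡⟨ cong ∣_∣ (ℤ.*-identityʳ (D (map M G) G)) ⟩
  ∣ D (map M G) G ∣
    ≡⟨ cong ∣_∣ (D-rows-above-zero a a M 1≤a (λ p q c → ℤ.+-identityʳ (δ₂ (p , suc q) c))) ⟩
  ∣ D (map M (grid a 1)) (grid a 1) ∣
    ≡⟨ cong (λ L → ∣ D (map M L) L ∣) (List.++-identityʳ (map (_, 0) L)) ⟩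
  ∣ D (map M (map (_, 0) L)) (map (_, 0) L) ∣
    ≡⟨ cong ∣_∣ (D-relabel (_, 0) (map M (map (_, 0) L)) L) ⟨
  ∣ D (map (_∘ (_, 0)) (map M (map (_, 0) L))) L ∣
    ≡⟨ cong (λ R → ∣ D R L ∣) (≡.trans (cong (map (_∘ (_, 0))) (sym (List.map-∘ L))) (sym (List.map-∘ L))) ⟩
  ∣ D (map (λ p x → M (p , 0) (x , 0)) L) L ∣
    -- The sign (-1)^(p + x) of the paths may be put on the Kronecker delta as well, since it is 1
    -- on the diagonal. It is then a product of a row sign and a column sign.
    ≡⟨ cong ∣_∣ (D-cong-map L L (λ {p} {x} _ _ → signs p x)) ⟩
  ∣ D (map (λ p x → sgn x · (sgn p · (δ p x + b (suc p) x))) L) L ∣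
    ≡⟨ D-scale-columns sgn (λ p x → sgn p · (δ p x + b (suc p) x)) L L ∣sgn∣ ⟩
  ∣ D (map (λ p x → sgn p · (δ p x + b (suc p) x)) L) L ∣
    ≡⟨ D-scale-rows sgn (λ p x → δ p x + b (suc p) x) L L ∣sgn∣ ⟩
  ∣ D (map (λ p x → δ p x + b (suc p) x) L) L ∣
    ≡⟨ cong ∣_∣ (D-δ+b a) ⟩
  length (cyclicChains a) ∎
  where
  open ≡-Reasoning
  G = grid a a
  L = range 0 a
  M : ℕ × ℕ → ℕ × ℕ → ℤ
  M k c = δ₂ k c + pathGlue k c
  signs : ∀ p x → M (p , 0) (x , 0) ≡ sgn x · (sgn p · (δ p x + b (suc p) x))
  signs p x with p ℕ.≟ x
  ... | no p≢x rewrite δ-≢ p≢x = simplify (sgn x) (sgn p) (b (suc p) x)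
    where
    simplify : ∀ s t z → 0ℤ · 1ℤ + s · (t · z) ≡ s · (t · (0ℤ + z))
    simplify = solve-∀
  ... | yes refl rewrite δ-refl p = ≡.trans (cong (λ z → z + sgn p · (sgn p · b (suc p) p)) (sym (sgn-square p))) (simplify (sgn p) (b (suc p) p))
    where
    simplify : ∀ s z → s · s + s · (s · z) ≡ s · (s · (1ℤ + z))
    simplify = solve-∀

-- Matchings between finite lists

AllPairs-extract : ∀ {R : A → A → Set} → Symmetric R → ∀ xs {y ys} → AllPairs R (xs ++ y ∷ ys) →
  All (R y) (xs ++ ys) × AllPairs R (xs ++ ys)
AllPairs-extract R-sym []       (py ∷ pys) = py , pys
AllPairs-extract R-sym (x ∷ xs) (px ∷ p)
  with py , pys ← AllPairs-extract R-sym xs p | pxs , (pxy ∷ pxys) ← All.++⁻ xs px =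
  (R-sym pxy ∷ py) , (All.++⁺ pxs pxys ∷ pys)

-- Distinctness means having no common partner, so elements such as cubes, which are functions,
-- never have to be compared by propositional equality. `Y′` lists the partners in the order of `X`.
matching : ∀ (_~_ : A → B → Set) X Y →
  AllPairs (λ x x′ → ∀ y → x ~ y → ¬ x′ ~ y) X → AllPairs (λ y y′ → ∀ x → x ~ y → ¬ x ~ y′) Y →
  (∀ {x} → x ∈ X → ∃ λ y → y ∈ Y × x ~ y) → (∀ {y} → y ∈ Y → ∃ λ x → x ∈ X × x ~ y) →
  ∃ λ Y′ → Y′ ↭ Y × Pointwise _~_ X Y′
matching _~_ []      []      _ _ _ _ = [] , refl , []
matching _~_ []      (y ∷ Y) _ _ _ g with () ← proj₁ (proj₂ (g (here refl)))
matching _~_ (x ∷ X) Y (px ∷ pX) pY f g with f (here refl)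
... | y , y∈Y , x~y with ∈-∃++ y∈Y
... | Y₁ , Y₂ , refl = add-y (matching _~_ X (Y₁ ++ Y₂) pX (proj₂ extracted) f′ g′)
  where
  extracted = AllPairs-extract (λ r z p q → r z q p) Y₁ pY
  f′ : ∀ {x′} → x′ ∈ X → ∃ λ y′ → y′ ∈ Y₁ ++ Y₂ × x′ ~ y′
  f′ x′∈ with f (there x′∈)
  ... | y′ , y′∈ , x′~y′ with ↭.∈-resp-↭ (↭.shift y Y₁ Y₂) y′∈
  ... | here refl  = contradiction x′~y′ (All.lookup px x′∈ y x~y)
  ... | there y′∈′ = y′ , y′∈′ , x′~y′
  g′ : ∀ {y′} → y′ ∈ Y₁ ++ Y₂ → ∃ λ x′ → x′ ∈ X × x′ ~ y′
  g′ y′∈ with g (↭.∈-resp-↭ (↭-sym (↭.shift y Y₁ Y₂)) (there y′∈))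
  ... | x′ , here refl , x~y′   = contradiction x~y′ (All.lookup (proj₁ extracted) y′∈ x x~y)
  ... | x′ , there x′∈ , x′~y′ = x′ , x′∈ , x′~y′
  add-y : (∃ λ Y′ → Y′ ↭ Y₁ ++ Y₂ × Pointwise _~_ X Y′) → ∃ λ Y′ → Y′ ↭ Y₁ ++ y ∷ Y₂ × Pointwise _~_ (x ∷ X) Y′
  add-y (Y′ , Y′↭ , X~Y′) = y ∷ Y′ , trans (prep y Y′↭) (↭-sym (↭.shift y Y₁ Y₂)) , x~y ∷ X~Y′

matching-length : ∀ {_~_ : A → B → Set} {X Y} → (∃ λ Y′ → Y′ ↭ Y × Pointwise _~_ X Y′) → length X ≡ length Y
matching-length (Y′ , p , X~Y′) = ≡.trans (Pointwise.Pointwise-length X~Y′) (↭.↭-length p)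

AllPairs-restrict : ∀ {P : A → Set} {R S : A → A → Set} {xs} → (∀ {x y} → P x → P y → R x y → S x y) →
  (∀ {x} → x ∈ xs → P x) → AllPairs R xs → AllPairs S xs
AllPairs-restrict f p []       = []
AllPairs-restrict f p (r ∷ rs) =
  All.tabulate (λ y∈ → f (p (here refl)) (p (there y∈)) (All.lookup r y∈)) ∷ AllPairs-restrict f (p ∘ there) rs

-- `g` recovers the block that an element comes from, so different blocks are disjoint.
concatMap-unique : ∀ (f : A → List B) (g : B → A) → (∀ x {y} → y ∈ f x → g y ≡ x) → (∀ x → Unique (f x)) →
  ∀ {xs} → Unique xs → Unique (concatMap f xs)
concatMap-unique f g gf f! {[]}     []         = []
concatMap-unique f g gf f! {x ∷ xs} (x∉ ∷ xs!) = Unique.++⁺ (f! x) (concatMap-unique f g gf f! xs!)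
  λ { (y∈fx , y∈rest) → disjoint x∉ y∈fx (∈-concatMap⁻ f y∈rest) }
  where
  disjoint : ∀ {zs y} → All (x ≢_) zs → y ∈ f x → Any (λ z → y ∈ f z) zs → ⊥
  disjoint (x≢z ∷ _)  y∈fx (here y∈fz) = x≢z (≡.trans (sym (gf x y∈fx)) (gf _ y∈fz))
  disjoint (_ ∷ x∉zs) y∈fx (there any) = disjoint x∉zs y∈fx any

-- Rows and columns may change their labels, even the type of these; this is how monomials give way
-- to cells of the rhombus.
D-cong-Pointwise : ∀ {X Y : Set} {P : X → Y → Set} {Q : A → B → Set} {M : X → A → ℤ} {N : Y → B → ℤ} →
  (∀ {x y c d} → P x y → Q c d → M x c ≡ N y d) →
  ∀ {xs ys C E} → Pointwise P xs ys → Pointwise Q C E → D (map M xs) C ≡ D (map N ys) E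
D-cong-Pointwise eq []       []        = refl
D-cong-Pointwise eq []       (_ ∷ _)   = refl
D-cong-Pointwise {Q = Q} eq (p ∷ ps) qs = go (eq p) (D-cong-Pointwise eq ps) qs
  where
  go : ∀ {v w ω ψ C E} → (∀ {c d} → Q c d → v c ≡ w d) → (∀ {C E} → Pointwise Q C E → ω C ≡ ψ E) →
    Pointwise Q C E → wedge v ω C ≡ wedge w ψ E
  go vw ωψ []       = refl
  go vw ωψ (q ∷ qs) = cong₂ (λ x y → x + -1ℤ · y) (cong₂ _·_ (vw q) (ωψ qs)) (go vw (ωψ ∘ (q ∷_)) qs)

-- Orbits of monomials

InBox : ℕ → Mon → Set
InBox a (i , j , k) = i ℕ.< 2 ℕ.* a × j ℕ.< 2 ℕ.* a × k ℕ.< 2 ℕ.* a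

Orbit : Mon → Mon → Set
Orbit t u = u ≡ t ⊎ u ≡ ρ t ⊎ u ≡ ρ (ρ t)

Orbit-sym : ∀ {t u} → Orbit t u → Orbit u t
Orbit-sym (inj₁ refl)        = inj₁ refl
Orbit-sym (inj₂ (inj₁ refl)) = inj₂ (inj₂ refl)
Orbit-sym (inj₂ (inj₂ refl)) = inj₂ (inj₁ refl)

Orbit-trans : ∀ {t u v} → Orbit t u → Orbit u v → Orbit t v
Orbit-trans (inj₁ refl)        o                  = o
Orbit-trans (inj₂ (inj₁ refl)) (inj₁ refl)        = inj₂ (inj₁ refl)
Orbit-trans (inj₂ (inj₁ refl)) (inj₂ (inj₁ refl)) = inj₂ (inj₂ refl)
Orbit-trans (inj₂ (inj₁ refl)) (inj₂ (inj₂ refl)) = inj₁ refl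
Orbit-trans (inj₂ (inj₂ refl)) (inj₁ refl)        = inj₂ (inj₂ refl)
Orbit-trans (inj₂ (inj₂ refl)) (inj₂ (inj₁ refl)) = inj₁ refl
Orbit-trans (inj₂ (inj₂ refl)) (inj₂ (inj₂ refl)) = inj₂ (inj₁ refl)

InBox-orbit : ∀ a {t u} → Orbit t u → InBox a t → InBox a u
InBox-orbit a (inj₁ refl)        box         = box
InBox-orbit a (inj₂ (inj₁ refl)) (i , j , k) = k , i , j
InBox-orbit a (inj₂ (inj₂ refl)) (i , j , k) = j , k , i

deg-ρ : ∀ t → deg (ρ t) ≡ deg t
deg-ρ (i , j , k) = shuffle i j k
  where
  shuffle : ∀ i j k → k ℕ.+ i ℕ.+ j ≡ i ℕ.+ j ℕ.+ k
  shuffle = ℕ-solve-∀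

deg-orbit : ∀ {t u} → Orbit t u → deg u ≡ deg t
deg-orbit         (inj₁ refl)        = refl
deg-orbit {t = t} (inj₂ (inj₁ refl)) = deg-ρ t
deg-orbit {t = t} (inj₂ (inj₂ refl)) = ≡.trans (deg-ρ (ρ t)) (deg-ρ t)

==ᵐ⇒≡ : ∀ s t → Bool.T (s ==ᵐ t) → s ≡ t
==ᵐ⇒≡ (i , j , k) (i′ , j′ , k′) eq with i≡ , jk ← to T-∧ eq with j≡ , k≡ ← to T-∧ jk =
  cong₂ _,_ (ℕ.≡ᵇ⇒≡ i i′ i≡) (cong₂ _,_ (ℕ.≡ᵇ⇒≡ j j′ j≡) (ℕ.≡ᵇ⇒≡ k k′ k≡))

==ᵐ-refl : ∀ t → Bool.T (t ==ᵐ t)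
==ᵐ-refl (i , j , k) = from T-∧ (ℕ.≡⇒≡ᵇ i i refl , from T-∧ (ℕ.≡⇒≡ᵇ j j refl , ℕ.≡⇒≡ᵇ k k refl))

orbitSum-in : ∀ t {u} → Orbit t u → orbitSum t u ≡ 1ℤ
orbitSum-in t {u} o = cong (if_then 1ℤ else 0ℤ) (to T-≡ (member o))
  where
  member : ∀ {u} → Orbit t u → Bool.T ((u ==ᵐ t) ∨ (u ==ᵐ ρ t) ∨ (u ==ᵐ ρ (ρ t)))
  member (inj₁ refl)        = from T-∨ (inj₁ (==ᵐ-refl t))
  member (inj₂ (inj₁ refl)) = from (T-∨ {ρ t ==ᵐ t}) (inj₂ (from T-∨ (inj₁ (==ᵐ-refl (ρ t)))))
  member (inj₂ (inj₂ refl)) = from (T-∨ {ρ (ρ t) ==ᵐ t}) (inj₂ (from (T-∨ {ρ (ρ t) ==ᵐ ρ t}) (inj₂ (==ᵐ-refl (ρ (ρ t))))))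

orbitSum-out : ∀ t {u} → ¬ Orbit t u → orbitSum t u ≡ 0ℤ
orbitSum-out t {u} ¬o with (u ==ᵐ t) ∨ (u ==ᵐ ρ t) ∨ (u ==ᵐ ρ (ρ t)) in eq
... | false = refl
... | true with to (T-∨ {u ==ᵐ t}) (from T-≡ eq)
...   | inj₁ e = contradiction (inj₁ (==ᵐ⇒≡ u t e)) ¬o
...   | inj₂ e with to (T-∨ {u ==ᵐ ρ t}) e
...     | inj₁ e′ = contradiction (inj₂ (inj₁ (==ᵐ⇒≡ u (ρ t) e′))) ¬o
...     | inj₂ e′ = contradiction (inj₂ (inj₂ (==ᵐ⇒≡ u (ρ (ρ t)) e′))) ¬o

orbitSum-ρ : ∀ t u → orbitSum t (ρ u) ≡ orbitSum t u
orbitSum-ρ t u with orbit? u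
  where
  _≟ᵐ_ : (s t : Mon) → Dec (s ≡ t)
  _≟ᵐ_ = ≡-dec ℕ._≟_ (≡-dec ℕ._≟_ ℕ._≟_)
  orbit? : ∀ u → Dec (Orbit t u)
  orbit? u = (u ≟ᵐ t) ⊎-dec ((u ≟ᵐ ρ t) ⊎-dec (u ≟ᵐ ρ (ρ t)))
... | yes o = ≡.trans (orbitSum-in t (Orbit-trans o (inj₂ (inj₁ refl)))) (sym (orbitSum-in t o))
... | no ¬o = ≡.trans (orbitSum-out t (λ o → ¬o (Orbit-trans o (inj₂ (inj₂ refl))))) (sym (orbitSum-out t ¬o))

data _≤ˡᵉˣ_ : Mon → Mon → Set where
  first  : ∀ {i j k i′ j′ k′} → i ℕ.< i′ → (i , j , k) ≤ˡᵉˣ (i′ , j′ , k′)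
  second : ∀ {i j k j′ k′} → j ℕ.< j′ → (i , j , k) ≤ˡᵉˣ (i , j′ , k′)
  third  : ∀ {i j k k′} → k ℕ.≤ k′ → (i , j , k) ≤ˡᵉˣ (i , j , k′)

≤ˡᵉˣ-antisym : ∀ {s t} → s ≤ˡᵉˣ t → t ≤ˡᵉˣ s → s ≡ t
≤ˡᵉˣ-antisym (first p)  (first q)  = contradiction q (ℕ.<-asym p)
≤ˡᵉˣ-antisym (first p)  (second q) = contradiction p (ℕ.<-irrefl refl)
≤ˡᵉˣ-antisym (first p)  (third q)  = contradiction p (ℕ.<-irrefl refl)
≤ˡᵉˣ-antisym (second p) (first q)  = contradiction q (ℕ.<-irrefl refl)
≤ˡᵉˣ-antisym (second p) (second q) = contradiction q (ℕ.<-asym p)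
≤ˡᵉˣ-antisym (second p) (third q)  = contradiction p (ℕ.<-irrefl refl)
≤ˡᵉˣ-antisym (third p)  (first q)  = contradiction q (ℕ.<-irrefl refl)
≤ˡᵉˣ-antisym (third p)  (second q) = contradiction q (ℕ.<-irrefl refl)
≤ˡᵉˣ-antisym (third p)  (third q)  = cong (λ k → _ , _ , k) (ℕ.≤-antisym p q)

≤ˡ⇒≤ˡᵉˣ : ∀ s t → Bool.T (s ≤ˡ t) → s ≤ˡᵉˣ t
≤ˡ⇒≤ˡᵉˣ s@(i , j , k) t@(i′ , j′ , k′) p with to (T-∨ {s <ˡ t}) p
... | inj₂ e with refl ← ==ᵐ⇒≡ s t e = third ℕ.≤-refl
... | inj₁ l with to (T-∨ {i ℕ.<ᵇ i′}) l
... | inj₁ i< = first (ℕ.<ᵇ⇒< i i′ i<)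
... | inj₂ e with i≡ , l₂ ← to T-∧ e with refl ← ℕ.≡ᵇ⇒≡ i i′ i≡ | to (T-∨ {j ℕ.<ᵇ j′}) l₂
... | inj₁ j< = second (ℕ.<ᵇ⇒< j j′ j<)
... | inj₂ e₂ with j≡ , k< ← to T-∧ e₂ with refl ← ℕ.≡ᵇ⇒≡ j j′ j≡ = third (ℕ.<⇒≤ (ℕ.<ᵇ⇒< k k′ k<))

canonical-unique : ∀ {t u} → Bool.T (canonical t) → Bool.T (canonical u) → Orbit t u → t ≡ u
canonical-unique {t} {u} ct cu o with t≤ρt , t≤ρρt ← to (T-∧ {t ≤ˡ ρ t}) ct | u≤ρu , u≤ρρu ← to (T-∧ {u ≤ˡ ρ u}) cu with o
... | inj₁ refl        = refl
... | inj₂ (inj₁ refl) = ≤ˡᵉˣ-antisym (≤ˡ⇒≤ˡᵉˣ t u t≤ρt) (≤ˡ⇒≤ˡᵉˣ u t u≤ρρu)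
... | inj₂ (inj₂ refl) = ≤ˡᵉˣ-antisym (≤ˡ⇒≤ˡᵉˣ t u t≤ρρt) (≤ˡ⇒≤ˡᵉˣ u t u≤ρu)

<ˡ-first : ∀ s t → proj₁ s ℕ.< proj₁ t → Bool.T (s ≤ˡ t)
<ˡ-first s t i<i′ = from T-∨ (inj₁ (from T-∨ (inj₁ (ℕ.<⇒<ᵇ i<i′))))

<ˡ-second : ∀ i s t → proj₁ s ℕ.< proj₁ t → Bool.T ((i , s) ≤ˡ (i , t))
<ˡ-second i s t j<j′ = from T-∨ (inj₁ (from (T-∨ {i ℕ.<ᵇ i}) (inj₂ (from T-∧ (ℕ.≡⇒≡ᵇ i i refl , from T-∨ (inj₁ (ℕ.<⇒<ᵇ j<j′)))))))

-- The condition `i < k` breaks ties: of two equal minimal exponents, which are cyclically adjacent,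
-- it selects the first. A triple none of whose rotations has this form is constant.
canonical-< : ∀ {i j k} → i ℕ.≤ j → i ℕ.< k → Bool.T (canonical (i , j , k))
canonical-< {i} {j} {k} i≤j i<k = from (T-∧ {(i , j , k) ≤ˡ (k , i , j)}) (<ˡ-first (i , j , k) (k , i , j) i<k , rest (ℕ.m≤n⇒m<n∨m≡n i≤j))
  where
  rest : i ℕ.< j ⊎ i ≡ j → Bool.T ((i , j , k) ≤ˡ (j , k , i))
  rest (inj₁ i<j)  = <ˡ-first (i , j , k) (j , k , i) i<j
  rest (inj₂ refl) = <ˡ-second i (i , k) (k , i) i<k

canonical-≡ : ∀ i → Bool.T (canonical (i , i , i))
canonical-≡ i = from (T-∧ {t ≤ˡ t}) (t≤t , t≤t)
  where
  t = i , i , i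
  t≤t : Bool.T (t ≤ˡ t)
  t≤t = from (T-∨ {t <ˡ t}) (inj₂ (==ᵐ-refl t))

canonical-exists : ∀ t → ∃ λ u → Orbit t u × Bool.T (canonical u)
canonical-exists t@(i , j , k) with i ℕ.≤? j
canonical-exists t@(i , j , k) | yes i≤j with i ℕ.<? k
... | yes i<k = t , inj₁ refl , canonical-< i≤j i<k
... | no i≮k with k ℕ.<? j
...   | yes k<j = ρ t , inj₂ (inj₁ refl) , canonical-< (ℕ.≮⇒≥ i≮k) k<j
...   | no k≮j with refl ← ℕ.≤-antisym i≤j (ℕ.≤-trans (ℕ.≮⇒≥ k≮j) (ℕ.≮⇒≥ i≮k))
               | refl ← ℕ.≤-antisym (ℕ.≮⇒≥ i≮k) (ℕ.≤-trans i≤j (ℕ.≮⇒≥ k≮j)) = t , inj₁ refl , canonical-≡ i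
canonical-exists t@(i , j , k) | no i≰j with j ℕ.≤? k
... | yes j≤k = ρ (ρ t) , inj₂ (inj₂ refl) , canonical-< j≤k (ℕ.≰⇒> i≰j)
... | no j≰k = ρ t , inj₂ (inj₁ refl) , canonical-< (ℕ.<⇒≤ (ℕ.<-trans (ℕ.≰⇒> j≰k) (ℕ.≰⇒> i≰j))) (ℕ.≰⇒> j≰k)

line : ℕ → ℕ → ℕ → List Mon
line n i j = map (λ k → (i , j , k)) (upTo n)

plane : ℕ → ℕ → List Mon
plane n i = concatMap (line n i) (upTo n)

box : ℕ → List Mon
box n = concatMap (plane n) (upTo n)

∈-box⁺ : ∀ {n i j k} → i ℕ.< n → j ℕ.< n → k ℕ.< n → (i , j , k) ∈ box n
∈-box⁺ {n} {i} {j} i< j< k< =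
  ∈-concatMap⁺ (plane n) (lose (∈-upTo⁺ i<) (∈-concatMap⁺ (line n i) (lose (∈-upTo⁺ j<) (∈-map⁺ (λ k → i , j , k) (∈-upTo⁺ k<)))))

∈-box⁻ : ∀ {n t} → t ∈ box n → proj₁ t ℕ.< n × proj₁ (proj₂ t) ℕ.< n × proj₂ (proj₂ t) ℕ.< n
∈-box⁻ {n} t∈ with i , i∈ , t∈plane ← find (∈-concatMap⁻ (plane n) t∈)
  with j , j∈ , t∈line ← find (∈-concatMap⁻ (line n i) t∈plane)
  with k , k∈ , refl ← ∈-map⁻ (λ k → i , j , k) t∈line = ∈-upTo⁻ i∈ , ∈-upTo⁻ j∈ , ∈-upTo⁻ k∈

box-unique : ∀ n → Unique (box n)
box-unique n = concatMap-unique (plane n) proj₁ fst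
  (λ i → concatMap-unique (line n i) (proj₁ ∘ proj₂) (snd i) (λ j → Unique.map⁺ (λ { refl → refl }) (Unique.upTo⁺ n)) (Unique.upTo⁺ n))
  (Unique.upTo⁺ n)
  where
  snd : ∀ i j {t} → t ∈ line n i j → proj₁ (proj₂ t) ≡ j
  snd i j t∈ with _ , _ , refl ← ∈-map⁻ (λ k → i , j , k) t∈ = refl
  fst : ∀ i {t} → t ∈ plane n i → proj₁ t ≡ i
  fst i t∈ with j , _ , t∈line ← find (∈-concatMap⁻ (line n i) {xs = upTo n} t∈) with _ , _ , refl ← ∈-map⁻ (λ k → i , j , k) t∈line = refl

∈-invBasis⁺ : ∀ {a r t} → InBox a t → deg t ≡ r → Bool.T (canonical t) → t ∈ invBasis a r
∈-invBasis⁺ {a} {r} {t} (i< , j< , k<) deg≡ can =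
  ∈-filter⁺ (Bool.T? ∘ _) (∈-box⁺ i< j< k<) (from T-∧ (ℕ.≡⇒≡ᵇ (deg t) r deg≡ , can))

∈-invBasis⁻ : ∀ {a r t} → t ∈ invBasis a r → InBox a t × deg t ≡ r × Bool.T (canonical t)
∈-invBasis⁻ {a} {r} {t} t∈ with t∈box , p ← ∈-filter⁻ (Bool.T? ∘ _) {xs = box (2 ℕ.* a)} t∈ with deg≡ , can ← to (T-∧ {deg t ℕ.≡ᵇ r}) p =
  ∈-box⁻ t∈box , ℕ.≡ᵇ⇒≡ (deg t) r deg≡ , can

invBasis-unique : ∀ a r → Unique (invBasis a r)
invBasis-unique a r = Unique.filter⁺ (Bool.T? ∘ _) (box-unique (2 ℕ.* a))

-- The rhombus of orbit representatives

-- For e = a - 1 (degree 3a - 2) and e = a (degree 3a - 1), the monomials of the box with first exponent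
-- below a and last exponent at least a form an a × a rhombus, and meet every orbit exactly once.
data Rep (a e : ℕ) : ℕ × ℕ → Mon → Set where
  rep : ∀ {p q i j k} → i ℕ.+ suc p ≡ a → j ℕ.+ q ≡ e ℕ.+ p → k ≡ a ℕ.+ q → Rep a e (p , q) (i , j , k)

InCell : ℕ → ℕ → Mon → ℕ × ℕ → Set
InCell a e t c = ∃ λ u → Orbit t u × Rep a e c u

Rep-monomial : ∀ {a e c u u′} → Rep a e c u → Rep a e c u′ → u ≡ u′
Rep-monomial {c = p , q} {u = i , j , k} {u′ = i′ , j′ , k′} (rep ri rj rk) (rep ri′ rj′ rk′) =
  cong₂ _,_ (ℕ.+-cancelʳ-≡ (suc p) i i′ (≡.trans ri (sym ri′)))
            (cong₂ _,_ (ℕ.+-cancelʳ-≡ q j j′ (≡.trans rj (sym rj′))) (≡.trans rk (sym rk′)))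

Rep-cell : ∀ {a e c c′ u} → Rep a e c u → Rep a e c′ u → c ≡ c′
Rep-cell {a} {c = p , q} {c′ = p′ , q′} {u = i , j , k} (rep ri _ rk) (rep ri′ _ rk′) =
  cong₂ _,_ (ℕ.suc-injective (ℕ.+-cancelˡ-≡ i (suc p) (suc p′) (≡.trans ri (sym ri′))))
            (ℕ.+-cancelˡ-≡ a q q′ (≡.trans (sym rk) rk′))

Rep-low : ∀ {a e c u} → Rep a e c u → proj₁ u ℕ.< a
Rep-low {c = p , q} {u = i , j , k} (rep refl _ _) = ℕ.m<m+n i ℕ.z<s

Rep-high : ∀ {a e c u} → Rep a e c u → a ℕ.≤ proj₂ (proj₂ u)
Rep-high {a} {c = p , q} (rep _ _ refl) = ℕ.m≤m+n a q

-- A nontrivial rotation moves the last exponent to the front or the first one to the end, and these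
-- lie on opposite sides of a.
Rep-orbit : ∀ {a e c c′ u u′} → Rep a e c u → Rep a e c′ u′ → Orbit u u′ → c ≡ c′
Rep-orbit r r′ (inj₁ refl)        = Rep-cell r r′
Rep-orbit r r′ (inj₂ (inj₁ refl)) = contradiction (Rep-low r′) (ℕ.≤⇒≯ (Rep-high r))
Rep-orbit r r′ (inj₂ (inj₂ refl)) = contradiction (Rep-low r) (ℕ.≤⇒≯ (Rep-high r′))

InCell-functional : ∀ {a e t c c′} → InCell a e t c → InCell a e t c′ → c ≡ c′
InCell-functional (u , o , r) (u′ , o′ , r′) = Rep-orbit r r′ (Orbit-trans (Orbit-sym o) o′)

InCell-orbit : ∀ {a e t t′ c} → InCell a e t c → InCell a e t′ c → Orbit t t′
InCell-orbit (u , o , r) (u′ , o′ , r′) with refl ← Rep-monomial r r′ = Orbit-trans o (Orbit-sym o′)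

∈-range⁺ : ∀ o n {x} → o ℕ.≤ x → x ℕ.< o ℕ.+ n → x ∈ range o n
∈-range⁺ o zero    o≤x x< = contradiction (ℕ.<-≤-trans x< (ℕ.≤-trans (ℕ.≤-reflexive (ℕ.+-identityʳ o)) o≤x)) (ℕ.<-irrefl refl)
∈-range⁺ o (suc n) {x} o≤x x< with o ℕ.≟ x
... | yes refl = here refl
... | no o≢x   = there (∈-range⁺ (suc o) n (ℕ.≤∧≢⇒< o≤x o≢x) (ℕ.<-≤-trans x< (ℕ.≤-reflexive (ℕ.+-suc o n))))

∈-grid⁺ : ∀ a n {p q} → p ℕ.< a → q ℕ.< n → (p , q) ∈ grid a n
∈-grid⁺ a (suc n) {p} {q} p<a q<1+n with q ℕ.≟ n
... | yes refl = ∈-++⁺ˡ (∈-map⁺ (_, n) (∈-range⁺ 0 a ℕ.z≤n p<a))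
... | no q≢n   = ∈-++⁺ʳ (map (_, n) (range 0 a)) (∈-grid⁺ a n p<a (ℕ.≤∧≢⇒< (ℕ.≤-pred q<1+n) q≢n))

2*a≡a+a : ∀ a → 2 ℕ.* a ≡ a ℕ.+ a
2*a≡a+a a = cong (a ℕ.+_) (ℕ.+-identityʳ a)

-- The outer exponents determine the cell, and the degree then forces the middle one. The degree
-- condition, free of subtraction, covers e = a - 1 and e = a at once.
Rep-exists : ∀ {a e i j k} → i ℕ.< a → a ℕ.≤ k → k ℕ.< 2 ℕ.* a → suc (i ℕ.+ j ℕ.+ k) ≡ a ℕ.+ e ℕ.+ a →
  ∃ λ c → c ∈ grid a a × Rep a e c (i , j , k)
Rep-exists {a} {e} {i} {j} {k} i<a a≤k k<2a deg≡
  with p , i+p≡a ← ℕ.m≤n⇒∃[o]m+o≡n i<a | q , a+q≡k ← ℕ.m≤n⇒∃[o]m+o≡n a≤k =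
  (p , q) ,
  ∈-grid⁺ a a (ℕ.≤-trans (ℕ.s≤s (ℕ.m≤n+m p i)) (ℕ.≤-reflexive i+p≡a))
    (ℕ.+-cancelˡ-< a q a (ℕ.≤-trans (ℕ.s≤s (ℕ.≤-reflexive a+q≡k)) (ℕ.≤-trans k<2a (ℕ.≤-reflexive (2*a≡a+a a))))) ,
  rep (≡.trans (ℕ.+-suc i p) i+p≡a) (ℕ.+-cancelˡ-≡ (a ℕ.+ suc i) (j ℕ.+ q) (e ℕ.+ p) middle) (sym a+q≡k)
  where
  open ≡-Reasoning
  ring₁ : ∀ a i j q → (a ℕ.+ (1 ℕ.+ i)) ℕ.+ (j ℕ.+ q) ≡ 1 ℕ.+ (i ℕ.+ j ℕ.+ (a ℕ.+ q))
  ring₁ = ℕ-solve-∀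
  ring₂ : ∀ a e i p → a ℕ.+ e ℕ.+ (1 ℕ.+ (i ℕ.+ p)) ≡ (a ℕ.+ (1 ℕ.+ i)) ℕ.+ (e ℕ.+ p)
  ring₂ = ℕ-solve-∀
  middle : (a ℕ.+ suc i) ℕ.+ (j ℕ.+ q) ≡ (a ℕ.+ suc i) ℕ.+ (e ℕ.+ p)
  middle = begin
    (a ℕ.+ suc i) ℕ.+ (j ℕ.+ q)      ≡⟨ ring₁ a i j q ⟩
    suc (i ℕ.+ j ℕ.+ (a ℕ.+ q))      ≡⟨ cong (λ x → suc (i ℕ.+ j ℕ.+ x)) a+q≡k ⟩
    suc (i ℕ.+ j ℕ.+ k)              ≡⟨ deg≡ ⟩
    a ℕ.+ e ℕ.+ a                    ≡⟨ cong (a ℕ.+ e ℕ.+_) i+p≡a ⟨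
    a ℕ.+ e ℕ.+ (suc i ℕ.+ p)        ≡⟨ ring₂ a e i p ⟩
    (a ℕ.+ suc i) ℕ.+ (e ℕ.+ p)      ∎

-- Unless all exponents lie on the same side of a, some exponent below a cyclically follows one that
-- is at least a. Three small exponents give degree at most 3a - 3 and three large ones at least 3a;
-- the bounds on `e` exclude both.
InCell-exists : ∀ {a e t} → e ℕ.≤ a → a ℕ.≤ suc e → InBox a t → suc (deg t) ≡ a ℕ.+ e ℕ.+ a →
  ∃ λ c → c ∈ grid a a × InCell a e t c
InCell-exists {a} {e} {t@(i , j , k)} e≤a a≤1+e (i<2a , j<2a , k<2a) deg≡ = go (i ℕ.<? a) (j ℕ.<? a) (k ℕ.<? a)
  where
  rotate : ∀ {u} → Orbit t u → (∃ λ c → c ∈ grid a a × Rep a e c u) → ∃ λ c → c ∈ grid a a × InCell a e t c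
  rotate o (c , c∈ , r) = c , c∈ , _ , o , r
  deg-ρ≡ : suc (deg (ρ t)) ≡ a ℕ.+ e ℕ.+ a
  deg-ρ≡ = ≡.trans (cong suc (deg-ρ t)) deg≡
  deg-ρρ≡ : suc (deg (ρ (ρ t))) ≡ a ℕ.+ e ℕ.+ a
  deg-ρρ≡ = ≡.trans (cong suc (deg-ρ (ρ t))) deg-ρ≡
  open ℕ.≤-Reasoning
  ring : ∀ i j k → (1 ℕ.+ i) ℕ.+ (1 ℕ.+ j) ℕ.+ (1 ℕ.+ k) ≡ 3 ℕ.+ (i ℕ.+ j ℕ.+ k)
  ring = ℕ-solve-∀
  ring′ : ∀ a e → a ℕ.+ (1 ℕ.+ e) ℕ.+ a ≡ 1 ℕ.+ (a ℕ.+ e ℕ.+ a)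
  ring′ = ℕ-solve-∀
  go : Dec (i ℕ.< a) → Dec (j ℕ.< a) → Dec (k ℕ.< a) → ∃ λ c → c ∈ grid a a × InCell a e t c
  go (yes i<a) _         (no k≮a)  = rotate (inj₁ refl) (Rep-exists i<a (ℕ.≮⇒≥ k≮a) k<2a deg≡)
  go _         (no j≮a)  (yes k<a) = rotate (inj₂ (inj₁ refl)) (Rep-exists k<a (ℕ.≮⇒≥ j≮a) j<2a deg-ρ≡)
  go (no i≮a)  (yes j<a) _         = rotate (inj₂ (inj₂ refl)) (Rep-exists j<a (ℕ.≮⇒≥ i≮a) i<2a deg-ρρ≡)
  go (yes i<a) (yes j<a) (yes k<a) = contradiction (begin-strict
    2 ℕ.+ deg t                          <⟨ ℕ.n<1+n _ ⟩
    3 ℕ.+ deg t                          ≡⟨ ring i j k ⟨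
    suc i ℕ.+ suc j ℕ.+ suc k            ≤⟨ ℕ.+-mono-≤ (ℕ.+-mono-≤ i<a j<a) k<a ⟩
    a ℕ.+ a ℕ.+ a                        ≤⟨ ℕ.+-monoˡ-≤ a (ℕ.+-monoʳ-≤ a a≤1+e) ⟩
    a ℕ.+ suc e ℕ.+ a                    ≡⟨ ring′ a e ⟩
    suc (a ℕ.+ e ℕ.+ a)                  ≡⟨ cong suc deg≡ ⟨
    2 ℕ.+ deg t                          ∎) (ℕ.<-irrefl refl)
  go (no i≮a)  (no j≮a)  (no k≮a)  = contradiction (begin-strict
    deg t                                <⟨ ℕ.n<1+n _ ⟩
    suc (deg t)                          ≡⟨ deg≡ ⟩
    a ℕ.+ e ℕ.+ a                        ≤⟨ ℕ.+-monoˡ-≤ a (ℕ.+-monoʳ-≤ a e≤a) ⟩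
    a ℕ.+ a ℕ.+ a                        ≤⟨ ℕ.+-mono-≤ (ℕ.+-mono-≤ (ℕ.≮⇒≥ i≮a) (ℕ.≮⇒≥ j≮a)) (ℕ.≮⇒≥ k≮a) ⟩
    deg t                                ∎) (ℕ.<-irrefl refl)

Rep-inhabited : ∀ {a e p q} → e ℕ.≤ a → a ℕ.≤ suc e → p ℕ.< a → q ℕ.< a →
  ∃ λ u → Rep a e (p , q) u × InBox a u × suc (deg u) ≡ a ℕ.+ e ℕ.+ a
Rep-inhabited {a} {e} {p} {q} e≤a a≤1+e p<a q<a with i , p+i≡a ← ℕ.m≤n⇒∃[o]m+o≡n p<a =
  (i , e ℕ.+ p ℕ.∸ q , a ℕ.+ q) , rep ri rj refl ,
  (subst (i ℕ.<_) (sym (2*a≡a+a a)) (ℕ.<-≤-trans (ℕ.≤-trans (ℕ.s≤s (ℕ.m≤n+m i p)) (ℕ.≤-reflexive p+i≡a)) (ℕ.m≤m+n a a)) ,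
   subst (e ℕ.+ p ℕ.∸ q ℕ.<_) (sym (2*a≡a+a a)) (ℕ.≤-<-trans (ℕ.m∸n≤m (e ℕ.+ p) q) (ℕ.+-mono-≤-< e≤a p<a)) ,
   subst (a ℕ.+ q ℕ.<_) (sym (2*a≡a+a a)) (ℕ.+-monoʳ-< a q<a)) ,
  ℕ.+-cancelʳ-≡ p _ _ (begin
    suc (i ℕ.+ j ℕ.+ (a ℕ.+ q)) ℕ.+ p              ≡⟨ ring₁ a i j p q ⟩
    (i ℕ.+ suc p) ℕ.+ (j ℕ.+ q) ℕ.+ a              ≡⟨ cong₂ (λ x y → x ℕ.+ y ℕ.+ a) ri rj ⟩
    a ℕ.+ (e ℕ.+ p) ℕ.+ a                          ≡⟨ ring₂ a e p ⟩
    a ℕ.+ e ℕ.+ a ℕ.+ p                            ∎)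
  where
  open ≡-Reasoning
  j = e ℕ.+ p ℕ.∸ q
  ring₁ : ∀ a i j p q → 1 ℕ.+ (i ℕ.+ j ℕ.+ (a ℕ.+ q)) ℕ.+ p ≡ (i ℕ.+ (1 ℕ.+ p)) ℕ.+ (j ℕ.+ q) ℕ.+ a
  ring₁ = ℕ-solve-∀
  ring₂ : ∀ a e p → a ℕ.+ (e ℕ.+ p) ℕ.+ a ≡ a ℕ.+ e ℕ.+ a ℕ.+ p
  ring₂ = ℕ-solve-∀
  ri : i ℕ.+ suc p ≡ a
  ri = ≡.trans (ℕ.+-comm i (suc p)) p+i≡a
  rj : e ℕ.+ p ℕ.∸ q ℕ.+ q ≡ e ℕ.+ p
  -- The subtraction is exact: `q < a` and `a ≤ suc e` give `q ≤ e`.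
  rj = ℕ.m∸n+n≡m (ℕ.≤-trans (ℕ.≤-pred (ℕ.≤-trans q<a a≤1+e)) (ℕ.m≤m+n e p))

-- Canonical monomials and cells label the same orbits. The relation carries the memberships in box
-- and grid along, because `entry` uses them.
basis-matching : ∀ a e r → e ℕ.≤ a → a ℕ.≤ suc e → suc r ≡ a ℕ.+ e ℕ.+ a →
  ∃ λ C → C ↭ grid a a × Pointwise (λ t c → InBox a t × InCell a e t c × c ∈ grid a a) (invBasis a r) C
basis-matching a e r e≤a a≤1+e deg≡ = matching _ (invBasis a r) (grid a a)
  (AllPairs-restrict (λ { (_ , _ , ct) (_ , _ , cu) t≢u c (_ , it , _) (_ , iu , _) → t≢u (canonical-unique ct cu (InCell-orbit it iu)) })
    (∈-invBasis⁻ {a} {r}) (invBasis-unique a r))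
  (AllPairs.map (λ c⋖c′ t (_ , it , _) (_ , it′ , _) → ⋖⇒≢ c⋖c′ (InCell-functional it it′)) (grid-sorted a a))
  cell basis
  where
  cell : ∀ {t} → t ∈ invBasis a r → ∃ λ c → c ∈ grid a a × InBox a t × InCell a e t c × c ∈ grid a a
  cell t∈ with boxed , deg-t , _ ← ∈-invBasis⁻ {a} {r} t∈
    with c , c∈ , it ← InCell-exists e≤a a≤1+e boxed (≡.trans (cong suc deg-t) deg≡) = c , c∈ , boxed , it , c∈
  basis : ∀ {c} → c ∈ grid a a → ∃ λ t → t ∈ invBasis a r × InBox a t × InCell a e t c × c ∈ grid a a
  basis {c} c∈ with p<a , q<a ← ∈-grid⁻ a a c∈
    with u , r , boxed , deg-u ← Rep-inhabited e≤a a≤1+e p<a q<a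
    with t , o , can ← canonical-exists u =
    t , ∈-invBasis⁺ {a} (InBox-orbit a o boxed) (≡.trans (deg-orbit o) (ℕ.suc-injective (≡.trans deg-u (sym deg≡)))) can ,
    InBox-orbit a o boxed , (u , Orbit-sym o , r) , c∈

-- Entries of the multiplication matrix

atPred : ℕ → (ℕ → ℤ) → ℤ
atPred zero    f = 0ℤ
atPred (suc n) f = f n

atPred-cong : ∀ n {f g} → (∀ m → f m ≡ g m) → atPred n f ≡ atPred n g
atPred-cong zero    eq = refl
atPred-cong (suc n) eq = eq n

mulXYZ-box : ∀ a f {i j k} → InBox a (i , j , k) → mulXYZ a f (i , j , k) ≡
  atPred i (λ i′ → f (i′ , j , k)) + atPred j (λ j′ → f (i , j′ , k)) + atPred k (λ k′ → f (i , j , k′))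
mulXYZ-box a f {i} {j} {k} (i< , j< , k<)
  rewrite to T-≡ (from (T-∧ {i ℕ.<ᵇ 2 ℕ.* a}) (ℕ.<⇒<ᵇ i< , from (T-∧ {j ℕ.<ᵇ 2 ℕ.* a}) (ℕ.<⇒<ᵇ j< , ℕ.<⇒<ᵇ k<)))
  = cong₂ _+_ (cong₂ _+_ (x i) (y j)) (z k)
  where
  x : ∀ i → (if 1 ℕ.≤ᵇ i then f (i ℕ.∸ 1 , j , k) else 0ℤ) ≡ atPred i (λ i′ → f (i′ , j , k))
  x zero    = refl
  x (suc i) = refl
  y : ∀ j → (if 1 ℕ.≤ᵇ j then f (i , j ℕ.∸ 1 , k) else 0ℤ) ≡ atPred j (λ j′ → f (i , j′ , k))
  y zero    = refl
  y (suc j) = refl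
  z : ∀ k → (if 1 ℕ.≤ᵇ k then f (i , j , k ℕ.∸ 1) else 0ℤ) ≡ atPred k (λ k′ → f (i , j , k′))
  z zero    = refl
  z (suc k) = refl

mulXYZ-ρ : ∀ a {f} → (∀ t → f (ρ t) ≡ f t) → ∀ {t} → InBox a t → mulXYZ a f (ρ t) ≡ mulXYZ a f t
mulXYZ-ρ a {f} f-ρ {i , j , k} boxed = begin
  mulXYZ a f (k , i , j)
    ≡⟨ mulXYZ-box a f (InBox-orbit a (inj₂ (inj₁ refl)) boxed) ⟩
  atPred k (λ k′ → f (k′ , i , j)) + atPred i (λ i′ → f (k , i′ , j)) + atPred j (λ j′ → f (k , i , j′))
    ≡⟨ cong₂ _+_ (cong₂ _+_ (atPred-cong k (λ k′ → f-ρ (i , j , k′))) (atPred-cong i (λ i′ → f-ρ (i′ , j , k)))) (atPred-cong j (λ j′ → f-ρ (i , j′ , k))) ⟩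
  atPred k (λ k′ → f (i , j , k′)) + atPred i (λ i′ → f (i′ , j , k)) + atPred j (λ j′ → f (i , j′ , k))
    ≡⟨ shuffle (atPred k (λ k′ → f (i , j , k′))) _ _ ⟩
  atPred i (λ i′ → f (i′ , j , k)) + atPred j (λ j′ → f (i , j′ , k)) + atPred k (λ k′ → f (i , j , k′))
    ≡⟨ mulXYZ-box a f boxed ⟨
  mulXYZ a f (i , j , k) ∎
  where
  open ≡-Reasoning
  shuffle : ∀ x y z → x + y + z ≡ y + z + x
  shuffle = solve-∀

-- Allows an entry to be evaluated at the representative in the rhombus instead of the canonical
-- monomial.
mulXYZ-orbit : ∀ a {f} → (∀ t → f (ρ t) ≡ f t) → ∀ {t u} → Orbit t u → InBox a t → mulXYZ a f t ≡ mulXYZ a f u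
mulXYZ-orbit a     f-ρ (inj₁ refl)        boxed = refl
mulXYZ-orbit a     f-ρ (inj₂ (inj₁ refl)) boxed = sym (mulXYZ-ρ a f-ρ boxed)
mulXYZ-orbit a {f} f-ρ (inj₂ (inj₂ refl)) boxed =
  ≡.trans (sym (mulXYZ-ρ a f-ρ boxed)) (sym (mulXYZ-ρ a f-ρ (InBox-orbit a (inj₂ (inj₁ refl)) boxed)))

orbitSum-cell : ∀ {a e t w c c′} → InCell a e t c → InCell a e w c′ → orbitSum t w ≡ δ₂ c′ c
orbitSum-cell {t = t} {c = c} {c′} it iw with ≡-dec ℕ._≟_ ℕ._≟_ c′ c
... | yes refl = ≡.trans (orbitSum-in t (InCell-orbit it iw)) (sym (δ₂-refl c))
... | no c′≢c  = ≡.trans (orbitSum-out t λ o → c′≢c (InCell-functional iw (InCell-resp o it))) (sym (δ₂-≢ c′ c c′≢c))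
  where
  InCell-resp : ∀ {a e t w c} → Orbit t w → InCell a e t c → InCell a e w c
  InCell-resp o (u , o′ , r) = u , Orbit-trans (Orbit-sym o) o′ , r

-- The row cell belongs to degree 3a - 1, the column cell to degree 3a - 2. Lowering the first
-- exponent of the representative leads to `(p + 1 , q)`, lowering the middle one to `(p , q)`, and
-- lowering the last one to `(p , q - 1)` or, if `q = 0`, across the glued side.
entry : ∀ {e s t k c} → let a = suc e in InBox a s → InCell a a s k → k ∈ grid a a → InCell a e t c → c ∈ grid a a →
  mulXYZ a (orbitSum t) s ≡ tri k c + glue k c
entry {e} {s} {t} {p , q} {x , y} s-box (d@(i , j , k) , o , rep ri rj rk) k∈ it c∈ = begin
  mulXYZ a f s                             ≡⟨ mulXYZ-orbit a (orbitSum-ρ t) o s-box ⟩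
  mulXYZ a f d                             ≡⟨ mulXYZ-box a f (InBox-orbit a o s-box) ⟩
  atPred i (λ i′ → f (i′ , j , k)) + atPred j (λ j′ → f (i , j′ , k)) + atPred k (λ k′ → f (i , j , k′))
    ≡⟨ cong₂ _+_ (cong₂ _+_ (X i ri) (Y j rj)) (Z q k rj rk) ⟩
  δ₂ (suc p , q) (x , y) + δ₂ (p , q) (x , y) + (δ₂ (p , q) (x , suc y) + glue (p , q) (x , y))
    ≡⟨ shuffle (δ₂ (suc p , q) (x , y)) (δ₂ (p , q) (x , y)) _ _ ⟩
  tri (p , q) (x , y) + glue (p , q) (x , y) ∎
  where
  open ≡-Reasoning
  a = suc e
  f = orbitSum t
  shuffle : ∀ m n o r → m + n + (o + r) ≡ n + m + o + r
  shuffle = solve-∀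
  X : ∀ i → i ℕ.+ suc p ≡ a → atPred i (λ i′ → f (i′ , j , k)) ≡ δ₂ (suc p , q) (x , y)
  -- Here `suc p = a`, and the cell `(a , q)` lies outside the grid.
  X zero    ri = sym (δ₂-≢ (suc p , q) (x , y) λ { refl → ℕ.<-irrefl ri (proj₁ (∈-grid⁻ a a c∈)) })
  X (suc i) ri = orbitSum-cell it (_ , inj₁ refl , rep (≡.trans (ℕ.+-suc i (suc p)) ri) (≡.trans rj (sym (ℕ.+-suc e p))) rk)
  Y : ∀ j → j ℕ.+ q ≡ a ℕ.+ p → atPred j (λ j′ → f (i , j′ , k)) ≡ δ₂ (p , q) (x , y)
  Y zero    rj = contradiction (ℕ.≤-trans (ℕ.m≤m+n a p) (ℕ.≤-reflexive (sym rj))) (ℕ.<⇒≱ (proj₂ (∈-grid⁻ a a k∈)))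
  Y (suc j) rj = orbitSum-cell it (_ , inj₁ refl , rep ri (ℕ.suc-injective rj) rk)
  Z : ∀ q k → j ℕ.+ q ≡ a ℕ.+ p → k ≡ a ℕ.+ q →
    atPred k (λ k′ → f (i , j , k′)) ≡ δ₂ (p , q) (x , suc y) + glue (p , q) (x , y)
  -- The lowered monomial is (a - 1 - p, a + p, a - 1); its rotation (a - 1, a - 1 - p, a + p)
  -- represents the cell `(0 , p)`.
  Z zero    _ rj refl = begin
    f (i , j , e ℕ.+ 0)                ≡⟨ orbitSum-cell it (_ , inj₂ (inj₁ refl) , rep ri₀ ri₁ (≡.trans (sym (ℕ.+-identityʳ j)) rj)) ⟩
    δ₂ (0 , p) (x , y)                 ≡⟨ ℤ.+-identityˡ _ ⟨
    0ℤ + δ₂ (0 , p) (x , y)            ≡⟨ cong (_+ δ₂ (0 , p) (x , y)) (ℤ.*-zeroʳ (δ p x)) ⟨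
    δ p x · 0ℤ + δ₂ (0 , p) (x , y)    ∎
    where
    ri₀ : e ℕ.+ 0 ℕ.+ 1 ≡ suc e
    ri₀ = ≡.trans (cong (ℕ._+ 1) (ℕ.+-identityʳ e)) (ℕ.+-comm e 1)
    ri₁ : i ℕ.+ p ≡ e ℕ.+ 0
    ri₁ = ≡.trans (ℕ.suc-injective (≡.trans (sym (ℕ.+-suc i p)) ri)) (sym (ℕ.+-identityʳ e))
  Z (suc q) _ rj refl = ≡.trans
    (orbitSum-cell it (_ , inj₁ refl , rep ri (ℕ.suc-injective (≡.trans (sym (ℕ.+-suc j q)) rj)) (ℕ.+-suc e q)))
    (sym (ℤ.+-identityʳ (δ₂ (p , q) (x , y))))

-- Equality of the lengths keeps every index inside `L`, so the default value of `coordAt` does not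
-- occur.
tabulate-coordAt : ∀ (f : Mon → Elem) L {n} → n ≡ length L → ∀ C →
  D (tabulate {n = n} (λ p t → coordAt L (toℕ p) (f t))) C ≡ D (map (λ s t → f t s) L) C
tabulate-coordAt f L eq C = D-cong C (rows L eq _ (λ _ _ → refl))
  where
  coordAt-suc : ∀ s L n g → coordAt (s ∷ L) (suc n) g ≡ coordAt L n g
  coordAt-suc s L n g with nth L n
  ... | just _  = refl
  ... | nothing = refl
  rows : ∀ L {n} → n ≡ length L → (g : Fin n → Mon → ℤ) → (∀ p t → g p t ≡ coordAt L (toℕ p) (f t)) →
    Pointwise (λ v w → ∀ {c} → c ∈ C → v c ≡ w c) (tabulate g) (map (λ s t → f t s) L)
  rows []      refl g eq = []
  rows (s ∷ L) refl g eq = (λ {t} _ → eq zero t) ∷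
    rows L refl (g ∘ suc) (λ p t → ≡.trans (eq (suc p) t) (coordAt-suc s L (toℕ p) (f t)))

invBasis-length : ∀ a e r → e ℕ.≤ a → a ℕ.≤ suc e → suc r ≡ a ℕ.+ e ℕ.+ a → length (invBasis a r) ≡ length (grid a a)
invBasis-length a e r e≤a a≤1+e deg≡ = matching-length (basis-matching a e r e≤a a≤1+e deg≡)

∣det∣-Umat : ∀ e r → let a = suc e in suc r ≡ a ℕ.+ e ℕ.+ a →
  ∣ det (length (invBasis a r)) (Umat a r) ∣ ≡ length (cyclicChains a)
∣det∣-Umat e r deg≡ = assemble (suc e) refl
  where
  open ≡-Reasoning
  assemble : ∀ a → a ≡ suc e → ∣ det (length (invBasis a r)) (Umat a r) ∣ ≡ length (cyclicChains a)
  assemble a refl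
    with C , C↭ , basis~C ← basis-matching a e r (ℕ.n≤1+n e) ℕ.≤-refl deg≡
       | K , K↭ , basis~K ← basis-matching a a (suc r) ℕ.≤-refl (ℕ.n≤1+n a) (≡.trans (cong suc deg≡) (cong (ℕ._+ a) (sym (ℕ.+-suc a e)))) = begin
    ∣ det (length (invBasis a r)) (Umat a r) ∣
      ≡⟨ cong ∣_∣ (det-D _ (λ p t → coordAt (invBasis a (suc r)) (toℕ p) (mulXYZ a (orbitSum t))) (lookup (invBasis a r))) ⟩
    ∣ D (tabulate {n = length (invBasis a r)} _) (tabulate (lookup (invBasis a r))) ∣
      ≡⟨ cong ∣_∣ (tabulate-coordAt (λ t → mulXYZ a (orbitSum t)) (invBasis a (suc r))
           (≡.trans (≡.trans (Pointwise.Pointwise-length basis~C) (↭.↭-length C↭)) (sym (≡.trans (Pointwise.Pointwise-length basis~K) (↭.↭-length K↭))))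
           (tabulate (lookup (invBasis a r)))) ⟩
    ∣ D (map (λ s t → mulXYZ a (orbitSum t) s) (invBasis a (suc r))) (tabulate (lookup (invBasis a r))) ∣
      ≡⟨ cong (λ L → ∣ D (map (λ s t → mulXYZ a (orbitSum t) s) (invBasis a (suc r))) L ∣) (List.tabulate-lookup (invBasis a r)) ⟩
    ∣ D (map (λ s t → mulXYZ a (orbitSum t) s) (invBasis a (suc r))) (invBasis a r) ∣
      ≡⟨ cong ∣_∣ (D-cong-Pointwise (λ { (s-box , is , k∈) (_ , it , c∈) → entry s-box is k∈ it c∈ }) basis~K basis~C) ⟩
    ∣ D (map N K) C ∣
      ≡⟨ ∣D∣-↭-rows (↭.map⁺ N K↭) C ⟩
    ∣ D (map N (grid a a)) C ∣
      ≡⟨ ∣D∣-↭-columns (map N (grid a a)) C↭ ⟩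
    ∣ D (map N (grid a a)) (grid a a) ∣
      ≡⟨ ∣D∣-rhombus a (ℕ.s≤s ℕ.z≤n) ⟩
    length (cyclicChains a) ∎
    where
    N : ℕ × ℕ → ℕ × ℕ → ℤ
    N k c = tri k c + glue k c

-- Chains of interlacing subsets and their heights

⟦_⟧ : Bool → ℕ
⟦ false ⟧ = 0
⟦ true ⟧  = 1

trues : List Bool → ℕ → ℕ
trues []      t       = 0
trues (b ∷ E) zero    = ⟦ b ⟧ ℕ.+ trues E zero
trues (b ∷ E) (suc t) = trues E t

height : List (List Bool) → ℕ → ℕ → ℕ
height []      c       t = 0
height (E ∷ y) zero    t = trues E t
height (E ∷ y) (suc c) t = height y c t

trues-mono : ∀ E t → trues E (suc t) ℕ.≤ trues E t
trues-mono []      t       = ℕ.z≤n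
trues-mono (b ∷ E) zero    = ℕ.m≤n+m (trues E 0) ⟦ b ⟧
trues-mono (b ∷ E) (suc t) = trues-mono E t

trues-outside : ∀ E {t} → length E ℕ.≤ t → trues E t ≡ 0
trues-outside []      _                 = refl
trues-outside (b ∷ E) {suc t} (ℕ.s≤s E≤t) = trues-outside E E≤t

⟦⟧-injective : ∀ {b c} → ⟦ b ⟧ ≡ ⟦ c ⟧ → b ≡ c
⟦⟧-injective {false} {false} _ = refl
⟦⟧-injective {true}  {true}  _ = refl

trues-injective : ∀ E F → length E ≡ length F → (∀ t → trues E t ≡ trues F t) → E ≡ F
trues-injective []      []      _   _  = refl
trues-injective (b ∷ E) (c ∷ F) len eq = cong₂ _∷_
  (⟦⟧-injective (ℕ.+-cancelʳ-≡ (trues E 0) ⟦ b ⟧ ⟦ c ⟧ (≡.trans (eq 0) (cong (⟦ c ⟧ ℕ.+_) (sym (eq 1))))))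
  (trues-injective E F (ℕ.suc-injective len) (eq ∘ suc))

-- The graph of `succs`. The digits in a constructor's name are the heads of the two sets; an
-- initial p marks a premise with a pending carry, an initial s one without.
data Step : Bool → List Bool → List Bool → Set where
  nil : Step false [] []
  s00 : ∀ {E F} → Step false E F → Step false (false ∷ E) (false ∷ F)
  s11 : ∀ {E F} → Step false E F → Step false (true ∷ E) (true ∷ F)
  s10 : ∀ {E F} → Step false E F → Step true (true ∷ E) (false ∷ F)
  p00 : ∀ {E F} → Step true E F → Step true (false ∷ E) (false ∷ F)
  p01 : ∀ {E F} → Step true E F → Step false (false ∷ E) (true ∷ F)

Step⇒∈ : ∀ {d E F} → Step d E F → F ∈ succs d E
Step⇒∈ nil                 = here refl
Step⇒∈ (s00 s)             = ∈-++⁺ˡ (∈-map⁺ (false ∷_) (Step⇒∈ s))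
Step⇒∈ (s11 s)             = ∈-map⁺ (true ∷_) (Step⇒∈ s)
Step⇒∈ (s10 s)             = ∈-map⁺ (false ∷_) (Step⇒∈ s)
Step⇒∈ (p00 s)             = ∈-map⁺ (false ∷_) (Step⇒∈ s)
Step⇒∈ {E = false ∷ E} (p01 s) = ∈-++⁺ʳ (map (false ∷_) (succs false E)) (∈-map⁺ (true ∷_) (Step⇒∈ s))

∈⇒Step : ∀ d E {F} → F ∈ succs d E → Step d E F
∈⇒Step false []          (here refl) = nil
∈⇒Step false (false ∷ E) F∈ with ∈-++⁻ (map (false ∷_) (succs false E)) F∈
... | inj₁ F∈₀ with _ , F∈₁ , refl ← ∈-map⁻ (false ∷_) F∈₀ = s00 (∈⇒Step false E F∈₁)
... | inj₂ F∈₀ with _ , F∈₁ , refl ← ∈-map⁻ (true ∷_) F∈₀  = p01 (∈⇒Step true E F∈₁)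
∈⇒Step true  (false ∷ E) F∈ with _ , F∈₁ , refl ← ∈-map⁻ (false ∷_) F∈ = p00 (∈⇒Step true E F∈₁)
∈⇒Step false (true ∷ E)  F∈ with _ , F∈₁ , refl ← ∈-map⁻ (true ∷_) F∈  = s11 (∈⇒Step false E F∈₁)
∈⇒Step true  (true ∷ E)  F∈ with _ , F∈₁ , refl ← ∈-map⁻ (false ∷_) F∈ = s10 (∈⇒Step false E F∈₁)

-- For the numbers of elements from t on: an element of the second set is at most its partner in the
-- first, which gives one bound, and exceeds the partner's predecessor, which gives the other.
Interlaced : (ℕ → ℕ) → (ℕ → ℕ) → Set
Interlaced f g = (∀ t → g t ℕ.≤ f t) × (∀ t → f t ℕ.≤ suc (g (suc t)))

Step-length : ∀ {d E F} → Step d E F → length F ≡ length E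
Step-length nil     = refl
Step-length (s00 s) = cong suc (Step-length s)
Step-length (s11 s) = cong suc (Step-length s)
Step-length (s10 s) = cong suc (Step-length s)
Step-length (p00 s) = cong suc (Step-length s)
Step-length (p01 s) = cong suc (Step-length s)

Step-total : ∀ {d E F} → Step d E F → trues E 0 ≡ ⟦ d ⟧ ℕ.+ trues F 0
Step-total nil     = refl
Step-total (s00 s) = Step-total s
Step-total (s11 s) = cong suc (Step-total s)
Step-total (s10 s) = cong suc (Step-total s)
Step-total (p00 s) = Step-total s
Step-total (p01 s) = Step-total s

Step⇒Interlaced : ∀ {d E F} → Step d E F → Interlaced (trues E) (trues F)
Step⇒Interlaced s = below s , above s
  where
  start : ∀ {d E F} → Step d E F → trues F 0 ℕ.≤ trues E 0
  start {d} {F = F} s = ℕ.≤-trans (ℕ.m≤n+m (trues F 0) ⟦ d ⟧) (ℕ.≤-reflexive (sym (Step-total s)))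
  below : ∀ {d E F} → Step d E F → ∀ t → trues F t ℕ.≤ trues E t
  below s       zero    = start s
  below nil     (suc t) = ℕ.z≤n
  below (s00 s) (suc t) = below s t
  below (s11 s) (suc t) = below s t
  below (s10 s) (suc t) = below s t
  below (p00 s) (suc t) = below s t
  below (p01 s) (suc t) = below s t
  above : ∀ {d E F} → Step d E F → ∀ t → trues E t ℕ.≤ suc (trues F (suc t))
  above nil     t       = ℕ.z≤n
  above (s00 s) (suc t) = above s t
  above (s11 s) (suc t) = above s t
  above (s10 s) (suc t) = above s t
  above (p00 s) (suc t) = above s t
  above (p01 s) (suc t) = above s t
  above (s00 s) zero    = ℕ.≤-trans (ℕ.≤-reflexive (Step-total s)) (ℕ.n≤1+n _)
  above (s11 s) zero    = ℕ.s≤s (ℕ.≤-reflexive (Step-total s))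
  above (s10 s) zero    = ℕ.s≤s (ℕ.≤-reflexive (Step-total s))
  above (p00 s) zero    = ℕ.≤-reflexive (Step-total s)
  above (p01 s) zero    = ℕ.≤-reflexive (Step-total s)

-- The carry `d₀` coming from the tails is the difference of their sizes, which the bounds confine
-- to 0 or 1.
Interlaced⇒Step : ∀ d E F → length F ≡ length E → trues E 0 ≡ ⟦ d ⟧ ℕ.+ trues F 0 → Interlaced (trues E) (trues F) → Step d E F
Interlaced⇒Step false []      []      _   _     _ = nil
Interlaced⇒Step d     (b ∷ E) (c ∷ F) len total (below , above) = go (carry (below 1) (ℕ.≤-trans (above 1) (ℕ.s≤s (trues-mono F 0))))
  where
  carry : ∀ {m n} → n ℕ.≤ m → m ℕ.≤ suc n → ∃ λ d₀ → m ≡ ⟦ d₀ ⟧ ℕ.+ n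
  carry n≤m m≤1+n with ℕ.m≤n⇒m<n∨m≡n n≤m
  ... | inj₁ n<m  = true , ℕ.≤-antisym m≤1+n n<m
  ... | inj₂ refl = false , refl
  combine : ∀ b c d d₀ → ⟦ b ⟧ ℕ.+ ⟦ d₀ ⟧ ≡ ⟦ d ⟧ ℕ.+ ⟦ c ⟧ → ⟦ b ⟧ ℕ.+ ⟦ d₀ ⟧ ℕ.≤ 1 → Step d₀ E F → Step d (b ∷ E) (c ∷ F)
  combine false false false false _ _ = s00
  combine false true  false true  _ _ = p01
  combine false false true  true  _ _ = p00
  combine true  true  false false _ _ = s11
  combine true  false true  false _ _ = s10
  combine false true  false false ()
  combine false true  true  false ()
  combine true  _     _     true  _ (ℕ.s≤s ())
  go : (∃ λ d₀ → trues E 0 ≡ ⟦ d₀ ⟧ ℕ.+ trues F 0) → Step d (b ∷ E) (c ∷ F)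
  go (d₀ , total₀) = combine b c d d₀
    (ℕ.+-cancelʳ-≡ (trues F 0) _ _ (begin
      ⟦ b ⟧ ℕ.+ ⟦ d₀ ⟧ ℕ.+ trues F 0     ≡⟨ ℕ.+-assoc ⟦ b ⟧ ⟦ d₀ ⟧ _ ⟩
      ⟦ b ⟧ ℕ.+ (⟦ d₀ ⟧ ℕ.+ trues F 0)   ≡⟨ cong (⟦ b ⟧ ℕ.+_) total₀ ⟨
      ⟦ b ⟧ ℕ.+ trues E 0                ≡⟨ total ⟩
      ⟦ d ⟧ ℕ.+ (⟦ c ⟧ ℕ.+ trues F 0)    ≡⟨ ℕ.+-assoc ⟦ d ⟧ ⟦ c ⟧ _ ⟨
      ⟦ d ⟧ ℕ.+ ⟦ c ⟧ ℕ.+ trues F 0      ∎))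
    -- The bound at 0 excludes an element of the first set that meets a pending carry.
    (ℕ.+-cancelʳ-≤ (trues F 0) _ 1 (ℕ.≤-trans
      (ℕ.≤-reflexive (≡.trans (ℕ.+-assoc ⟦ b ⟧ ⟦ d₀ ⟧ _) (cong (⟦ b ⟧ ℕ.+_) (sym total₀)))) (above 0)))
    (Interlaced⇒Step d₀ E F (ℕ.suc-injective len) total₀ (below ∘ suc , above ∘ suc))
    where open ≡-Reasoning

data Chain : List Bool → List Bool → List (List Bool) → Set where
  done : ∀ {E} → trues E 0 ≡ 0 → Chain [] E []
  _∷_  : ∀ {d ds E F y} → Step d E F → Chain ds F y → Chain (d ∷ ds) E (F ∷ y)

blank⁺ : ∀ E → trues E 0 ≡ 0 → [] ∈ blank E
blank⁺ []          _  = here refl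
blank⁺ (false ∷ E) eq = blank⁺ E eq

blank⁻ : ∀ E {y} → y ∈ blank E → y ≡ [] × trues E 0 ≡ 0
blank⁻ []          (here refl) = refl , refl
blank⁻ (false ∷ E) y∈          = blank⁻ E y∈

Chain⇒∈ : ∀ {ds E y} → Chain ds E y → y ∈ chains ds E
Chain⇒∈ {E = E} (done eq) = blank⁺ E eq
Chain⇒∈ {ds = d ∷ ds} {E} {F ∷ y} (s ∷ ch) =
  ∈-concatMap⁺ (λ F → map (F ∷_) (chains ds F)) (lose (Step⇒∈ s) (∈-map⁺ (F ∷_) (Chain⇒∈ ch)))

∈⇒Chain : ∀ ds {E y} → y ∈ chains ds E → Chain ds E y
∈⇒Chain [] {E} y∈ with refl , eq ← blank⁻ E y∈ = done eq
∈⇒Chain (d ∷ ds) {E} y∈ with F , F∈ , y∈map ← find (∈-concatMap⁻ (λ F → map (F ∷_) (chains ds F)) {xs = succs d E} y∈)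
  with y′ , y′∈ , refl ← ∈-map⁻ (F ∷_) y∈map = ∈⇒Step d E F∈ ∷ ∈⇒Chain ds y′∈

bools⁺ : ∀ E → E ∈ bools (length E)
bools⁺ []          = here refl
bools⁺ (false ∷ E) = ∈-++⁺ˡ (∈-map⁺ (false ∷_) (bools⁺ E))
bools⁺ (true ∷ E)  = ∈-++⁺ʳ (map (false ∷_) (bools (length E))) (∈-map⁺ (true ∷_) (bools⁺ E))

bools⁻ : ∀ n {E} → E ∈ bools n → length E ≡ n
bools⁻ zero    (here refl) = refl
bools⁻ (suc n) E∈ with ∈-++⁻ (map (false ∷_) (bools n)) E∈
... | inj₁ E∈₀ with _ , E∈₁ , refl ← ∈-map⁻ (false ∷_) E∈₀ = cong suc (bools⁻ n E∈₁)
... | inj₂ E∈₀ with _ , E∈₁ , refl ← ∈-map⁻ (true ∷_) E∈₀  = cong suc (bools⁻ n E∈₁)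

bools-unique : ∀ n → Unique (bools n)
bools-unique zero    = [] ∷ []
bools-unique (suc n) = Unique.++⁺ (Unique.map⁺ List.∷-injectiveʳ (bools-unique n)) (Unique.map⁺ List.∷-injectiveʳ (bools-unique n)) disjoint
  where
  disjoint : ∀ {E} → ¬ (E ∈ map (false ∷_) (bools n) × E ∈ map (true ∷_) (bools n))
  disjoint (E∈₀ , E∈₁) with _ , _ , refl ← ∈-map⁻ (false ∷_) E∈₀ with _ , _ , () ← ∈-map⁻ (true ∷_) E∈₁

succs-unique : ∀ d E → Unique (succs d E)
succs-unique false []          = [] ∷ []
succs-unique true  []          = []
succs-unique false (false ∷ E) = Unique.++⁺ (Unique.map⁺ List.∷-injectiveʳ (succs-unique false E)) (Unique.map⁺ List.∷-injectiveʳ (succs-unique true E)) disjoint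
  where
  disjoint : ∀ {F} → ¬ (F ∈ map (false ∷_) (succs false E) × F ∈ map (true ∷_) (succs true E))
  disjoint (F∈₀ , F∈₁) with _ , _ , refl ← ∈-map⁻ (false ∷_) F∈₀ with _ , _ , () ← ∈-map⁻ (true ∷_) F∈₁
succs-unique true  (false ∷ E) = Unique.map⁺ List.∷-injectiveʳ (succs-unique true E)
succs-unique false (true ∷ E)  = Unique.map⁺ List.∷-injectiveʳ (succs-unique false E)
succs-unique true  (true ∷ E)  = Unique.map⁺ List.∷-injectiveʳ (succs-unique false E)

firstRow : List (List Bool) → List Bool
firstRow []      = []
firstRow (E ∷ y) = E

firstRow-map : ∀ E ys {y} → y ∈ map (E ∷_) ys → firstRow y ≡ E
firstRow-map E ys y∈ with _ , _ , refl ← ∈-map⁻ (E ∷_) y∈ = refl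

chains-unique : ∀ ds E → Unique (chains ds E)
chains-unique []       E = blank-unique E
  where
  blank-unique : ∀ E → Unique (blank E)
  blank-unique []          = [] ∷ []
  blank-unique (false ∷ E) = blank-unique E
  blank-unique (true ∷ E)  = []
chains-unique (d ∷ ds) E = concatMap-unique _ firstRow (λ F → firstRow-map F (chains ds F))
  (λ F → Unique.map⁺ List.∷-injectiveʳ (chains-unique ds F)) (succs-unique d E)

cyclicChains-unique : ∀ a → Unique (cyclicChains a)
cyclicChains-unique a = concatMap-unique _ firstRow (λ E → firstRow-map E (chains E E))
  (λ E → Unique.map⁺ List.∷-injectiveʳ (chains-unique E E)) (bools-unique a)

Shape : ℕ → ℕ → List (List Bool) → Set
Shape m n y = length y ≡ m × All (λ E → length E ≡ n) y

Chain-shape : ∀ {ds E y n} → Chain ds E y → length E ≡ n → Shape (suc (length ds)) n (E ∷ y)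
Chain-shape (done _) len = refl , len ∷ []
Chain-shape (s ∷ ch) len with l , ls ← Chain-shape ch (≡.trans (Step-length s) len) = cong suc l , len ∷ ls

Chain-interlaced : ∀ {ds E y} → Chain ds E y → ∀ c → Interlaced (height (E ∷ y) c) (height (E ∷ y) (suc c))
Chain-interlaced {E = E} (done eq) zero = (λ t → ℕ.z≤n) , λ t → ℕ.≤-trans (vanishing t) ℕ.z≤n
  where
  vanishing : ∀ t → trues E t ℕ.≤ 0
  vanishing zero    = ℕ.≤-reflexive eq
  vanishing (suc t) = ℕ.≤-trans (trues-mono E t) (vanishing t)
Chain-interlaced (done eq) (suc c) = (λ t → ℕ.z≤n) , λ t → ℕ.z≤n
Chain-interlaced (s ∷ ch)  zero    = Step⇒Interlaced s
Chain-interlaced (s ∷ ch)  (suc c) = Chain-interlaced ch c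

-- Each exit is the loss of one element and the last set is empty, so the size of the c-th set is
-- the number of exits still to come. For `ds = E` this becomes the cyclic symmetry of the heights.
Chain-column : ∀ {ds E y} → Chain ds E y → ∀ c → height (E ∷ y) c 0 ≡ trues ds c
Chain-column (done eq)          zero    = eq
Chain-column (done eq)          (suc c) = refl
Chain-column (_∷_ {d = d} s ch) zero    = ≡.trans (Step-total s) (cong (⟦ d ⟧ ℕ.+_) (Chain-column ch zero))
Chain-column (s ∷ ch)           (suc c) = Chain-column ch c

toChain : ∀ ds E y {n} → Shape (suc (length ds)) n (E ∷ y) → (∀ c → Interlaced (height (E ∷ y) c) (height (E ∷ y) (suc c))) →
  (∀ c → height (E ∷ y) c 0 ≡ trues ds c) → Chain ds E y
toChain []       E []      shape inter col = done (col 0)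
toChain (d ∷ ds) E (F ∷ y) (l , lE ∷ lF ∷ ls) inter col =
  Interlaced⇒Step d E F (≡.trans lF (sym lE)) (≡.trans (col 0) (cong (⟦ d ⟧ ℕ.+_) (sym (col 1)))) (inter 0) ∷
  toChain ds F y (ℕ.suc-injective l , lF ∷ ls) (inter ∘ suc) (col ∘ suc)

-- The meeting point of the two counts: these are the height functions of the cyclic chains and also
-- those of the cyclically symmetric plane partitions in the box.
record Heights (a : ℕ) (h : ℕ → ℕ → ℕ) : Set where
  field
    rows      : ∀ c → Interlaced (h c) (h (suc c))
    decrease  : ∀ c t → h c (suc t) ℕ.≤ h c t
    symmetric : ∀ c → h c 0 ≡ h 0 c
    bottom    : ∀ {c t} → a ℕ.≤ c → h c t ≡ 0
    right     : ∀ {c t} → a ℕ.≤ t → h c t ≡ 0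

height-outside : ∀ {m n y} → Shape m n y → ∀ {c t} → m ℕ.≤ c → height y c t ≡ 0
height-outside {y = []}    _                 _           = refl
height-outside {y = E ∷ y} (refl , _ ∷ ls) (ℕ.s≤s m≤c) = height-outside {y = y} (refl , ls) m≤c

height-right : ∀ {m n y} → Shape m n y → ∀ {c t} → n ℕ.≤ t → height y c t ≡ 0
height-right {y = []}    _                            _   = refl
height-right {y = E ∷ y} (_ , refl ∷ _)   {c = zero}  n≤t = trues-outside E n≤t
height-right {y = E ∷ y} (refl , _ ∷ ls)  {c = suc c} n≤t = height-right {y = y} (refl , ls) n≤t

cyclicChains⁻ : ∀ a {y} → y ∈ cyclicChains a → Shape (suc a) a y × Heights a (height y)
cyclicChains⁻ a y∈ with E , E∈ , y∈map ← find (∈-concatMap⁻ (λ E → map (E ∷_) (chains E E)) {xs = bools a} y∈)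
  with y′ , y′∈ , refl ← ∈-map⁻ (E ∷_) y∈map
  with refl ← bools⁻ a E∈ = shape , record
    { rows      = Chain-interlaced ch
    ; decrease  = mono (E ∷ y′)
    ; symmetric = Chain-column ch
    ; bottom    = bottom
    ; right     = λ {c} → height-right shape {c}
    }
  where
  ch = ∈⇒Chain E y′∈
  shape = Chain-shape ch refl
  mono : ∀ y c t → height y c (suc t) ℕ.≤ height y c t
  mono []      c       t = ℕ.z≤n
  mono (E ∷ y) zero    t = trues-mono E t
  mono (E ∷ y) (suc c) t = mono y c t
  last : ∀ {ds E y} → Chain ds E y → ∀ t → height (E ∷ y) (length ds) t ≡ 0
  last {E = E} (done eq) zero = eq
  last {E = E} ch@(done eq) (suc t) = ℕ.n≤0⇒n≡0 (ℕ.≤-trans (trues-mono E t) (ℕ.≤-reflexive (last ch t)))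
  last (s ∷ ch) t = last ch t
  bottom : ∀ {c t} → length E ℕ.≤ c → height (E ∷ y′) c t ≡ 0
  -- A chain has a + 1 sets; the one with index a is the last, hence empty.
  bottom {c} {t} a≤c with ℕ.m≤n⇒m<n∨m≡n a≤c
  ... | inj₁ a<c  = height-outside shape {c} a<c
  ... | inj₂ refl = last ch t

cyclicChains⁺ : ∀ a {y} → Shape (suc a) a y → Heights a (height y) → y ∈ cyclicChains a
cyclicChains⁺ a {E ∷ y} (l , refl ∷ ls) h = ∈-concatMap⁺ (λ E → map (E ∷_) (chains E E)) (lose (bools⁺ E)
  (∈-map⁺ (E ∷_) (Chain⇒∈ (toChain E E y (l , refl ∷ ls) rows symmetric))))
  where open Heights h

height-injective : ∀ {m n} y z → Shape m n y → Shape m n z → (∀ c t → height y c t ≡ height z c t) → y ≡ z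
height-injective []      []      _ _ _ = refl
height-injective []      (F ∷ z) (refl , _) (() , _) _
height-injective (E ∷ y) []      (refl , _) (() , _) _
height-injective (E ∷ y) (F ∷ z) (l , lE ∷ ls) (l′ , lF ∷ ls′) eq = cong₂ _∷_
  (trues-injective E F (≡.trans lE (sym lF)) (eq 0))
  (height-injective y z (refl , ls) (ℕ.suc-injective (≡.trans l′ (sym l)) , ls′) (eq ∘ suc))

-- The set consists of the t at which `f` drops; every drop is by one, and `f` ends at zero.
row-exists : ∀ n (f : ℕ → ℕ) → (∀ t → f (suc t) ℕ.≤ f t) → (∀ t → f t ℕ.≤ suc (f (suc t))) → (∀ {t} → n ℕ.≤ t → f t ≡ 0) →
  ∃ λ E → length E ≡ n × (∀ t → trues E t ≡ f t)
row-exists zero    f mono step zeros = [] , refl , λ t → sym (zeros ℕ.z≤n)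
row-exists (suc n) f mono step zeros with E , len , eq ← row-exists n (f ∘ suc) (mono ∘ suc) (step ∘ suc) (zeros ∘ ℕ.s≤s)
  with ℕ.m≤n⇒m<n∨m≡n (mono 0)
... | inj₁ f1<f0 = true ∷ E , cong suc len , λ { zero → ≡.trans (cong suc (eq 0)) (ℕ.≤-antisym f1<f0 (step 0)) ; (suc t) → eq t }
... | inj₂ f1≡f0 = false ∷ E , cong suc len , λ { zero → ≡.trans (eq 0) f1≡f0 ; (suc t) → eq t }

table-exists : ∀ m n (h : ℕ → ℕ → ℕ) → (∀ c t → h c (suc t) ℕ.≤ h c t) → (∀ c t → h c t ℕ.≤ suc (h c (suc t))) →
  (∀ {c t} → m ℕ.≤ c → h c t ≡ 0) → (∀ {c t} → n ℕ.≤ t → h c t ≡ 0) →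
  ∃ λ y → Shape m n y × (∀ c t → height y c t ≡ h c t)
table-exists zero    n h mono step bottom right = [] , (refl , []) , λ c t → sym (bottom ℕ.z≤n)
table-exists (suc m) n h mono step bottom right
  with E , len , eq ← row-exists n (h 0) (mono 0) (step 0) right
     | y , (l , ls) , eqs ← table-exists m n (h ∘ suc) (mono ∘ suc) (step ∘ suc) (bottom ∘ ℕ.s≤s) right
  = E ∷ y , (cong suc l , len ∷ ls) , λ { zero t → eq t ; (suc c) t → eqs c t }

Heights-cong : ∀ {a h h′} → (∀ c t → h c t ≡ h′ c t) → Heights a h → Heights a h′
Heights-cong eq H = record
  { rows      = λ c → (λ t → subst₂ ℕ._≤_ (eq (suc c) t) (eq c t) (proj₁ (rows c) t)) ,
                      (λ t → subst₂ ℕ._≤_ (eq c t) (cong suc (eq (suc c) (suc t))) (proj₂ (rows c) t))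
  ; decrease  = λ c t → subst₂ ℕ._≤_ (eq c (suc t)) (eq c t) (decrease c t)
  ; symmetric = λ c → ≡.trans (sym (eq c 0)) (≡.trans (symmetric c) (eq 0 c))
  ; bottom    = λ a≤c → ≡.trans (sym (eq _ _)) (bottom a≤c)
  ; right     = λ a≤t → ≡.trans (sym (eq _ _)) (right a≤t)
  }
  where open Heights H

-- Cyclically symmetric plane partitions

T-allFin⁻ : ∀ {n} {p : Fin n → Bool} → Bool.T (allFinᵇ p) → ∀ i → Bool.T (p i)
T-allFin⁻ {p = p} all i = go (allFin _) all (∈-allFin i)
  where
  go : ∀ xs → Bool.T (and (map p xs)) → ∀ {i} → i ∈ xs → Bool.T (p i)
  go (x ∷ xs) all (here refl) = proj₁ (to T-∧ all)
  go (x ∷ xs) all (there i∈)  = go xs (proj₂ (to (T-∧ {p x}) all)) i∈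

T-allFin⁺ : ∀ {n} {p : Fin n → Bool} → (∀ i → Bool.T (p i)) → Bool.T (allFinᵇ p)
T-allFin⁺ {p = p} all = go (allFin _)
  where
  go : ∀ xs → Bool.T (and (map p xs))
  go []       = _
  go (x ∷ xs) = from T-∧ (all x , go xs)

T-⇒⁻ : ∀ {b c} → Bool.T (b ⇒ᵇ c) → Bool.T b → Bool.T c
T-⇒⁻ {true} {true} _ _ = _

T-⇒⁺ : ∀ {b c} → (Bool.T b → Bool.T c) → Bool.T (b ⇒ᵇ c)
T-⇒⁺ {false} f = _
T-⇒⁺ {true}  f = f _

-- Natural coordinates allow points such as (x, x + c, x + t) to be written without a proof that
-- they lie in the box; outside it nothing is a member.
data Mem {a : ℕ} (S : Cube a) : ℕ → ℕ → ℕ → Set where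
  mem : ∀ {i j k} → Bool.T (S i j k) → Mem S (toℕ i) (toℕ j) (toℕ k)

Mem-< : ∀ {a} {S : Cube a} {x y z} → Mem S x y z → x ℕ.< a × y ℕ.< a × z ℕ.< a
Mem-< (mem {i} {j} {k} _) = toℕ<n i , toℕ<n j , toℕ<n k

Mem⁺ : ∀ {a} {S : Cube a} {x y z} (x<a : x ℕ.< a) (y<a : y ℕ.< a) (z<a : z ℕ.< a) →
  Bool.T (S (fromℕ< x<a) (fromℕ< y<a) (fromℕ< z<a)) → Mem S x y z
Mem⁺ {S = S} x<a y<a z<a s = subst₂ (λ x (y , z) → Mem S x y z) (toℕ-fromℕ< x<a) (cong₂ _,_ (toℕ-fromℕ< y<a) (toℕ-fromℕ< z<a)) (mem s)

Mem⁻ : ∀ {a} {S : Cube a} {i j k} → Mem S (toℕ i) (toℕ j) (toℕ k) → Bool.T (S i j k)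
Mem⁻ {S = S} m = go m refl refl refl
  where
  go : ∀ {x y z} → Mem S x y z → ∀ {i j k} → toℕ i ≡ x → toℕ j ≡ y → toℕ k ≡ z → Bool.T (S i j k)
  go (mem s) ei ej ek with refl ← toℕ-injective ei | refl ← toℕ-injective ej | refl ← toℕ-injective ek = s

Mem? : ∀ {a} (S : Cube a) x y z → Dec (Mem S x y z)
Mem? {a} S x y z with x ℕ.<? a | y ℕ.<? a | z ℕ.<? a
... | no x≮a  | _       | _       = no (x≮a ∘ proj₁ ∘ Mem-<)
... | yes _   | no y≮a  | _       = no (y≮a ∘ proj₁ ∘ proj₂ ∘ Mem-<)
... | yes _   | yes _   | no z≮a  = no (z≮a ∘ proj₂ ∘ proj₂ ∘ Mem-<)
... | yes x<a | yes y<a | yes z<a with Bool.T? (S (fromℕ< x<a) (fromℕ< y<a) (fromℕ< z<a))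
...   | yes s = yes (Mem⁺ x<a y<a z<a s)
...   | no ¬s = no (λ m → ¬s (Mem⁻ (subst₂ (λ x (y , z) → Mem S x y z) (sym (toℕ-fromℕ< x<a))
                 (cong₂ _,_ (sym (toℕ-fromℕ< y<a)) (sym (toℕ-fromℕ< z<a))) m)))

record CSPP (M : ℕ → ℕ → ℕ → Set) : Set where
  field
    ideal : ∀ {x y z x′ y′ z′} → M x y z → x′ ℕ.≤ x → y′ ℕ.≤ y → z′ ℕ.≤ z → M x′ y′ z′
    rot   : ∀ {x y z} → M x y z → M y z x

isCSPP : ∀ {a} → Cube a → Bool
isCSPP S = isOrderIdeal S ∧ isCyclic S

isCSPP⁻ : ∀ {a} (S : Cube a) → Bool.T (isCSPP S) → CSPP (Mem S)
isCSPP⁻ {a} S p with ord , cyc ← to (T-∧ {isOrderIdeal S}) p = record { ideal = ideal ; rot = rot }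
  where
  ideal : ∀ {x y z x′ y′ z′} → Mem S x y z → x′ ℕ.≤ x → y′ ℕ.≤ y → z′ ℕ.≤ z → Mem S x′ y′ z′
  ideal (mem {i} {j} {k} s) x≤ y≤ z≤ = Mem⁺ x<a y<a z<a (T-⇒⁻
    (T-allFin⁻ (T-allFin⁻ (T-allFin⁻ (T-allFin⁻ (T-allFin⁻ (T-allFin⁻ ord i) j) k) (fromℕ< x<a)) (fromℕ< y<a)) (fromℕ< z<a))
    (from (T-∧ {S i j k}) (s , from (T-∧ {fromℕ< x<a ≤ᶠ i}) (below x<a x≤ , from (T-∧ {fromℕ< y<a ≤ᶠ j}) (below y<a y≤ , below z<a z≤)))))
    where
    x<a = ℕ.≤-<-trans x≤ (toℕ<n i)
    y<a = ℕ.≤-<-trans y≤ (toℕ<n j)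
    z<a = ℕ.≤-<-trans z≤ (toℕ<n k)
    below : ∀ {x} {i : Fin a} (x<a : x ℕ.< a) → x ℕ.≤ toℕ i → Bool.T (fromℕ< x<a ≤ᶠ i)
    below {i = i} x<a x≤i = ℕ.≤⇒≤ᵇ (subst (ℕ._≤ toℕ i) (sym (toℕ-fromℕ< x<a)) x≤i)
  rot : ∀ {x y z} → Mem S x y z → Mem S y z x
  rot (mem {i} {j} {k} s) = mem (T-⇒⁻ (proj₁ (to (T-∧ {S i j k ⇒ᵇ S j k i}) (T-allFin⁻ (T-allFin⁻ (T-allFin⁻ cyc i) j) k))) s)

isCSPP⁺ : ∀ {a} (S : Cube a) → CSPP (Mem S) → Bool.T (isCSPP S)
isCSPP⁺ S M = from (T-∧ {isOrderIdeal S})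
  ( T-allFin⁺ (λ i → T-allFin⁺ λ j → T-allFin⁺ λ k → T-allFin⁺ λ i′ → T-allFin⁺ λ j′ → T-allFin⁺ λ k′ →
      T-⇒⁺ λ p → let s , le = to (T-∧ {S i j k}) p ; i≤ , le′ = to (T-∧ {i′ ≤ᶠ i}) le ; j≤ , k≤ = to (T-∧ {j′ ≤ᶠ j}) le′ in
        Mem⁻ (ideal (mem {S = S} {i} {j} {k} s) (ℕ.≤ᵇ⇒≤ (toℕ i′) (toℕ i) i≤) (ℕ.≤ᵇ⇒≤ (toℕ j′) (toℕ j) j≤) (ℕ.≤ᵇ⇒≤ (toℕ k′) (toℕ k) k≤)))
  , T-allFin⁺ (λ i → T-allFin⁺ λ j → T-allFin⁺ λ k → from (T-∧ {S i j k ⇒ᵇ S j k i})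
      ( T-⇒⁺ (λ s → Mem⁻ (rot (mem {S = S} {i} {j} {k} s)))
      , T-⇒⁺ (λ s → Mem⁻ (rot (rot (mem {S = S} {j} {k} {i} s)))))))
  where open CSPP M

-- By cyclic symmetry a cyclically symmetric plane partition is determined by its points whose first
-- coordinate is minimal; these lie on the diagonal lines (x , x + c , x + t).
HasHeight : (ℕ → ℕ → ℕ → Set) → (ℕ → ℕ → ℕ) → Set
HasHeight M h = ∀ c t x → (M x (x ℕ.+ c) (x ℕ.+ t) → x ℕ.< h c t) × (x ℕ.< h c t → M x (x ℕ.+ c) (x ℕ.+ t))

HasHeight-cong : ∀ {M h h′} → (∀ c t → h c t ≡ h′ c t) → HasHeight M h → HasHeight M h′
HasHeight-cong eq hh c t x =
  subst (x ℕ.<_) (eq c t) ∘ proj₁ (hh c t x) , proj₂ (hh c t x) ∘ subst (x ℕ.<_) (sym (eq c t))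

<-ext-≤ : ∀ {m n} → (∀ x → x ℕ.< m → x ℕ.< n) → m ℕ.≤ n
<-ext-≤ {zero}  f = ℕ.z≤n
<-ext-≤ {suc m} f = f m (ℕ.n<1+n m)

HasHeight-functional : ∀ {M h h′} → HasHeight M h → HasHeight M h′ → ∀ c t → h c t ≡ h′ c t
HasHeight-functional hh hh′ c t = ℕ.≤-antisym
  (<-ext-≤ (λ x → proj₁ (hh′ c t x) ∘ proj₂ (hh c t x))) (<-ext-≤ (λ x → proj₁ (hh c t x) ∘ proj₂ (hh′ c t x)))

HasHeight-⊆ : ∀ {M M′ h} → CSPP M → CSPP M′ → HasHeight M h → HasHeight M′ h → ∀ {x y z} → M x y z → M′ x y z
HasHeight-⊆ {M} {M′} C C′ hh hh′ {x} {y} {z} m = go (ℕ.≤-total x y) (ℕ.≤-total x z) (ℕ.≤-total y z)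
  where
  open CSPP
  minimal : ∀ {x y z} → x ℕ.≤ y → x ℕ.≤ z → M x y z → M′ x y z
  minimal {x} x≤y x≤z m with c , refl ← ℕ.m≤n⇒∃[o]m+o≡n x≤y | t , refl ← ℕ.m≤n⇒∃[o]m+o≡n x≤z =
    proj₂ (hh′ c t x) (proj₁ (hh c t x) m)
  go : x ℕ.≤ y ⊎ y ℕ.≤ x → x ℕ.≤ z ⊎ z ℕ.≤ x → y ℕ.≤ z ⊎ z ℕ.≤ y → M′ x y z
  go (inj₁ x≤y) (inj₁ x≤z) _          = minimal x≤y x≤z m
  go (inj₁ x≤y) (inj₂ z≤x) _          = rot C′ (minimal z≤x (ℕ.≤-trans z≤x x≤y) (rot C (rot C m)))
  go (inj₂ y≤x) _          (inj₁ y≤z) = rot C′ (rot C′ (minimal y≤z y≤x (rot C m)))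
  go (inj₂ y≤x) _          (inj₂ z≤y) = rot C′ (minimal (ℕ.≤-trans z≤y y≤x) z≤y (rot C (rot C m)))

height-exists : ∀ n {P : ℕ → Set} → (∀ x → Dec (P x)) → (∀ {x} → P (suc x) → P x) → (∀ {x} → n ℕ.≤ x → ¬ P x) →
  ∃ λ h → ∀ x → (P x → x ℕ.< h) × (x ℕ.< h → P x)
height-exists zero    P? down out = 0 , λ x → (λ px → contradiction px (out ℕ.z≤n)) , λ ()
height-exists (suc n) {P} P? down out with P? n
... | yes pn = suc n , λ x → (λ px → ℕ.≰⇒> λ n<x → out n<x px) , λ x<1+n → downTo (ℕ.≤⇒≤′ (ℕ.≤-pred x<1+n)) pn
  where
  downTo : ∀ {x m} → x ℕ.≤′ m → P m → P x
  downTo (ℕ.≤′-reflexive refl) p = p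
  downTo (ℕ.≤′-step x≤m)       p = downTo x≤m (down p)
... | no ¬pn = height-exists n P? down λ {x} n≤x px → contradiction px (excluded n≤x)
  where
  excluded : ∀ {x} → n ℕ.≤ x → ¬ P x
  excluded n≤x px with ℕ.m≤n⇒m<n∨m≡n n≤x
  ... | inj₁ n<x  = out n<x px
  ... | inj₂ refl = ¬pn px

Heights-of : ∀ {a} {M : ℕ → ℕ → ℕ → Set} → (∀ x y z → Dec (M x y z)) → (∀ {x y z} → M x y z → x ℕ.< a × y ℕ.< a × z ℕ.< a) →
  CSPP M → ∃ λ h → HasHeight M h × Heights a h
Heights-of {a} {M} M? bound C = h , hh , record
  { rows      = λ c → (λ t → <-ext-≤ λ x x< → proj₁ (hh c t x) (ideal (proj₂ (hh (suc c) t x) x<) ℕ.≤-refl (ℕ.+-monoʳ-≤ x (ℕ.n≤1+n c)) ℕ.≤-refl))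
                    , above c
  ; decrease  = λ c t → <-ext-≤ λ x x< → proj₁ (hh c t x) (ideal (proj₂ (hh c (suc t) x) x<) ℕ.≤-refl ℕ.≤-refl (ℕ.+-monoʳ-≤ x (ℕ.n≤1+n t)))
  -- The points (x, x + c, x) and (x, x, x + c) are rotations of each other.
  ; symmetric = λ c → ℕ.≤-antisym
      (<-ext-≤ λ x x< → proj₁ (hh 0 c x) (subst (λ w → M x w (x ℕ.+ c)) (sym (ℕ.+-identityʳ x))
        (rot (rot (subst (M x (x ℕ.+ c)) (ℕ.+-identityʳ x) (proj₂ (hh c 0 x) x<))))))
      (<-ext-≤ λ x x< → proj₁ (hh c 0 x) (subst (M x (x ℕ.+ c)) (sym (ℕ.+-identityʳ x))
        (rot (subst (λ w → M x w (x ℕ.+ c)) (ℕ.+-identityʳ x) (proj₂ (hh 0 c x) x<)))))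
  ; bottom    = λ {c} {t} a≤c → empty (λ x x< → ℕ.<⇒≱ (proj₁ (proj₂ (bound (proj₂ (hh c t x) x<)))) (ℕ.≤-trans a≤c (ℕ.m≤n+m c x)))
  ; right     = λ {c} {t} a≤t → empty (λ x x< → ℕ.<⇒≱ (proj₂ (proj₂ (bound (proj₂ (hh c t x) x<)))) (ℕ.≤-trans a≤t (ℕ.m≤n+m t x)))
  }
  where
  open CSPP C
  line-height : ∀ c t → ∃ λ n → ∀ x → (M x (x ℕ.+ c) (x ℕ.+ t) → x ℕ.< n) × (x ℕ.< n → M x (x ℕ.+ c) (x ℕ.+ t))
  line-height c t = height-exists a (λ x → M? x (x ℕ.+ c) (x ℕ.+ t))
    (λ m → ideal m (ℕ.n≤1+n _) (ℕ.n≤1+n _) (ℕ.n≤1+n _)) (λ a≤x m → ℕ.<⇒≱ (proj₁ (bound m)) a≤x)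
  h : ℕ → ℕ → ℕ
  h c t = proj₁ (line-height c t)
  hh : HasHeight M h
  hh c t = proj₂ (line-height c t)
  empty : ∀ {n} → (∀ x → ¬ x ℕ.< n) → n ≡ 0
  empty {zero}  f = refl
  empty {suc n} f = contradiction ℕ.z<s (f 0)
  above : ∀ c t → h c t ℕ.≤ suc (h (suc c) (suc t))
  -- Lowering only the first coordinate of (x + 1, x + 1 + c, x + 1 + t) leads to the line with
  -- offsets c + 1 and t + 1.
  above c t = <-ext-≤ λ { zero _ → ℕ.z<s ; (suc x) x< → ℕ.s≤s (proj₁ (hh (suc c) (suc t) x) (ideal (proj₂ (hh c t (suc x)) x<) (ℕ.n≤1+n x)
    (ℕ.≤-reflexive (ℕ.+-suc x c)) (ℕ.≤-reflexive (ℕ.+-suc x t)))) }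

-- The plane partition with given heights

module _ {a : ℕ} {h : ℕ → ℕ → ℕ} (H : Heights a h) where
  open Heights H

  Low : ℕ → ℕ → ℕ → Set
  Low x y z = ∃ λ c → ∃ λ t → y ≡ x ℕ.+ c × z ≡ x ℕ.+ t × x ℕ.< h c t

  In : ℕ → ℕ → ℕ → Set
  In x y z = Low x y z ⊎ Low y z x ⊎ Low z x y

  Low? : ∀ x y z → Dec (Low x y z)
  Low? x y z with x ℕ.≤? y | x ℕ.≤? z
  ... | no x≰y | _      = no λ { (c , t , refl , _) → x≰y (ℕ.m≤m+n x c) }
  ... | yes _  | no x≰z = no λ { (c , t , _ , refl , _) → x≰z (ℕ.m≤m+n x t) }
  ... | yes x≤y | yes x≤z with c , refl ← ℕ.m≤n⇒∃[o]m+o≡n x≤y | t , refl ← ℕ.m≤n⇒∃[o]m+o≡n x≤z with x ℕ.<? h c t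
  ...   | yes x< = yes (c , t , refl , refl , x<)
  ...   | no x≮  = no λ { (c′ , t′ , ec , et , x<) → x≮ (subst₂ (λ c t → x ℕ.< h c t) (sym (ℕ.+-cancelˡ-≡ x c c′ ec)) (sym (ℕ.+-cancelˡ-≡ x t t′ et)) x<) }

  In? : ∀ x y z → Dec (In x y z)
  In? x y z = Low? x y z ⊎-dec (Low? y z x ⊎-dec Low? z x y)

  In-rot : ∀ {x y z} → In x y z → In y z x
  In-rot (inj₁ l)        = inj₂ (inj₂ l)
  In-rot (inj₂ (inj₁ l)) = inj₁ l
  In-rot (inj₂ (inj₂ l)) = inj₂ (inj₁ l)

  diagonal : ∀ {x c t} → suc x ℕ.< h c t → x ℕ.< h (suc c) (suc t)
  diagonal {x} {c} {t} x< = ℕ.≤-pred (ℕ.≤-trans x< (proj₂ (rows c) t))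

  -- If the lowered coordinate was the base of its line, the point moves to the next diagonal. If it
  -- tied with another base, it becomes the new base, and `symmetric` is needed to change the line
  -- first. Otherwise only an offset decreases.
  In-pred : ∀ {x y z} → In (suc x) y z → In x y z
  In-pred {x} (inj₁ (c , t , refl , refl , x<)) = inj₁ (suc c , suc t , sym (ℕ.+-suc x c) , sym (ℕ.+-suc x t) , diagonal x<)
  In-pred {x} {y} (inj₂ (inj₁ (c , suc t , refl , ex , y<))) =
    inj₂ (inj₁ (c , t , refl , ℕ.suc-injective (≡.trans ex (ℕ.+-suc y t)) , ℕ.<-≤-trans y< (decrease c t)))
  In-pred {x} {y} (inj₂ (inj₁ (c , zero , refl , ex , y<))) with refl ← ≡.trans ex (ℕ.+-identityʳ y) =
    inj₁ (1 , suc c , sym (ℕ.+-comm x 1) , sym (ℕ.+-suc x c) , diagonal (subst (suc x ℕ.<_) (symmetric c) y<))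
  In-pred {x} {y} {z} (inj₂ (inj₂ (suc c , t , ex , refl , z<))) =
    inj₂ (inj₂ (c , t , ℕ.suc-injective (≡.trans ex (ℕ.+-suc z c)) , refl , ℕ.<-≤-trans z< (proj₁ (rows c) t)))
  In-pred {x} {y} {z} (inj₂ (inj₂ (zero , t , ex , refl , z<))) with refl ← ≡.trans ex (ℕ.+-identityʳ z) =
    inj₁ (suc t , 1 , sym (ℕ.+-suc x t) , sym (ℕ.+-comm x 1) , diagonal (subst (suc x ℕ.<_) (sym (symmetric t)) z<))

  In-≤ : ∀ {x y z x′} → x′ ℕ.≤ x → In x y z → In x′ y z
  In-≤ {y = y} {z} x′≤x = go (ℕ.≤⇒≤′ x′≤x)
    where
    go : ∀ {x′ x} → x′ ℕ.≤′ x → In x y z → In x′ y z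
    go (ℕ.≤′-reflexive refl) m = m
    go (ℕ.≤′-step le)        m = go le (In-pred m)

  In-CSPP : CSPP In
  In-CSPP = record
    { ideal = λ m x≤ y≤ z≤ → In-rot (In-≤ z≤ (In-rot (In-≤ y≤ (In-rot (In-≤ x≤ m)))))
    ; rot   = In-rot
    }

  Low-height : ∀ {x c t} → Low x (x ℕ.+ c) (x ℕ.+ t) → x ℕ.< h c t
  Low-height {x} {c} {t} (c′ , t′ , ec , et , x<) =
    subst₂ (λ c t → x ℕ.< h c t) (sym (ℕ.+-cancelˡ-≡ x c c′ ec)) (sym (ℕ.+-cancelˡ-≡ x t t′ et)) x<

  -- Membership through another rotation means that a different coordinate is minimal too. The point
  -- then has a tie, and `symmetric` identifies the two heights concerned.
  In⇒< : ∀ x c t → In x (x ℕ.+ c) (x ℕ.+ t) → x ℕ.< h c t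
  In⇒< x c t (inj₁ l) = Low-height l
  In⇒< x c t (inj₂ (inj₁ (c′ , t′ , ez , ex , y<)))
    with 0≡ ← ℕ.+-cancelˡ-≡ x 0 (c ℕ.+ t′) (≡.trans (ℕ.+-identityʳ x) (≡.trans ex (ℕ.+-assoc x c t′)))
    with refl ← ℕ.m+n≡0⇒m≡0 c (sym 0≡) | refl ← ℕ.m+n≡0⇒n≡0 c (sym 0≡)
    with refl ← ℕ.+-cancelˡ-≡ x t c′ (≡.trans ez (cong (ℕ._+ c′) (ℕ.+-identityʳ x))) =
    subst₂ ℕ._<_ (ℕ.+-identityʳ x) (symmetric t) y<
  In⇒< x c t (inj₂ (inj₂ (c′ , t′ , ex , ey , z<)))
    with 0≡ ← ℕ.+-cancelˡ-≡ x 0 (t ℕ.+ c′) (≡.trans (ℕ.+-identityʳ x) (≡.trans ex (ℕ.+-assoc x t c′)))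
    with refl ← ℕ.m+n≡0⇒m≡0 t (sym 0≡) | refl ← ℕ.m+n≡0⇒n≡0 t (sym 0≡)
    with refl ← ℕ.+-cancelˡ-≡ x c t′ (≡.trans ey (cong (ℕ._+ t′) (ℕ.+-identityʳ x))) =
    subst₂ ℕ._<_ (ℕ.+-identityʳ x) (sym (symmetric c)) z<

  -- Descending along diagonals to first coordinate 0 leaves the other two coordinates fixed and
  -- turns them into offsets, which `bottom` and `right` bound.
  In-bound : ∀ x {c t} → x ℕ.< h c t → x ℕ.+ c ℕ.< a × x ℕ.+ t ℕ.< a
  In-bound zero    {c} {t} 0< =
    ℕ.≰⇒> (λ a≤c → ℕ.<⇒≱ 0< (ℕ.≤-reflexive (bottom a≤c))) , ℕ.≰⇒> (λ a≤t → ℕ.<⇒≱ 0< (ℕ.≤-reflexive (right a≤t)))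
  In-bound (suc x) {c} {t} x< with c< , t< ← In-bound x (diagonal x<) =
    subst (ℕ._< a) (ℕ.+-suc x c) c< , subst (ℕ._< a) (ℕ.+-suc x t) t<

  -- `S` is specified only pointwise, because the enumeration of cubes contains the desired function
  -- only up to pointwise equality.
  In-cube : (S : Cube a) → (∀ i j k → ⌊ In? (toℕ i) (toℕ j) (toℕ k) ⌋ ≡ S i j k) → CSPP (Mem S) × HasHeight (Mem S) h
  In-cube S S≐ = record { ideal = λ m x≤ y≤ z≤ → let x< , y< , z< = Mem-< m in
      enter (ideal (leave m) x≤ y≤ z≤) (ℕ.≤-<-trans x≤ x<) (ℕ.≤-<-trans y≤ y<) (ℕ.≤-<-trans z≤ z<)
    ; rot = λ m → let x< , y< , z< = Mem-< m in enter (In-rot (leave m)) y< z< x< } ,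
    λ c t x → In⇒< x c t ∘ leave , λ x< → let c< , t< = In-bound x x< in
      enter (inj₁ (c , t , refl , refl , x<)) (ℕ.≤-<-trans (ℕ.m≤m+n x c) c<) c< t<
    where
    open CSPP In-CSPP
    leave : ∀ {x y z} → Mem S x y z → In x y z
    leave (mem {i} {j} {k} s) = toWitness {a? = In? (toℕ i) (toℕ j) (toℕ k)} (subst Bool.T (sym (S≐ i j k)) s)
    enter : ∀ {x y z} → In x y z → x ℕ.< a → y ℕ.< a → z ℕ.< a → Mem S x y z
    enter m x< y< z< = Mem⁺ x< y< z< (subst Bool.T (S≐ (fromℕ< x<) (fromℕ< y<) (fromℕ< z<))
      (fromWitness (subst₂ (λ x (y , z) → In x y z) (sym (toℕ-fromℕ< x<)) (cong₂ _,_ (sym (toℕ-fromℕ< y<)) (sym (toℕ-fromℕ< z<))) m)))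

-- The relation on values is arbitrary so that the lemma can be nested three times, cubes being
-- compared pointwise at every level.
funs-distinct : ∀ {_≈_ : A → A → Set} n {xs} → AllPairs (λ x y → ¬ x ≈ y) xs → AllPairs (λ f g → ¬ (∀ i → f i ≈ g i)) (funs xs n)
funs-distinct zero    p = [] ∷ []
funs-distinct (suc n) p = AllPairs.concat⁺
  (All.map⁺ (All.universal (λ x → AllPairs.map⁺ (AllPairs.map (λ f≉g eq → f≉g (eq ∘ suc)) (funs-distinct n p))) _))
  (AllPairs.map⁺ (AllPairs.map (λ x≉y → All.map⁺ (All.universal (λ f → All.map⁺ (All.universal (λ g eq → x≉y (eq zero)) _)) _)) p))

funs-complete : ∀ {_≈_ : A → A → Set} n {xs} → (∀ x → Any (x ≈_) xs) → ∀ (f : Fin n → A) → Any (λ g → ∀ i → f i ≈ g i) (funs xs n)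
funs-complete zero    p f = here λ ()
funs-complete (suc n) p f = Any.concatMap⁺ _ (Any.map
  (λ f0≈x → Any.map⁺ (Any.map (λ f≈g → λ { zero → f0≈x ; (suc i) → f≈g i }) (funs-complete n p (f ∘ suc)))) (p (f zero)))

T-ext : ∀ {b c} → (Bool.T b → Bool.T c) → (Bool.T c → Bool.T b) → b ≡ c
T-ext {false} {false} f g = refl
T-ext {false} {true}  f g = contradiction _ g
T-ext {true}  {false} f g = contradiction _ f
T-ext {true}  {true}  f g = refl

allCubes-distinct : ∀ a → AllPairs (λ S S′ → ¬ (∀ i j k → S i j k ≡ S′ i j k)) (allCubes a)
allCubes-distinct a = funs-distinct a (funs-distinct a (funs-distinct {_≈_ = _≡_} a (((λ ()) ∷ []) ∷ [] ∷ [])))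

allCubes-complete : ∀ a (S : Cube a) → Any (λ S′ → ∀ i j k → S i j k ≡ S′ i j k) (allCubes a)
allCubes-complete a = funs-complete a (funs-complete a (funs-complete {_≈_ = _≡_} a λ { false → there (here refl) ; true → here refl }))

-- Partners are a cube and a chain with the same heights. Heights determine a cube because it is a
-- cyclically symmetric ideal, and a chain because of its shape; both directions of existence pass
-- through `Heights`.
cspp-chains : ∀ a → cspp a ≡ length (cyclicChains a)
cspp-chains a = matching-length (matching (λ S y → HasHeight (Mem S) (height y)) X (cyclicChains a)
  (AllPairs-restrict (λ {S} {S′} C C′ S≢ y hS hS′ → S≢ λ i j k → T-ext
      (λ s → Mem⁻ (HasHeight-⊆ C C′ hS hS′ (mem {S = S} {i} {j} {k} s))) (λ s → Mem⁻ (HasHeight-⊆ C′ C hS′ hS (mem {S = S′} {i} {j} {k} s))))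
    (isCSPP⁻ _ ∘ proj₂ ∘ ∈-filter⁻ (Bool.T? ∘ isCSPP) {xs = allCubes a}) (AllPairs.filter⁺ (Bool.T? ∘ isCSPP) (allCubes-distinct a)))
  (AllPairs-restrict (λ {y} {z} sy sz y≢z S hy hz → y≢z (height-injective y z sy sz (HasHeight-functional {Mem S} hy hz)))
    (proj₁ ∘ cyclicChains⁻ a) (cyclicChains-unique a))
  chain cube)
  where
  X = filterᵇ isCSPP (allCubes a)
  chain : ∀ {S} → S ∈ X → ∃ λ y → y ∈ cyclicChains a × HasHeight (Mem S) (height y)
  chain {S} S∈ with h , hh , H ← Heights-of (Mem? S) Mem-< (isCSPP⁻ S (proj₂ (∈-filter⁻ (Bool.T? ∘ isCSPP) {xs = allCubes a} S∈)))
    with y , shape , eq ← table-exists (suc a) a h (Heights.decrease H)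
      -- Within a row, heights drop by at most one: h(c, t) ≤ 1 + h(c + 1, t + 1) ≤ 1 + h(c, t + 1).
      (λ c t → ℕ.≤-trans (proj₂ (Heights.rows H c) t) (ℕ.s≤s (proj₁ (Heights.rows H c) (suc t))))
      (Heights.bottom H ∘ ℕ.<⇒≤) (Heights.right H) =
    y , cyclicChains⁺ a shape (Heights-cong (λ c t → sym (eq c t)) H) , HasHeight-cong {Mem S} (λ c t → sym (eq c t)) hh
  cube : ∀ {y} → y ∈ cyclicChains a → ∃ λ S → S ∈ X × HasHeight (Mem S) (height y)
  cube {y} y∈ with _ , H ← cyclicChains⁻ a y∈
    with S , S∈ , S≐ ← find (allCubes-complete a (λ i j k → ⌊ In? H (toℕ i) (toℕ j) (toℕ k) ⌋))
    with C , hh ← In-cube H S S≐ = S , ∈-filter⁺ (Bool.T? ∘ isCSPP) S∈ (isCSPP⁺ S C) , hh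

theorem1p3 : (a : ℕ) → 1 ≤ a →
    (length (invBasis a (3 * a ∸ 2)) ≡ length (invBasis a (suc (3 * a ∸ 2))))
    × (∣ det (length (invBasis a (3 * a ∸ 2))) (Umat a (3 * a ∸ 2)) ∣ ≡ cspp a)
theorem1p3 (suc e) _ =
  ≡.trans (invBasis-length a e r (ℕ.n≤1+n e) ℕ.≤-refl deg≡)
          (sym (invBasis-length a a (suc r) ℕ.≤-refl (ℕ.n≤1+n a) (≡.trans (cong suc deg≡) (cong (ℕ._+ a) (sym (ℕ.+-suc a e)))))) ,
  ≡.trans (∣det∣-Umat e r deg≡) (sym (cspp-chains a))
  where
  a = suc e
  r = 3 * a ∸ 2
  ring : ∀ e → 1 ℕ.+ (1 ℕ.+ (1 ℕ.+ 3 ℕ.* e)) ≡ 1 ℕ.+ (e ℕ.+ (1 ℕ.+ (e ℕ.+ (1 ℕ.+ (e ℕ.+ 0)))))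
  ring = ℕ-solve-∀
  ring′ : ∀ e → 2 ℕ.+ 3 ℕ.* e ≡ (1 ℕ.+ e) ℕ.+ e ℕ.+ (1 ℕ.+ e)
  ring′ = ℕ-solve-∀
  deg≡ : suc r ≡ a ℕ.+ e ℕ.+ a
  -- Rewriting `3 * a` as a threefold successor lets the truncated subtraction of 2 compute.
  deg≡ = ≡.trans (cong (λ n → suc (n ∸ 2)) (sym (ring e))) (ring′ e)
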